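{- If $t\ge 2$, $n\ge 20t^2+31t+12$ and $\pi=(d_1,\ldots,d_n)$ is a graphic sequence with $\sigma(\pi)>4tn-4t^2-2t$, then $\pi$ has a realization containing every 2-tree on $3t+2$ vertices as a subgraph.
   Context: A simple graph $G$ is a 2-tree if $G=K_3$, or $G$ has a vertex $v$ of degree 2 whose two neighbors are adjacent and $G-v$ is a 2-tree. A non-increasing sequence $\pi=(d_1,\ldots,d_n)$ of nonnegative integers is graphic if it is the degree sequence of some simple graph on $n$ vertices, called a realization of $\pi$. We write $\sigma(\pi)=d_1+\cdots+d_n$. -}

module Defs where

open import Data.Nat using (ℕ; zero; suc; _+_; _*_; _≤_; _<_; _≥_)
open import Data.Fin using (Fin; punchIn)
import Data.Fin
open import Data.Bool using (Bool; true; false; if_then_else_)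
open import Data.List using (List; map; allFin)
open import Data.Nat.ListAction using (sum)
open import Data.Product using (Σ; ∃; _×_; _,_)
open import Data.Sum using (_⊎_)
open import Relation.Binary.PropositionalEquality using (_≡_; _≢_)
open import Function.Definitions using (Injective)

record Graph (n : ℕ) : Set where
  field
    adj    : Fin n → Fin n → Bool
    sym    : ∀ i j → adj i j ≡ adj j i
    irrefl : ∀ i → adj i i ≡ false
open Graph public

Adj : ∀ {n} → Graph n → Fin n → Fin n → Set
Adj G i j = adj G i j ≡ true

degree : ∀ {n} → Graph n → Fin n → ℕ
degree {n} G i = sum (map (λ j → if adj G i j then 1 else 0) (allFin n))

deleteVertex : ∀ {m} → Graph (suc m) → Fin (suc m) → Graph m
deleteVertex G v = record
  { adj    = λ i j → adj G (punchIn v i) (punchIn v j)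
  ; sym    = λ i j → sym G (punchIn v i) (punchIn v j)
  ; irrefl = λ i → irrefl G (punchIn v i)
  }

IsK3 : Graph 3 → Set
IsK3 G = ∀ i j → i ≢ j → Adj G i j

data IsTwoTree : (m : ℕ) → Graph m → Set where
  base : (G : Graph 3) → IsK3 G → IsTwoTree 3 G
  step : ∀ {m} (G : Graph (suc m)) (v : Fin (suc m)) →
         degree G v ≡ 2 →
         (∀ a b → Adj G v a → Adj G v b → a ≢ b → Adj G a b) →
         IsTwoTree m (deleteVertex G v) →
         IsTwoTree (suc m) G

ContainsSubgraph : ∀ {n m} → Graph n → Graph m → Set
ContainsSubgraph {n} {m} G H =
  Σ (Fin m → Fin n) λ f → Injective _≡_ _≡_ f × (∀ i j → Adj H i j → Adj G (f i) (f j))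

-- Sequences of length n, indexed by Fin n (d_1 is at index zero).
NonIncreasing : ∀ {n} → (Fin n → ℕ) → Set
NonIncreasing {n} π = ∀ (i j : Fin n) → Data.Fin._≤_ i j → π j ≤ π i

σ : ∀ {n} → (Fin n → ℕ) → ℕ
σ {n} π = sum (map π (allFin n))

Realization : ∀ {n} → (Fin n → ℕ) → Graph n → Set
Realization π G = ∀ i → degree G i ≡ π i

Graphic : ∀ {n} → (Fin n → ℕ) → Set
Graphic {n} π = NonIncreasing π × Σ (Graph n) (Realization π)

{-# OPTIONS --safe #-}
module Submission where

-- Let k = 3t + 2.  Peeling off vertices with at most two remaining neighbours shows that, for every 0 ≤ j ≤ t, a 2-tree
-- on k vertices splits into 2t − j hubs, a core of 2j + 2 vertices, and t − j pairwise non-adjacent vertices all of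
-- whose neighbours are hubs; if j ≥ 1, the core can be matched up into j + 1 non-adjacent pairs (by 3-colouring, with an
-- extra argument for j = 1).  So one target graph on k vertices contains all these 2-trees: every hub is joined to
-- everything, and the core is complete (j = 0) or complete minus a perfect matching (j ≥ 1).
--
-- The target is planted on the k vertices of largest degree of a realization by degree-preserving switches.  If a target
-- edge uw is missing, then u and w have neighbours x and y along non-target edges, and uw can be gained by
-- ux, wy → uw, xy or by ux, wy, zz′ → uw, xz, yz′ unless the realization is blocked.
-- If only p = 2t − j < 2t degrees exceed 3t, blocking contradicts a count of the edges outside the p hubs.  Otherwise
-- take j = 0 and plant the clique on the hubs, their edges to the other target vertices, and the core edge in turn.  In a
-- blocked realization the neighbours X of u outside the target and the non-hub neighbours Y of w are completely joined,
-- and X or Y is a clique up to one vertex.  Either this yields a clique on k vertices, or all degrees outside the target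
-- are at most 6t + 1, and then the vertices not adjacent to a fixed y ∈ Y contradict the Erdős–Gallai inequality.

open import Defs renaming (sym to adj-sym)
open import Data.Nat using (ℕ; zero; suc; _+_; _*_; _≤_; _<_; z≤n; s≤s; _∸_; _<ᵇ_; _≤?_; _<?_)
open import Data.Nat.Properties as ℕₚ using (≤-refl; ≤-trans; ≤-reflexive; ≤-pred; <-≤-trans; ≤-<-trans; <-irrefl; <⇒≱; ≰⇒>; ≮⇒≥; m≤m+n; m≤n+m; m≤n⇒∃[o]m+o≡n; +-comm; +-assoc; +-identityʳ; +-mono-≤; +-monoˡ-≤; +-monoʳ-≤; +-mono-<-≤; +-mono-≤-<; +-cancelˡ-≤; +-cancelʳ-≤; *-mono-≤; *-monoˡ-≤; *-monoʳ-≤)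
open import Data.Nat.ListAction using () renaming (sum to sumˡ)
open import Data.Nat.Tactic.RingSolver using (solve-∀)
open import Data.Fin using (Fin; zero; suc; toℕ; fromℕ<; punchIn; punchOut)
open import Data.Fin.Properties using (_≟_; any?; suc-injective; toℕ-injective; toℕ-fromℕ<; toℕ<n; punchIn-punchOut; punchIn-injective; punchInᵢ≢i; pigeonhole)
open import Data.Bool using (Bool; true; false; if_then_else_; not; _∧_; _∨_)
import Data.Bool as Bool
open import Data.Bool.Properties using (¬-not)
open import Data.Vec as Vec using ()
open import Data.List using (List; []; _∷_; _++_; length; map; allFin; tabulate)
open import Data.List.Properties using (map-tabulate; length-++; length-map; length-tabulate; ++-assoc)
open import Data.List.Membership.Propositional using (_∈_)
open import Data.List.Membership.Propositional.Properties using (∈-∃++; ∈-++⁺ˡ; ∈-++⁺ʳ; ∈-++⁻; ∈-allFin)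
import Data.List.Membership.DecPropositional as DecMembership
open import Data.List.Relation.Unary.Any using (here; there)
open import Data.List.Relation.Unary.All as All using (All; []; _∷_)
open import Data.List.Relation.Unary.AllPairs using (_∷_)
open import Data.List.Relation.Unary.Unique.Propositional using (Unique)
open import Data.List.Relation.Unary.Unique.Propositional.Properties using (allFin⁺)
open import Data.List.Relation.Binary.Permutation.Propositional as Perm using (_↭_; prep; ↭-refl; ↭-sym; ↭-trans; ↭⇒↭ₛ)
open import Data.List.Relation.Binary.Permutation.Propositional.Properties using (∈-resp-↭; ↭-length; shift; shifts; ++⁺ˡ; ++⁺ʳ; ++-comm)
import Data.List.Relation.Binary.Permutation.Setoid.Properties as Permₛ
open import Data.Product using (Σ; ∃; _×_; _,_; proj₁; proj₂)
open import Data.Sum using (_⊎_; inj₁; inj₂; [_,_]′)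
open import Data.Empty using (⊥; ⊥-elim)
open import Data.Unit using (tt)
open import Function using (_∘_; id)
open import Function.Definitions using (Injective)
open import Relation.Nullary using (¬_; ¬?; Dec; yes; no; does; contradiction; _×-dec_; _⊎-dec_)
open import Relation.Nullary.Decidable using (dec-true; dec-false)
open import Relation.Binary.PropositionalEquality using (_≡_; _≢_; refl; sym; trans; cong; cong₂; subst; subst₂; setoid; module ≡-Reasoning)
open import Algebra.Properties.CommutativeMonoid.Sum ℕₚ.+-0-commutativeMonoid using (sum; sum-cong-≗; ∑-distrib-+; ∑-comm; sum-replicate-zero)
open import Algebra.Properties.Semiring.Sum ℕₚ.+-*-semiring using (*-distribʳ-sum)

-- Finite sums and cardinalities

-- If all degrees after the first 2t + 1 are at most 2t, the Erdős-Gallai inequality gives exactly σ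
-- ≤ 4tn - 4t² - 2t, so the density hypothesis leaves no slack linear in n. The other contradictions
-- rest on a deficit shared by many vertices: measured against the allowance 4t for degree plus hub
-- neighbours, they lose at least one each, and n is large enough for this to outweigh the boundary
-- terms.
--
-- The core loses a matching because of degrees. With p = 2t - j hubs, j ≥ 1, the same inequality
-- guarantees only degree 2t + j on the first 3t + 2 vertices, while a complete core of 2j + 2
-- vertices would ask for p + 2j + 1 = 2t + j + 1. For j = 0, degree 2t + 1 is guaranteed on the
-- first 2t + 2 vertices, just what the core edge needs.
--
-- For j = 1 the colouring can end with a triangle. Three triangles on a common edge have no split
-- into 1 hub and two non-adjacent core pairs, so the scheme fails for t = 1; for t ≥ 2 eight
-- vertices are available to repair it.

infixr 7 _·_

_·_ : Bool → ℕ → ℕ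
b · m = if b then m else 0

𝟙 : Bool → ℕ
𝟙 b = b · 1

∣_∣ : ∀ {n} → (Fin n → Bool) → ℕ
∣ A ∣ = sum (λ i → 𝟙 (A i))

sumˡ-allFin : ∀ {n} (f : Fin n → ℕ) → sumˡ (map f (allFin n)) ≡ sum f
sumˡ-allFin f = trans (cong sumˡ (map-tabulate id f)) (go f)
  where
  go : ∀ {n} (f : Fin n → ℕ) → sumˡ (tabulate f) ≡ sum f
  go {zero}  f = refl
  go {suc n} f = cong (f zero +_) (go (f ∘ suc))

degree-sum : ∀ {n} (G : Graph n) i → degree G i ≡ ∣ adj G i ∣
degree-sum G i = sumˡ-allFin (λ j → 𝟙 (adj G i j))

sum-mono : ∀ {n} {f g : Fin n → ℕ} → (∀ i → f i ≤ g i) → sum f ≤ sum g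
sum-mono {zero}  f≤g = z≤n
sum-mono {suc n} f≤g = +-mono-≤ (f≤g zero) (sum-mono (f≤g ∘ suc))

sum-·ʳ : ∀ {n} (A : Fin n → Bool) c → sum (λ i → A i · c) ≡ ∣ A ∣ * c
sum-·ʳ {n} A c = trans (sum-cong-≗ pt) (sym (*-distribʳ-sum c (λ i → 𝟙 (A i))))
  where
  pt : ∀ i → A i · c ≡ 𝟙 (A i) * c
  pt i with A i
  ... | true  = sym (+-identityʳ c)
  ... | false = refl

·-sum : ∀ {n} b (f : Fin n → ℕ) → b · sum f ≡ sum (λ i → b · f i)
·-sum true  f = refl
·-sum {n} false f = sym (sum-replicate-zero n)

_≡ᵇ_ : ∀ {n} → Fin n → Fin n → Bool
i ≡ᵇ j = does (i ≟ j)

≡ᵇ-refl : ∀ {n} (i : Fin n) → (i ≡ᵇ i) ≡ true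
≡ᵇ-refl i = dec-true (i ≟ i) refl

≢⇒≡ᵇ : ∀ {n} {i j : Fin n} → i ≢ j → (i ≡ᵇ j) ≡ false
≢⇒≡ᵇ {i = i} {j} = dec-false (i ≟ j)

∣singleton∣ : ∀ {n} (v : Fin n) → ∣ v ≡ᵇ_ ∣ ≡ 1
∣singleton∣ {suc n} zero    = cong suc (sum-replicate-zero n)
∣singleton∣ {suc n} (suc v) = trans (sum-cong-≗ pt) (∣singleton∣ v)
  where
  pt : ∀ i → 𝟙 (suc v ≡ᵇ suc i) ≡ 𝟙 (v ≡ᵇ i)
  pt i with v ≟ i
  ... | yes _ = refl
  ... | no  _ = refl

∣full∣ : ∀ {n} → ∣ (λ (_ : Fin n) → true) ∣ ≡ n
∣full∣ {zero}  = refl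
∣full∣ {suc n} = cong suc (∣full∣ {n})

nonempty : ∀ {n} (A : Fin n → Bool) → 1 ≤ ∣ A ∣ → ∃ λ i → A i ≡ true
nonempty {suc n} A p with A zero in eq
... | true  = zero , eq
... | false with nonempty (A ∘ suc) p
...   | i , q = suc i , q

enumerate : ∀ {n} k (A : Fin n → Bool) → k ≤ ∣ A ∣ →
            Σ (Fin k → Fin n) λ f → Injective _≡_ _≡_ f × (∀ i → A (f i) ≡ true)
enumerate zero A p = (λ ()) , (λ {}) , λ ()
enumerate {suc n} (suc k) A p with A zero in eq
... | false with enumerate (suc k) (A ∘ suc) p
...   | f , inj , q = (suc ∘ f) , (λ e → inj (suc-injective e)) , q
enumerate {suc n} (suc k) A (s≤s p) | true with enumerate k (A ∘ suc) p
...   | f , inj , q = g , g-inj , g-A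
  where
  g : Fin (suc k) → Fin (suc n)
  g zero    = zero
  g (suc i) = suc (f i)
  g-inj : Injective _≡_ _≡_ g
  g-inj {zero}  {zero}  _ = refl
  g-inj {suc i} {suc j} e = cong suc (inj (suc-injective e))
  g-A : ∀ i → A (g i) ≡ true
  g-A zero    = eq
  g-A (suc i) = q i

∧-≡true : ∀ {a b} → a ∧ b ≡ true → a ≡ true × b ≡ true
∧-≡true {true} e = refl , e

∧-true : ∀ {a b} → a ≡ true → b ≡ true → a ∧ b ≡ true
∧-true refl refl = refl

≢true⇒false : ∀ {b} → b ≢ true → b ≡ false
≢true⇒false = ¬-not

≡false⇒≢true : ∀ {b} → b ≡ false → b ≢ true
≡false⇒≢true refl ()

not-≡true : ∀ {b} → not b ≡ true → b ≡ false
not-≡true {false} _ = refl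

-- Switching

Adj-sym : ∀ {n} (G : Graph n) {i j} → Adj G i j → Adj G j i
Adj-sym G {i} {j} = trans (adj-sym G j i)

nonadj-sym : ∀ {n} (G : Graph n) {i j} → adj G i j ≡ false → adj G j i ≡ false
nonadj-sym G {i} {j} = trans (adj-sym G j i)

Adj⇒≢ : ∀ {n} (G : Graph n) {i j} → Adj G i j → i ≢ j
Adj⇒≢ G {i} e refl = ≡false⇒≢true (irrefl G i) e

SamePair : ∀ {n} (u v i j : Fin n) → Set
SamePair u v i j = (u ≡ i × v ≡ j) ⊎ (v ≡ i × u ≡ j)

samePair? : ∀ {n} (u v i j : Fin n) → Dec (SamePair u v i j)
samePair? u v i j with (u ≟ i ×-dec v ≟ j) ⊎-dec (v ≟ i ×-dec u ≟ j)
... | yes p = yes p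
... | no ¬p = no ¬p

SamePair-swap : ∀ {n} {u v i j : Fin n} → SamePair u v i j → SamePair u v j i
SamePair-swap (inj₁ (p , q)) = inj₂ (q , p)
SamePair-swap (inj₂ (p , q)) = inj₁ (q , p)

setEdge : ∀ {n} → Graph n → Bool → (u v : Fin n) → u ≢ v → Graph n
setEdge {n} G b u v u≢v = record { adj = a ; sym = a-sym ; irrefl = a-irrefl }
  where
  a : Fin n → Fin n → Bool
  a i j = if does (samePair? u v i j) then b else adj G i j
  a-sym : ∀ i j → a i j ≡ a j i
  a-sym i j with samePair? u v i j | samePair? u v j i
  ... | yes _ | yes _ = refl
  ... | yes p | no ¬q = contradiction (SamePair-swap p) ¬q
  ... | no ¬p | yes q = contradiction (SamePair-swap q) ¬p
  ... | no _  | no _  = adj-sym G i j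
  a-irrefl : ∀ i → a i i ≡ false
  a-irrefl i with samePair? u v i i
  ... | yes (inj₁ (refl , p)) = contradiction (sym p) u≢v
  ... | yes (inj₂ (refl , p)) = contradiction p u≢v
  ... | no _ = irrefl G i

module _ {n : ℕ} (G : Graph n) (u v : Fin n) (u≢v : u ≢ v) where

  setEdge-at : ∀ b → adj (setEdge G b u v u≢v) u v ≡ b
  setEdge-at b rewrite dec-true (samePair? u v u v) (inj₁ (refl , refl)) = refl

  setEdge-off : ∀ b {i j} → ¬ SamePair u v i j → adj (setEdge G b u v u≢v) i j ≡ adj G i j
  setEdge-off b {i} {j} ¬p rewrite dec-false (samePair? u v i j) ¬p = refl

  setEdge-idem : ∀ i j → adj (setEdge G (adj G u v) u v u≢v) i j ≡ adj G i j
  setEdge-idem i j with samePair? u v i j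
  ... | yes (inj₁ (refl , refl)) = refl
  ... | yes (inj₂ (refl , refl)) = adj-sym G u v
  ... | no _ = refl

  setEdge-true-keeps : ∀ {i j} → Adj G i j → Adj (setEdge G true u v u≢v) i j
  setEdge-true-keeps {i} {j} e with samePair? u v i j
  ... | yes _ = refl
  ... | no _  = e

  setEdge-false-keeps : ∀ {i j} → adj G i j ≡ false → adj (setEdge G false u v u≢v) i j ≡ false
  setEdge-false-keeps {i} {j} e with samePair? u v i j
  ... | yes _ = refl
  ... | no _  = e

  private
    ends : Fin n → ℕ
    ends i = 𝟙 (u ≡ᵇ i) + 𝟙 (v ≡ᵇ i)

    -- Comparing the two settings of the pair with each other needs no case split on whether uv is
    -- an edge of `G`. By `setEdge-idem`, `G` is one of the two, which yields both `degree-add` and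
    -- `degree-remove`.
    toggle : ∀ i → degree (setEdge G true u v u≢v) i ≡ degree (setEdge G false u v u≢v) i + ends i
    toggle i = begin
      degree (setEdge G true u v u≢v) i
        ≡⟨ degree-sum (setEdge G true u v u≢v) i ⟩
      ∣ adj (setEdge G true u v u≢v) i ∣
        ≡⟨ sum-cong-≗ pt ⟩
      sum (λ j → 𝟙 (adj (setEdge G false u v u≢v) i j) + (A j + B j))
        ≡⟨ ∑-distrib-+ (λ j → 𝟙 (adj (setEdge G false u v u≢v) i j)) (λ j → A j + B j) ⟩
      ∣ adj (setEdge G false u v u≢v) i ∣ + sum (λ j → A j + B j)
        ≡⟨ cong₂ _+_ (sym (degree-sum (setEdge G false u v u≢v) i)) (trans (∑-distrib-+ A B) (cong₂ _+_ (inner u v) (inner v u))) ⟩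
      degree (setEdge G false u v u≢v) i + ends i ∎
      where
      open ≡-Reasoning
      A B : Fin n → ℕ
      A j = (u ≡ᵇ i) · 𝟙 (v ≡ᵇ j)
      B j = (v ≡ᵇ i) · 𝟙 (u ≡ᵇ j)
      inner : ∀ p q → sum (λ j → (p ≡ᵇ i) · 𝟙 (q ≡ᵇ j)) ≡ 𝟙 (p ≡ᵇ i)
      inner p q = trans (sym (·-sum (p ≡ᵇ i) (λ j → 𝟙 (q ≡ᵇ j)))) (cong ((p ≡ᵇ i) ·_) (∣singleton∣ q))
      pt : ∀ j → 𝟙 (adj (setEdge G true u v u≢v) i j) ≡ 𝟙 (adj (setEdge G false u v u≢v) i j) + (A j + B j)
      pt j with samePair? u v i j
      ... | yes (inj₁ (refl , refl)) rewrite ≡ᵇ-refl u | ≡ᵇ-refl v | ≢⇒≡ᵇ (u≢v ∘ sym) = refl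
      ... | yes (inj₂ (refl , refl)) rewrite ≡ᵇ-refl u | ≡ᵇ-refl v | ≢⇒≡ᵇ u≢v = refl
      ... | no ¬p with u ≟ i | v ≟ j | v ≟ i | u ≟ j
      ...   | yes p | yes q | _     | _     = contradiction (inj₁ (p , q)) ¬p
      ...   | _     | _     | yes p | yes q = contradiction (inj₂ (p , q)) ¬p
      ...   | yes _ | no _  | yes _ | no _  = sym (+-identityʳ _)
      ...   | yes _ | no _  | no _  | _     = sym (+-identityʳ _)
      ...   | no _  | _     | yes _ | no _  = sym (+-identityʳ _)
      ...   | no _  | _     | no _  | _     = sym (+-identityʳ _)

    idem-degree : ∀ {b} → adj G u v ≡ b → ∀ i → degree (setEdge G b u v u≢v) i ≡ degree G i
    idem-degree refl i = trans (degree-sum (setEdge G (adj G u v) u v u≢v) i)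
      (trans (sum-cong-≗ (λ j → cong 𝟙 (setEdge-idem i j))) (sym (degree-sum G i)))

  degree-add : adj G u v ≡ false → ∀ i → degree (setEdge G true u v u≢v) i ≡ degree G i + ends i
  degree-add e i = trans (toggle i) (cong (_+ ends i) (idem-degree e i))

  degree-remove : adj G u v ≡ true → ∀ i → degree G i ≡ degree (setEdge G false u v u≢v) i + ends i
  degree-remove e i = trans (sym (idem-degree e i)) (toggle i)

record Exchange {n} (G : Graph n) (u w : Fin n) (Lost : Fin n → Fin n → Set) : Set where
  field
    graph   : Graph n
    degrees : ∀ i → degree graph i ≡ degree G i
    gained  : Adj graph u w
    kept    : ∀ {a b} → Adj G a b → ¬ Lost a b → Adj graph a b

-- The classical 2-switch: on the alternating 4-cycle u x y w every vertex loses one edge and gains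
-- one. Both deletions precede the additions, so `degree-remove` and `degree-add` always meet the
-- pair in the state they require.
switch₂ : ∀ {n} (G : Graph n) {u x w y : Fin n} → Adj G u x → Adj G w y →
          u ≢ w → adj G u w ≡ false → x ≢ y → adj G x y ≡ false →
          Exchange G u w (λ a b → SamePair u x a b ⊎ SamePair w y a b)
switch₂ {n} G {u} {x} {w} {y} ux wy u≢w uw x≢y xy = record
  { graph   = G₄
  ; degrees = degs
  ; gained  = setEdge-true-keeps G₃ x y x≢y (setEdge-at G₂ u w u≢w true)
  ; kept    = λ {a} {b} ab ¬l →
      setEdge-true-keeps G₃ x y x≢y (setEdge-true-keeps G₂ u w u≢w
        (trans (setEdge-off G₁ w y w≢y false (¬l ∘ inj₂))
          (trans (setEdge-off G u x u≢x false (¬l ∘ inj₁)) ab)))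
  }
  where
  u≢x = Adj⇒≢ G ux
  w≢y = Adj⇒≢ G wy
  G₁ = setEdge G false u x u≢x
  G₂ = setEdge G₁ false w y w≢y
  G₃ = setEdge G₂ true u w u≢w
  G₄ = setEdge G₃ true x y x≢y
  w≢x : w ≢ x
  w≢x refl = ≡false⇒≢true uw ux
  wy₁ : adj G₁ w y ≡ true
  wy₁ = trans (setEdge-off G u x u≢x false
          (λ { (inj₁ (p , _)) → u≢w p ; (inj₂ (p , _)) → w≢x (sym p) })) wy
  uw₂ : adj G₂ u w ≡ false
  uw₂ = setEdge-false-keeps G₁ w y w≢y (setEdge-false-keeps G u x u≢x uw)
  xy₃ : adj G₃ x y ≡ false
  xy₃ = trans (setEdge-off G₂ u w u≢w true
          (λ { (inj₁ (p , _)) → u≢x p ; (inj₂ (p , _)) → w≢x p }))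
        (setEdge-false-keeps G₁ w y w≢y (setEdge-false-keeps G u x u≢x xy))
  arith : ∀ d a b c e → d + (a + b) + (c + e) ≡ d + (b + e) + (a + c)
  arith = solve-∀
  degs : ∀ i → degree G₄ i ≡ degree G i
  degs i
    rewrite degree-add G₃ x y x≢y xy₃ i | degree-add G₂ u w u≢w uw₂ i
          | degree-remove G u x u≢x ux i | degree-remove G₁ w y w≢y wy₁ i
    = arith (degree G₂ i) (𝟙 (u ≡ᵇ i)) (𝟙 (w ≡ᵇ i)) (𝟙 (x ≡ᵇ i)) (𝟙 (y ≡ᵇ i))

-- x ∉ N[z] and y ∉ N[z′] are the only conditions needed: x ≡ y, z ≡ w and z′ ≡ u are harmless.
switch₃ : ∀ {n} (G : Graph n) {u x w y z z′ : Fin n} → Adj G u x → Adj G w y → Adj G z z′ →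
          u ≢ w → adj G u w ≡ false → x ≢ z → adj G x z ≡ false → y ≢ z′ → adj G y z′ ≡ false →
          Exchange G u w (λ a b → SamePair u x a b ⊎ SamePair w y a b ⊎ SamePair z z′ a b)
switch₃ {n} G {u} {x} {w} {y} {z} {z′} ux wy zz u≢w uw x≢z xz y≢z′ yz′ = record
  { graph   = G₆
  ; degrees = degs
  ; gained  = setEdge-true-keeps G₅ y z′ y≢z′ (setEdge-true-keeps G₄ x z x≢z (setEdge-at G₃ u w u≢w true))
  ; kept    = λ {a} {b} ab ¬l →
      setEdge-true-keeps G₅ y z′ y≢z′ (setEdge-true-keeps G₄ x z x≢z (setEdge-true-keeps G₃ u w u≢w
        (trans (setEdge-off G₂ z z′ z≢z′ false (¬l ∘ inj₂ ∘ inj₂))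
          (trans (setEdge-off G₁ w y w≢y false (¬l ∘ inj₂ ∘ inj₁))
            (trans (setEdge-off G u x u≢x false (¬l ∘ inj₁)) ab)))))
  }
  where
  u≢x = Adj⇒≢ G ux
  w≢y = Adj⇒≢ G wy
  z≢z′ = Adj⇒≢ G zz
  G₁ = setEdge G false u x u≢x
  G₂ = setEdge G₁ false w y w≢y
  G₃ = setEdge G₂ false z z′ z≢z′
  G₄ = setEdge G₃ true u w u≢w
  G₅ = setEdge G₄ true x z x≢z
  G₆ = setEdge G₅ true y z′ y≢z′
  w≢x : w ≢ x
  w≢x refl = ≡false⇒≢true uw ux
  y≢u : y ≢ u
  y≢u refl = ≡false⇒≢true (nonadj-sym G uw) wy
  z≢u : z ≢ u
  z≢u refl = ≡false⇒≢true xz (Adj-sym G ux)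
  z′≢w : z′ ≢ w
  z′≢w refl = ≡false⇒≢true yz′ (Adj-sym G wy)
  down : ∀ {a b} → adj G a b ≡ false → adj G₃ a b ≡ false
  down e = setEdge-false-keeps G₂ z z′ z≢z′ (setEdge-false-keeps G₁ w y w≢y (setEdge-false-keeps G u x u≢x e))
  wy₁ : adj G₁ w y ≡ true
  wy₁ = trans (setEdge-off G u x u≢x false
          (λ { (inj₁ (p , _)) → u≢w p ; (inj₂ (p , _)) → w≢x (sym p) })) wy
  zz₂ : adj G₂ z z′ ≡ true
  zz₂ = trans (setEdge-off G₁ w y w≢y false
          (λ { (inj₁ (_ , p)) → y≢z′ p ; (inj₂ (_ , p)) → z′≢w (sym p) }))
        (trans (setEdge-off G u x u≢x false
          (λ { (inj₁ (p , _)) → z≢u (sym p) ; (inj₂ (p , _)) → x≢z p })) zz)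
  uw₃ : adj G₃ u w ≡ false
  uw₃ = down uw
  xz₄ : adj G₄ x z ≡ false
  xz₄ = trans (setEdge-off G₃ u w u≢w true
          (λ { (inj₁ (p , _)) → u≢x p ; (inj₂ (p , _)) → w≢x p })) (down xz)
  yz₅ : adj G₅ y z′ ≡ false
  -- The two added edges could coincide only as x = y, z = z′ or as z = y, x = z′. The first
  -- contradicts that zz′ is an edge; in the second zz′ would be the non-edge yz′.
  yz₅ = trans (setEdge-off G₄ x z x≢z true
          (λ { (inj₁ (_ , p)) → z≢z′ p
             ; (inj₂ (refl , refl)) → ≡false⇒≢true yz′ zz }))
        (trans (setEdge-off G₃ u w u≢w true
          (λ { (inj₁ (p , _)) → y≢u (sym p) ; (inj₂ (p , _)) → w≢y p })) (down yz′))
  arith : ∀ d a b c e f g → d + (a + b) + (c + e) + (f + g) ≡ d + (e + g) + (b + f) + (a + c)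
  arith = solve-∀
  degs : ∀ i → degree G₆ i ≡ degree G i
  degs i
    rewrite degree-add G₅ y z′ y≢z′ yz₅ i | degree-add G₄ x z x≢z xz₄ i | degree-add G₃ u w u≢w uw₃ i
          | degree-remove G u x u≢x ux i | degree-remove G₁ w y w≢y wy₁ i | degree-remove G₂ z z′ z≢z′ zz₂ i
    = arith (degree G₃ i) (𝟙 (u ≡ᵇ i)) (𝟙 (w ≡ᵇ i)) (𝟙 (x ≡ᵇ i)) (𝟙 (z ≡ᵇ i)) (𝟙 (y ≡ᵇ i)) (𝟙 (z′ ≡ᵇ i))

-- Improving switches and progress towards a target

sum-mono-< : ∀ {n} {f g : Fin n → ℕ} → (∀ i → f i ≤ g i) → ∀ i → f i < g i → sum f < sum g
sum-mono-< f≤g zero    p = +-mono-<-≤ p (sum-mono (f≤g ∘ suc))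
sum-mono-< f≤g (suc i) p = +-mono-≤-< (f≤g zero) (sum-mono-< (f≤g ∘ suc) i p)

Rel : ℕ → Set
Rel n = Fin n → Fin n → Bool

infix 4 _⊑_ _⊆_
_⊑_ : ∀ {n} → Rel n → Rel n → Set
S ⊑ T = ∀ {a b} → S a b ≡ true → T a b ≡ true

Symmetricᵇ : ∀ {n} → Rel n → Set
Symmetricᵇ T = ∀ a b → T a b ≡ T b a

_⊆_ : ∀ {n} → Rel n → Graph n → Set
T ⊆ G = T ⊑ adj G

record Improved {n} (T : Rel n) (G : Graph n) (u w : Fin n) : Set where
  field
    graph   : Graph n
    degrees : ∀ i → degree graph i ≡ degree G i
    gained  : Adj graph u w
    kept    : ∀ {a b} → T a b ≡ true → Adj G a b → Adj graph a b

module _ {n : ℕ} {T : Rel n} (T-sym : Symmetricᵇ T) where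

  avoids : ∀ {u x a b} → T u x ≡ false → T a b ≡ true → ¬ SamePair u x a b
  avoids e t (inj₁ (refl , refl)) = ≡false⇒≢true e t
  avoids e t (inj₂ (refl , refl)) = ≡false⇒≢true (trans (T-sym _ _) e) t

  improve₂ : ∀ (G : Graph n) {u x w y} → Adj G u x → Adj G w y → u ≢ w → adj G u w ≡ false →
             x ≢ y → adj G x y ≡ false → T u x ≡ false → T w y ≡ false → Improved T G u w
  improve₂ G ux wy u≢w uw x≢y xy tux twy = record
    { graph = graph ; degrees = degrees ; gained = gained
    ; kept = λ t ab → kept ab [ avoids tux t , avoids twy t ]′ }
    where open Exchange (switch₂ G ux wy u≢w uw x≢y xy)

  improve₃ : ∀ (G : Graph n) {u x w y z z′} → Adj G u x → Adj G w y → Adj G z z′ → u ≢ w → adj G u w ≡ false →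
             x ≢ z → adj G x z ≡ false → y ≢ z′ → adj G y z′ ≡ false →
             T u x ≡ false → T w y ≡ false → T z z′ ≡ false → Improved T G u w
  improve₃ G ux wy zz u≢w uw x≢z xz y≢z′ yz′ tux twy tzz = record
    { graph = graph ; degrees = degrees ; gained = gained
    ; kept = λ t ab → kept ab [ avoids tux t , [ avoids twy t , avoids tzz t ]′ ]′ }
    where open Exchange (switch₃ G ux wy zz u≢w uw x≢z xz y≢z′ yz′)

module _ {n : ℕ} (π : Fin n → ℕ) (T T₀ : Rel n) (T₀⊑T : T₀ ⊑ T) {Goal : Set}
  (step : ∀ G → Realization π G → T₀ ⊆ G → ∀ {u w} → T u w ≡ true → adj G u w ≡ false → Improved T G u w ⊎ Goal) where

  private
    missing : Graph n → Rel n
    missing G a b = T a b ∧ not (adj G a b)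

    μ : Graph n → ℕ
    μ G = sum (λ a → ∣ missing G a ∣)

    μ-decreases : ∀ G {u w} → T u w ≡ true → adj G u w ≡ false → (I : Improved T G u w) → μ (Improved.graph I) < μ G
    μ-decreases G {u} {w} t e I = sum-mono-< (λ a → sum-mono (pt a)) u (sum-mono-< (pt u) w strict)
      where
      open Improved I
      pt : ∀ a b → 𝟙 (missing graph a b) ≤ 𝟙 (missing G a b)
      pt a b with T a b in ta | adj G a b in ga
      ... | false | _     = z≤n
      ... | true  | false with adj graph a b
      ...   | true  = z≤n
      ...   | false = ≤-refl
      pt a b | true | true rewrite kept ta ga = z≤n
      strict : 𝟙 (missing graph u w) < 𝟙 (missing G u w)
      strict rewrite t | e | gained = ≤-refl

    search : ∀ m G → Realization π G → T₀ ⊆ G → μ G ≤ m → (Σ (Graph n) λ G′ → Realization π G′ × T ⊆ G′) ⊎ Goal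
    search m G r s μ≤ with any? (λ a → any? (λ b → missing G a b Bool.≟ true))
    ... | no none = inj₁ (G , r , λ {a} {b} t → found a b t)
      where
      found : ∀ a b → T a b ≡ true → Adj G a b
      found a b t with adj G a b in e
      ... | true  = refl
      ... | false = contradiction (a , b , ∧-true t (cong not e)) none
    ... | yes (u , w , e) with T u w in t | adj G u w in g
    ...   | true | false with step G r s t g
    ...     | inj₂ goal = inj₂ goal
    ...     | inj₁ I with m
    ...       | zero  = contradiction (<-≤-trans (μ-decreases G t g I) μ≤) λ ()
    ...       | suc m′ = search m′ (Improved.graph I) (λ i → trans (Improved.degrees I i) (r i))
                  (λ t₀ → Improved.kept I (T₀⊑T t₀) (s t₀))
                  (≤-pred (<-≤-trans (μ-decreases G t g I) μ≤))

  -- Each improvement lowers the number `μ` of missing ordered target pairs: none is lost and uw is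
  -- gained. `T₀` is what an earlier stage has planted; being part of `T` it survives, so `step` may
  -- rely on it. `Goal` is the way out when a blocked realization already settles the problem.
  realize : ∀ G → Realization π G → T₀ ⊆ G → (Σ (Graph n) λ G′ → Realization π G′ × T ⊆ G′) ⊎ Goal
  realize G r s = search (μ G) G r s ≤-refl

-- Degree counts

below : ∀ {n} → ℕ → Fin n → Bool
below m i = toℕ i <ᵇ m

below⇒< : ∀ {n m} {i : Fin n} → below m i ≡ true → toℕ i < m
below⇒< {m = m} {i} e = ℕₚ.<ᵇ⇒< (toℕ i) m (subst Bool.T (sym e) tt)

<⇒below : ∀ {n m} {i : Fin n} → toℕ i < m → below m i ≡ true
<⇒below {m = m} {i} p with below m i | ℕₚ.<⇒<ᵇ p
... | true | _ = refl

¬below⇒≥ : ∀ {n m} {i : Fin n} → below m i ≡ false → m ≤ toℕ i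
¬below⇒≥ e = ≮⇒≥ (λ p → ≡false⇒≢true e (<⇒below p))

≥⇒¬below : ∀ {n m} {i : Fin n} → m ≤ toℕ i → below m i ≡ false
≥⇒¬below p = ≢true⇒false (λ e → <⇒≱ (below⇒< e) p)

∣below∣ : ∀ {n} m → m ≤ n → ∣ below {n} m ∣ ≡ m
∣below∣ {zero}  zero    _       = refl
∣below∣ {suc n} zero    _       = ∣below∣ {n} zero z≤n
∣below∣ {suc n} (suc m) (s≤s p) = cong suc (∣below∣ {n} m p)

∣∣-mono : ∀ {n} (A B : Fin n → Bool) → (∀ i → A i ≡ true → B i ≡ true) → ∣ A ∣ ≤ ∣ B ∣
∣∣-mono A B A⊆B = sum-mono pt
  where
  pt : ∀ i → 𝟙 (A i) ≤ 𝟙 (B i)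
  pt i with A i in a
  ... | false = z≤n
  ... | true rewrite A⊆B i a = ≤-refl

∣∣-mono-< : ∀ {n} (A B : Fin n → Bool) → (∀ i → A i ≡ true → B i ≡ true) →
            ∀ i → A i ≡ false → B i ≡ true → ∣ A ∣ < ∣ B ∣
∣∣-mono-< A B A⊆B i a b = sum-mono-< pt i strict
  where
  pt : ∀ i → 𝟙 (A i) ≤ 𝟙 (B i)
  pt i with A i in a
  ... | false = z≤n
  ... | true rewrite A⊆B i a = ≤-refl
  strict : 𝟙 (A i) < 𝟙 (B i)
  strict rewrite a | b = ≤-refl

term≤sum : ∀ {n} (f : Fin n → ℕ) i → f i ≤ sum f
term≤sum f zero    = m≤m+n _ _
term≤sum f (suc i) = ≤-trans (term≤sum (f ∘ suc) i) (m≤n+m _ _)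

sum-split : ∀ {n} (A : Fin n → Bool) (f : Fin n → ℕ) →
            sum f ≡ sum (λ i → A i · f i) + sum (λ i → not (A i) · f i)
sum-split A f = trans (sum-cong-≗ pt) (∑-distrib-+ (λ i → A i · f i) (λ i → not (A i) · f i))
  where
  pt : ∀ i → f i ≡ A i · f i + not (A i) · f i
  pt i with A i
  ... | true  = sym (+-identityʳ _)
  ... | false = refl

sum-+₃ : ∀ {n} (f g h : Fin n → ℕ) → sum (λ i → f i + g i + h i) ≡ sum f + sum g + sum h
sum-+₃ f g h = trans (∑-distrib-+ (λ i → f i + g i) h) (cong (_+ sum h) (∑-distrib-+ f g))

sum-+₄ : ∀ {n} (f g h k : Fin n → ℕ) → sum (λ i → f i + g i + h i + k i) ≡ sum f + sum g + sum h + sum k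
sum-+₄ f g h k = trans (∑-distrib-+ (λ i → f i + g i + h i) k) (cong (_+ sum k) (sum-+₃ f g h))

∣not∣ : ∀ {n} (A : Fin n → Bool) → ∣ A ∣ + ∣ not ∘ A ∣ ≡ n
∣not∣ {n} A = trans (sym (trans (sum-cong-≗ pt) (∑-distrib-+ (𝟙 ∘ A) (𝟙 ∘ not ∘ A)))) (∣full∣ {n})
  where
  pt : ∀ i → 1 ≡ 𝟙 (A i) + 𝟙 (not (A i))
  pt i with A i
  ... | true  = refl
  ... | false = refl

module Neighbourhoods {n : ℕ} (G : Graph n) where

  deg : Fin n → ℕ
  deg v = ∣ adj G v ∣

  nb : (Fin n → Bool) → Fin n → ℕ
  nb P v = ∣ (λ h → P h ∧ adj G v h) ∣

  deg-split : ∀ P v → deg v ≡ nb P v + nb (not ∘ P) v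
  deg-split P v = trans (sum-cong-≗ pt) (∑-distrib-+ (λ h → 𝟙 (P h ∧ adj G v h)) (λ h → 𝟙 (not (P h) ∧ adj G v h)))
    where
    pt : ∀ h → 𝟙 (adj G v h) ≡ 𝟙 (P h ∧ adj G v h) + 𝟙 (not (P h) ∧ adj G v h)
    pt h with P h
    ... | true  = sym (+-identityʳ _)
    ... | false = refl

  nb≤∣∣ : ∀ P v → nb P v ≤ ∣ P ∣
  nb≤∣∣ P v = ∣∣-mono (λ h → P h ∧ adj G v h) P (λ h e → proj₁ (∧-≡true e))

  nb≤deg : ∀ P v → nb P v ≤ deg v
  nb≤deg P v = ∣∣-mono (λ h → P h ∧ adj G v h) (adj G v) (λ h e → proj₂ (∧-≡true {P h} e))

  -- By double counting, the degrees in `P` sum to the total of `nb P` over all vertices, and the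
  -- share of `P` itself is at most ∣P∣(∣P∣ - 1). Keeping `nb P v` instead of the usual minimum of
  -- degree and ∣P∣ lets later counts exploit vertices that miss hubs.
  erdős-gallai : ∀ P → sum deg + ∣ P ∣ ≤ ∣ P ∣ * ∣ P ∣ + sum (λ v → not (P v) · (deg v + nb P v))
  erdős-gallai P = begin
    sum deg + ∣ P ∣
      ≡⟨ cong (_+ ∣ P ∣) (trans (sum-split P deg) (cong (_+ out) (trans double (sum-split P (nb P))))) ⟩
    inn + out′ + out + ∣ P ∣
      ≡⟨ rearrange inn out′ out ∣ P ∣ ⟩
    (inn + ∣ P ∣) + (out + out′)
      ≤⟨ +-mono-≤ inner (≤-reflexive (trans (sym (∑-distrib-+ (λ v → not (P v) · deg v) (λ v → not (P v) · nb P v)))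
           (sum-cong-≗ (λ v → ·-+ (not (P v)))))) ⟩
    ∣ P ∣ * ∣ P ∣ + sum (λ v → not (P v) · (deg v + nb P v)) ∎
    where
    open ℕₚ.≤-Reasoning
    inn = sum (λ v → P v · nb P v)
    out = sum (λ v → not (P v) · deg v)
    out′ = sum (λ v → not (P v) · nb P v)
    rearrange : ∀ a b c d → a + b + c + d ≡ (a + d) + (c + b)
    rearrange = solve-∀
    ·-+ : ∀ b {x y} → b · x + b · y ≡ b · (x + y)
    ·-+ true  = refl
    ·-+ false = refl
    double : sum (λ v → P v · deg v) ≡ sum (nb P)
    double = trans (sum-cong-≗ (λ v → ·-sum (P v) (λ h → 𝟙 (adj G v h))))
      (trans (∑-comm (λ v h → P v · 𝟙 (adj G v h))) (sum-cong-≗ (λ h → sum-cong-≗ (λ v → flip-adj h v))))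
      where
      flip-adj : ∀ h v → P v · 𝟙 (adj G v h) ≡ 𝟙 (P v ∧ adj G h v)
      flip-adj h v rewrite adj-sym G v h with P v
      ... | true  = refl
      ... | false = refl
    inner : inn + ∣ P ∣ ≤ ∣ P ∣ * ∣ P ∣
    inner = ≤-trans (≤-reflexive (sym (∑-distrib-+ (λ v → P v · nb P v) (𝟙 ∘ P))))
      (≤-trans (sum-mono pt) (≤-reflexive (sum-·ʳ P ∣ P ∣)))
      where
      nb< : ∀ v → P v ≡ true → nb P v < ∣ P ∣
      nb< v e = ∣∣-mono-< (λ h → P h ∧ adj G v h) P (λ h q → proj₁ (∧-≡true q)) v not-self e
        where
        not-self : P v ∧ adj G v v ≡ false
        not-self rewrite e = irrefl G v
      pt : ∀ v → P v · nb P v + 𝟙 (P v) ≤ P v · ∣ P ∣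
      pt v with P v in e
      ... | false = z≤n
      ... | true  = ≤-trans (≤-reflexive (+-comm _ 1)) (nb< v e)

  clo : Fin n → Fin n → Bool
  clo x z = (x ≡ᵇ z) ∨ adj G x z

  clo-false : ∀ {x z} → clo x z ≡ false → x ≢ z × adj G x z ≡ false
  clo-false {x} {z} e with x ≟ z
  ... | no p = p , e

  clo-self : ∀ x → clo x x ≡ true
  clo-self x rewrite ≡ᵇ-refl x = refl

  adj⇒clo : ∀ {x z} → Adj G x z → clo x z ≡ true
  adj⇒clo {x} {z} e with x ≟ z
  ... | yes _ = refl
  ... | no _  = e

  clo⇒adj : ∀ {x z} → x ≢ z → clo x z ≡ true → Adj G x z
  clo⇒adj {x} {z} x≢z e with x ≟ z
  ... | yes p = contradiction p x≢z
  ... | no _  = e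

  clo-sym : ∀ {x z} → clo x z ≡ true → clo z x ≡ true
  clo-sym {x} {z} e with x ≟ z
  ... | yes refl = clo-self x
  ... | no _     = adj⇒clo (Adj-sym G e)

  ∣clo∣ : ∀ x → ∣ clo x ∣ ≡ suc (deg x)
  ∣clo∣ x = trans (trans (sum-cong-≗ pt) (∑-distrib-+ (λ z → 𝟙 (x ≡ᵇ z)) (λ z → 𝟙 (adj G x z)))) (cong (_+ deg x) (∣singleton∣ x))
    where
    pt : ∀ z → 𝟙 (clo x z) ≡ 𝟙 (x ≡ᵇ z) + 𝟙 (adj G x z)
    pt z with x ≟ z
    ... | yes refl rewrite irrefl G x = refl
    ... | no _     = refl

  -- If N[x] contained N(w), then u would make an inclusion strict: N(w) ⊂ N(x) when x and w are
  -- non-adjacent, N[w] ⊂ N[x] otherwise. Either way deg w < deg x.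
  private-neighbour : ∀ {u x w} → Adj G u x → adj G u w ≡ false → u ≢ w → x ≢ w → deg x ≤ deg w →
                      ∃ λ y → Adj G w y × clo x y ≡ false
  private-neighbour {u} {x} {w} ux uw u≢w x≢w dx≤dw
    with any? (λ y → (adj G w y ∧ not (clo x y)) Bool.≟ true)
  ... | yes (y , e) = y , proj₁ (∧-≡true e) , not-≡true (proj₂ (∧-≡true {adj G w y} e))
  private-neighbour {u} {x} {w} ux uw u≢w x≢w dx≤dw | no none = contradiction dx≤dw (<⇒≱ less)
    where
    covered : ∀ y → Adj G w y → clo x y ≡ true
    covered y wy with clo x y in e
    ... | true  = refl
    ... | false = contradiction (y , ∧-true wy (cong not e)) none
    wu : adj G w u ≡ false
    wu = nonadj-sym G uw
    less : deg w < deg x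
    less with adj G x w in xw
    ... | false = ∣∣-mono-< (adj G w) (adj G x) (λ j wj → clo⇒adj (λ { refl → ≡false⇒≢true (nonadj-sym G xw) wj }) (covered j wj))
                    u wu (Adj-sym G ux)
    ... | true  = ℕₚ.≤-pred (subst (_≤ suc (deg x)) (cong suc (∣clo∣ w)) (subst (∣ clo w ∣ <_) (∣clo∣ x)
                    (∣∣-mono-< (clo w) (clo x) sub u (w≁u) (adj⇒clo (Adj-sym G ux)))))
      where
      w≁u : clo w u ≡ false
      w≁u rewrite ≢⇒≡ᵇ (u≢w ∘ sym) = wu
      sub : ∀ j → clo w j ≡ true → clo x j ≡ true
      sub j e with w ≟ j
      ... | yes refl = adj⇒clo xw
      ... | no _     = covered j e

-- Arithmetic behind the blocked case with 2t hubs

slack : ∀ {a b} c → a + c ≡ b → a ≤ b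
slack c refl = m≤m+n _ c

-- (ℓ − 1)(2t − ℓ) ≥ 0
ℓ²-bound : ∀ t ℓ → 1 ≤ ℓ → ℓ ≤ 2 * t → ℓ * ℓ + 2 * t ≤ (2 * t + 1) * ℓ
ℓ²-bound t ℓ 1≤ℓ ℓ≤2t with m≤n⇒∃[o]m+o≡n 1≤ℓ | m≤n⇒∃[o]m+o≡n ℓ≤2t
... | a , refl | b , e rewrite sym e = ≤-trans (m≤m+n _ (a * b)) (≤-reflexive (id₁ a b))
  where
  id₁ : ∀ a b → (1 + a) * (1 + a) + (1 + a + b) + a * b ≡ (1 + a + b + 1) * (1 + a)
  id₁ = solve-∀

-- The left side is quadratic in ℓ with leading coefficient 6t + 2. Adding 6t + 2 times `ℓ²-bound`
-- removes ℓ², and for ℓ = 1 + a the remaining difference has non-negative coefficients. At ℓ = 1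
-- both sides begin with 40t²; this is where the coefficient 20 in the bound on n is used up.
stuck-polynomial : ∀ t ℓ → 1 ≤ ℓ → ℓ ≤ 2 * t →
  (4 * t + 2 + ℓ) * (3 * t + 1) + (4 * t + 1) * (ℓ * (3 * t + 1) + 3 * t)
    + (ℓ * (3 * t + 1) + t) * (t + 2) + 2 * ℓ * (ℓ * (3 * t + 1) + 3 * t)
  ≤ 2 * ℓ * (20 * (t * t) + 28 * t + 10)
stuck-polynomial t ℓ 1≤ℓ ℓ≤2t with ℓ²-bound t ℓ 1≤ℓ ℓ≤2t | m≤n⇒∃[o]m+o≡n 1≤ℓ
... | sq | a , refl = +-cancelʳ-≤ ((6 * t + 2) * ((2 * t + 1) * ℓ)) _ _
  (≤-trans (slack (12 * t + 12 + a * (13 * (t * t) + 23 * t + 14)) (id₂ t a))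
    (+-monoʳ-≤ (2 * ℓ * (20 * (t * t) + 28 * t + 10)) (*-monoʳ-≤ (6 * t + 2) sq)))
  where
  id₂ : ∀ t a →
    (4 * t + 2 + (1 + a)) * (3 * t + 1) + (4 * t + 1) * ((1 + a) * (3 * t + 1) + 3 * t)
    + ((1 + a) * (3 * t + 1) + t) * (t + 2) + 2 * (1 + a) * ((1 + a) * (3 * t + 1) + 3 * t) + (6 * t + 2) * ((2 * t + 1) * (1 + a))
    + (12 * t + 12 + a * (13 * (t * t) + 23 * t + 14))
    ≡ 2 * (1 + a) * (20 * (t * t) + 28 * t + 10) + (6 * t + 2) * ((1 + a) * (1 + a) + 2 * t)
  id₂ = solve-∀

-- D′, m and q stand for deg u, n and s, each reduced by 2t. The bound on X makes deg u, and hence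
-- B, at most E. So Z is at least N - E, where N is the lower bound on n minus 3t + 2, and the 2ℓ
-- saved on each vertex of Z covers all other terms.
stuck-arithmetic : ∀ t ℓ q D′ m Z B X κ → 1 ≤ ℓ → ℓ ≤ 2 * t → q ≤ t + 2 →
  20 * (t * t) + 31 * t + 12 ≤ 2 * t + m → m ≤ Z + B + q → B ≤ 2 * t + D′ →
  2 * t + D′ + 2 ≤ X + (2 * t + q) → X ≤ ℓ * (3 * t + 1) → κ ≤ (4 * t + 2 + ℓ) * (3 * t + 1) →
  ¬ (2 * ℓ * Z < κ + (4 * t + 1) * B + D′ * q)
stuck-arithmetic t ℓ q D′ m Z B X κ 1≤ℓ ℓ≤2t q≤ n≤ m≤ B≤ D≤ X≤ κ≤ lt = <-irrefl refl (begin-strict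
  2 * ℓ * N
    ≤⟨ *-monoʳ-≤ (2 * ℓ) N≤Z+E ⟩
  2 * ℓ * (Z + E)
    ≡⟨ ℕₚ.*-distribˡ-+ (2 * ℓ) Z E ⟩
  2 * ℓ * Z + 2 * ℓ * E
    <⟨ ℕₚ.+-monoˡ-< (2 * ℓ * E) lt ⟩
  κ + (4 * t + 1) * B + D′ * q + 2 * ℓ * E
    ≤⟨ +-monoˡ-≤ (2 * ℓ * E) (+-mono-≤ (+-mono-≤ κ≤ (*-monoʳ-≤ (4 * t + 1) (≤-trans B≤ D≤E))) (*-mono-≤ D′≤ q≤)) ⟩
  (4 * t + 2 + ℓ) * (3 * t + 1) + (4 * t + 1) * E + (ℓ * (3 * t + 1) + t) * (t + 2) + 2 * ℓ * E
    ≤⟨ stuck-polynomial t ℓ 1≤ℓ ℓ≤2t ⟩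
  2 * ℓ * N ∎)
  where
  open ℕₚ.≤-Reasoning
  E = ℓ * (3 * t + 1) + 3 * t
  N = 20 * (t * t) + 28 * t + 10
  id₁ : ∀ e t → e + (2 * t + (t + 2)) ≡ e + 3 * t + 2
  id₁ = solve-∀
  id₂ : ∀ e t → e + 3 * t ≡ 2 * t + (e + t)
  id₂ = solve-∀
  id₃ : ∀ t z e → 2 * t + (z + e + (t + 2)) ≡ z + e + (3 * t + 2)
  id₃ = solve-∀
  id₄ : ∀ t → 20 * (t * t) + 28 * t + 10 + (3 * t + 2) ≡ 20 * (t * t) + 31 * t + 12
  id₄ = solve-∀
  D≤E : 2 * t + D′ ≤ E
  D≤E = +-cancelʳ-≤ 2 _ _ (≤-trans D≤ (≤-trans (+-mono-≤ X≤ (+-monoʳ-≤ (2 * t) q≤)) (≤-reflexive (id₁ (ℓ * (3 * t + 1)) t))))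
  D′≤ : D′ ≤ ℓ * (3 * t + 1) + t
  D′≤ = +-cancelˡ-≤ (2 * t) _ _ (≤-trans D≤E (≤-reflexive (id₂ (ℓ * (3 * t + 1)) t)))
  N≤Z+E : N ≤ Z + E
  N≤Z+E = +-cancelʳ-≤ (3 * t + 2) _ _ (≤-trans (≤-reflexive (id₄ t)) (≤-trans n≤
    (≤-trans (+-monoʳ-≤ (2 * t) (≤-trans m≤ (+-mono-≤ (+-monoʳ-≤ Z (≤-trans B≤ D≤E)) q≤))) (≤-reflexive (id₃ t Z E)))))

-- Blocked realizations

Clique : ∀ {n} → Graph n → (Fin n → Bool) → Set
Clique G C = ∀ {a b} → C a ≡ true → C b ≡ true → a ≢ b → Adj G a b

module _ {n : ℕ} (G : Graph n) where
  open Neighbourhoods G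

  -- One analysis serves every stage: `s` is 2t while the hubs become a clique and 3t + 2
  -- afterwards; u is a hub or the first core vertex. `S1` and `S2` express that neither switch for
  -- uw is available. `P₁` collects the hubs that miss some vertex of X; the key point is that
  -- vertices of Z see none of them.
  module Stuck (t s : ℕ) (1≤t : 1 ≤ t) (2t≤s : 2 * t ≤ s) (s≤3t+2 : s ≤ 3 * t + 2) (s≤n : s ≤ n)
    (n≥ : 20 * (t * t) + 31 * t + 12 ≤ n)
    (dense : 4 * t * n < sum deg + 4 * (t * t) + 2 * t)
    (u w x₀ y : Fin n)
    (u∈S : below s u ≡ true) (w∈S : below s w ≡ true) (u≢w : u ≢ w) (uw : adj G u w ≡ false)
    (deg≤w : ∀ v → below s v ≡ false → deg v ≤ deg w)
    (deg≤u : ∀ v → below (2 * t) v ≡ false → deg v ≤ deg u)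
    (deg≤P : ∀ h v → below (2 * t) h ≡ true → below (2 * t) v ≡ false → deg v ≤ deg h)
    (2t≤deg-u : 2 * t ≤ deg u)
    (ux₀ : Adj G u x₀) (x₀∉S : below s x₀ ≡ false)
    (wy : Adj G w y) (y∉P : below (2 * t) y ≡ false)
    (S1 : ∀ {a b} → Adj G u a → below s a ≡ false → Adj G w b → below (2 * t) b ≡ false → clo a b ≡ true)
    (S2 : ∀ {a b z z′} → Adj G u a → below s a ≡ false → Adj G w b → below (2 * t) b ≡ false →
          Adj G z z′ → below s z ≡ false ⊎ below s z′ ≡ false → clo a z ≡ false → clo b z′ ≡ true)
    where

    private
      P S X Y Z B P₁ K : Fin n → Bool
      P = below (2 * t)
      S = below s
      X v = not (S v) ∧ adj G u v
      Y v = not (P v) ∧ adj G w v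
      Z v = not (S v) ∧ not (clo y v)
      B v = not (S v) ∧ clo y v
      P₁ h = P h ∧ does (any? (λ v → (X v ∧ not (adj G h v)) Bool.≟ true))
      K v = not (P v) ∧ clo x₀ v

      ℓ = ∣ P₁ ∣

      2t≤n : 2 * t ≤ n
      2t≤n = ≤-trans 2t≤s s≤n

      P⇒S : ∀ v → P v ≡ true → S v ≡ true
      P⇒S v e = <⇒below {i = v} (<-≤-trans (below⇒< {i = v} e) 2t≤s)

      ¬S⇒¬P : ∀ v → S v ≡ false → P v ≡ false
      ¬S⇒¬P v e = ≢true⇒false (λ p → ≡false⇒≢true e (P⇒S v p))

      X-out : ∀ {v} → X v ≡ true → S v ≡ false × Adj G u v
      X-out {v} e = let p , q = ∧-≡true {not (S v)} e in not-≡true p , q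

      X-in : ∀ {v} → S v ≡ false → Adj G u v → X v ≡ true
      X-in p q = ∧-true (cong not p) q

      P₁-out : ∀ {h} → P₁ h ≡ true → P h ≡ true × ∃ λ x → X x ≡ true × adj G h x ≡ false
      P₁-out {h} e with any? (λ v → (X v ∧ not (adj G h v)) Bool.≟ true) | ∧-≡true {P h} e
      ... | yes (x , q) | p , _ = p , x , proj₁ (∧-≡true q) , not-≡true (proj₂ (∧-≡true {X x} q))

      P₁-in : ∀ {h x} → P h ≡ true → X x ≡ true → adj G h x ≡ false → P₁ h ≡ true
      P₁-in {h} {x} p q e with any? (λ v → (X v ∧ not (adj G h v)) Bool.≟ true)
      ... | yes _ = ∧-true p refl
      ... | no ¬q = contradiction (x , ∧-true q (cong not e)) ¬q

      P₁⇒P : ∀ h → P₁ h ≡ true → P h ≡ true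
      P₁⇒P h e = proj₁ (P₁-out {h} e)

      ℓ≤2t : ℓ ≤ 2 * t
      ℓ≤2t = subst (ℓ ≤_) (∣below∣ (2 * t) 2t≤n) (∣∣-mono P₁ P P₁⇒P)

      -- Since deg x ≤ deg w, `private-neighbour` yields a neighbour of w outside N[x]. `S1` forbids
      -- this for a non-hub, so it is a hub.
      misses-P : ∀ {x} → X x ≡ true → ∃ λ h → P₁ h ≡ true × adj G h x ≡ false
      misses-P {x} e with X-out {x} e
      ... | x∉S , ux with private-neighbour ux uw u≢w x≢w (deg≤w x x∉S)
        where
        x≢w : x ≢ w
        x≢w refl = ≡false⇒≢true x∉S w∈S
      ...   | h , wh , xh with P h in p
      ...     | true  = h , P₁-in p e hx , hx
        where
        hx = nonadj-sym G (proj₂ (clo-false xh))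
      ...     | false = contradiction (S1 ux x∉S wh p) (≡false⇒≢true xh)

      -- The edge hv serves as third edge of the switch: h misses some x in X, so `S2` puts v into
      -- N[y]. Thus N(h) outside S lies in `B`.
      P₁-clo : ∀ {h v} → P₁ h ≡ true → S v ≡ false → Adj G h v → clo y v ≡ true
      P₁-clo {h} {v} e v∉S hv with P₁-out {h} e
      ... | p , x , xX , hx with X-out {x} xX
      ...   | x∉S , ux = S2 ux x∉S wy y∉P hv (inj₂ v∉S) xh
        where
        xh : clo x h ≡ false
        xh rewrite ≢⇒≡ᵇ {i = x} {h} (λ { refl → ≡false⇒≢true (¬S⇒¬P x x∉S) p }) = nonadj-sym G hx

      -- If k were outside N[x], then `S2` applied to the edge kz would place z in N[y], against z
      -- in Z.
      Z-nbr : ∀ {z k x} → Z z ≡ true → Adj G z k → X x ≡ true → clo x k ≡ true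
      Z-nbr {z} {k} {x} e zk xX with X-out {x} xX | ∧-≡true {not (S z)} e | clo x k in xk
      ... | _          | _       | true  = refl
      ... | x∉S , ux   | z∉S , q | false =
        contradiction (S2 ux x∉S wy y∉P (Adj-sym G zk) (inj₂ (not-≡true z∉S)) xk) (≡false⇒≢true (not-≡true q))

      ∣P∣ : ∣ P ∣ ≡ 2 * t
      ∣P∣ = ∣below∣ (2 * t) 2t≤n

      ∣S∣ : ∣ S ∣ ≡ s
      ∣S∣ = ∣below∣ s s≤n

      1≤ℓ : 1 ≤ ℓ
      1≤ℓ with misses-P {x₀} (X-in x₀∉S ux₀)
      ... | h , e , _ = ≤-trans (≤-reflexive (sym (cong 𝟙 e))) (term≤sum (𝟙 ∘ P₁) h)

      -- X and S together cover N(u), and S also contains u and w, neither of which lies in N(u).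
      deg-u+2≤ : deg u + 2 ≤ ∣ X ∣ + s
      deg-u+2≤ = begin
        deg u + 2
          ≡⟨ sym (+-assoc (deg u) 1 1) ⟩
        deg u + 1 + 1
          ≡⟨ sym (cong₂ (λ a b → deg u + a + b) (∣singleton∣ u) (∣singleton∣ w)) ⟩
        deg u + ∣ u ≡ᵇ_ ∣ + ∣ w ≡ᵇ_ ∣
          ≡⟨ sym (sum-+₃ (λ v → 𝟙 (adj G u v)) (λ v → 𝟙 (u ≡ᵇ v)) (λ v → 𝟙 (w ≡ᵇ v))) ⟩
        sum (λ v → 𝟙 (adj G u v) + 𝟙 (u ≡ᵇ v) + 𝟙 (w ≡ᵇ v))
          ≤⟨ sum-mono pt ⟩
        sum (λ v → 𝟙 (X v) + 𝟙 (S v))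
          ≡⟨ ∑-distrib-+ (𝟙 ∘ X) (𝟙 ∘ S) ⟩
        ∣ X ∣ + ∣ S ∣
          ≡⟨ cong (∣ X ∣ +_) ∣S∣ ⟩
        ∣ X ∣ + s ∎
        where
        open ℕₚ.≤-Reasoning
        pt : ∀ v → 𝟙 (adj G u v) + 𝟙 (u ≡ᵇ v) + 𝟙 (w ≡ᵇ v) ≤ 𝟙 (X v) + 𝟙 (S v)
        pt v with u ≟ v | w ≟ v
        ... | yes refl | yes refl = contradiction refl u≢w
        ... | yes refl | no _ rewrite irrefl G u | u∈S = s≤s z≤n
        ... | no _ | yes refl rewrite uw | w∈S = s≤s z≤n
        ... | no _ | no _ with adj G u v | S v
        ...   | true  | true  = s≤s z≤n
        ...   | true  | false = s≤s z≤n
        ...   | false | _     = z≤n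

      miss : Fin n → Fin n → Bool
      miss h v = B v ∧ not (adj G h v)

      -- By `P₁-clo`, N(h) outside S lies in N[y], and the vertices of `B` missed by h are what is
      -- left of N[y] there. As deg y ≤ deg h, little can be left. The summand 1 is gained from w,
      -- which lies in both N[y] and S.
      miss-bound : ∀ {h} → P₁ h ≡ true → ∣ miss h ∣ + 1 ≤ s
      miss-bound {h} e = +-cancelˡ-≤ (1 + deg h) _ _ (begin
        1 + deg h + (∣ miss h ∣ + 1)
          ≡⟨ rearrange (deg h) (∣ miss h ∣) ⟩
        ∣ miss h ∣ + deg h + 1 + 1
          ≡⟨ sym (cong₂ (λ a b → ∣ miss h ∣ + deg h + a + b) (∣singleton∣ w) (∣singleton∣ h)) ⟩
        ∣ miss h ∣ + deg h + ∣ w ≡ᵇ_ ∣ + ∣ h ≡ᵇ_ ∣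
          ≡⟨ sym (sum-+₄ (λ v → 𝟙 (miss h v)) (λ v → 𝟙 (adj G h v)) (λ v → 𝟙 (w ≡ᵇ v)) (λ v → 𝟙 (h ≡ᵇ v))) ⟩
        sum (λ v → 𝟙 (miss h v) + 𝟙 (adj G h v) + 𝟙 (w ≡ᵇ v) + 𝟙 (h ≡ᵇ v))
          ≤⟨ sum-mono pt ⟩
        sum (λ v → 𝟙 (clo y v) + 𝟙 (S v))
          ≡⟨ trans (∑-distrib-+ (λ v → 𝟙 (clo y v)) (𝟙 ∘ S)) (cong₂ _+_ (∣clo∣ y) ∣S∣) ⟩
        1 + deg y + s
          ≤⟨ +-monoˡ-≤ s (s≤s (deg≤P h y (P₁⇒P h e) y∉P)) ⟩
        1 + deg h + s ∎)
        where
        open ℕₚ.≤-Reasoning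
        rearrange : ∀ a b → 1 + a + (b + 1) ≡ b + a + 1 + 1
        rearrange = solve-∀
        h∈S = P⇒S h (P₁⇒P h e)
        yw : clo y w ≡ true
        yw = adj⇒clo (Adj-sym G wy)
        pt : ∀ v → 𝟙 (miss h v) + 𝟙 (adj G h v) + 𝟙 (w ≡ᵇ v) + 𝟙 (h ≡ᵇ v) ≤ 𝟙 (clo y v) + 𝟙 (S v)
        pt v with w ≟ v | h ≟ v
        ... | yes refl | yes refl rewrite irrefl G w | w∈S | yw = ≤-refl
        ... | yes refl | no _ rewrite w∈S | yw with adj G h w
        ...   | true  = ≤-refl
        ...   | false = s≤s z≤n
        pt v | no _ | yes refl rewrite irrefl G h | h∈S = m≤n+m 1 _
        pt v | no _ | no _ with S v in v∈S | adj G h v in hv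
        ... | true  | true  = m≤n+m 1 _
        ... | true  | false = z≤n
        ... | false | true rewrite P₁-clo {h} e v∈S hv = ≤-refl
        ... | false | false with clo y v
        ...   | true  = ≤-refl
        ...   | false = z≤n

      miss≤ : ∀ {h} → P₁ h ≡ true → ∣ miss h ∣ ≤ 3 * t + 1
      miss≤ {h} e = ≤-pred (≤-trans (≤-reflexive (+-comm 1 _)) (≤-trans (miss-bound {h} e) (≤-trans s≤3t+2 (≤-reflexive (id₁ t)))))
        where
        id₁ : ∀ t → 3 * t + 2 ≡ 1 + (3 * t + 1)
        id₁ = solve-∀

      -- X lies in `B` by `S1`, and each of its vertices is missed by a hub of `P₁`, so the ℓ sets
      -- `miss h` cover X.
      ∣X∣≤ : ∣ X ∣ ≤ ℓ * (3 * t + 1)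
      ∣X∣≤ = begin
        ∣ X ∣
          ≤⟨ sum-mono pt ⟩
        sum (λ v → sum (λ h → P₁ h · 𝟙 (miss h v)))
          ≡⟨ ∑-comm (λ v h → P₁ h · 𝟙 (miss h v)) ⟩
        sum (λ h → sum (λ v → P₁ h · 𝟙 (miss h v)))
          ≤⟨ sum-mono bound ⟩
        sum (λ h → P₁ h · (3 * t + 1))
          ≡⟨ sum-·ʳ P₁ (3 * t + 1) ⟩
        ℓ * (3 * t + 1) ∎
        where
        open ℕₚ.≤-Reasoning
        pt : ∀ v → 𝟙 (X v) ≤ sum (λ h → P₁ h · 𝟙 (miss h v))
        pt v with X v in e
        ... | false = z≤n
        ... | true with misses-P {v} e | X-out {v} e
        ...   | h , p , hv | v∉S , uv =
          ≤-trans (≤-reflexive (sym one)) (term≤sum (λ h → P₁ h · 𝟙 (miss h v)) h)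
          where
          one : P₁ h · 𝟙 (miss h v) ≡ 1
          one rewrite p | v∉S | clo-sym (S1 uv v∉S wy y∉P) | hv = refl
        bound : ∀ h → sum (λ v → P₁ h · 𝟙 (miss h v)) ≤ P₁ h · (3 * t + 1)
        bound h with P₁ h in e
        ... | true  = miss≤ {h} e
        ... | false = ≤-reflexive (sum-replicate-zero n)

      ∣B∣≤deg-u : ∣ B ∣ ≤ deg u
      ∣B∣≤deg-u = ≤-trans (+-cancelʳ-≤ 1 _ _ (begin
        ∣ B ∣ + 1
          ≡⟨ cong (∣ B ∣ +_) (sym (∣singleton∣ w)) ⟩
        ∣ B ∣ + ∣ w ≡ᵇ_ ∣
          ≡⟨ sym (∑-distrib-+ (𝟙 ∘ B) (λ v → 𝟙 (w ≡ᵇ v))) ⟩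
        sum (λ v → 𝟙 (B v) + 𝟙 (w ≡ᵇ v))
          ≤⟨ sum-mono pt ⟩
        ∣ clo y ∣
          ≡⟨ trans (∣clo∣ y) (+-comm 1 _) ⟩
        deg y + 1 ∎)) (deg≤u y y∉P)
        where
        open ℕₚ.≤-Reasoning
        pt : ∀ v → 𝟙 (B v) + 𝟙 (w ≡ᵇ v) ≤ 𝟙 (clo y v)
        pt v with w ≟ v
        ... | yes refl rewrite w∈S | adj⇒clo (Adj-sym G wy) = ≤-refl
        ... | no _ with S v | clo y v
        ...   | true  | _     = z≤n
        ...   | false | true  = ≤-refl
        ...   | false | false = z≤n

      ∣Z∣+∣B∣+∣S∣ : ∣ Z ∣ + ∣ B ∣ + s ≡ n
      ∣Z∣+∣B∣+∣S∣ = trans (cong (∣ Z ∣ + ∣ B ∣ +_) (sym ∣S∣))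
        (trans (sym (sum-+₃ (𝟙 ∘ Z) (𝟙 ∘ B) (𝟙 ∘ S))) (trans (sum-cong-≗ pt) (∣full∣ {n})))
        where
        pt : ∀ v → 𝟙 (Z v) + 𝟙 (B v) + 𝟙 (S v) ≡ 1
        pt v with S v | clo y v
        ... | true  | _     = refl
        ... | false | true  = refl
        ... | false | false = refl

      -- A vertex of Z has no neighbour in `P₁`: such a hub misses some x in X, whereas `Z-nbr`
      -- would put it into N[x]. This deficit of ℓ hubs per vertex of Z drives the contradiction.
      nb-Z : ∀ z → Z z ≡ true → nb P z + ℓ ≤ 2 * t
      nb-Z z e = begin
        nb P z + ℓ
          ≡⟨ sym (∑-distrib-+ (λ h → 𝟙 (P h ∧ adj G z h)) (𝟙 ∘ P₁)) ⟩
        sum (λ h → 𝟙 (P h ∧ adj G z h) + 𝟙 (P₁ h))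
          ≤⟨ sum-mono pt ⟩
        ∣ P ∣
          ≡⟨ ∣P∣ ⟩
        2 * t ∎
        where
        open ℕₚ.≤-Reasoning
        pt : ∀ h → 𝟙 (P h ∧ adj G z h) + 𝟙 (P₁ h) ≤ 𝟙 (P h)
        pt h with P₁ h in p
        ... | false with P h | adj G z h
        ...   | true  | true  = ≤-refl
        ...   | true  | false = z≤n
        ...   | false | _     = z≤n
        pt h | true with P₁-out {h} p
        ... | ph , x , xX , hx rewrite ph with adj G z h in zh
        ...   | false = ≤-refl
        ...   | true  = contradiction (Z-nbr {z} {x = x} e zh xX) (≡false⇒≢true xh)
          where
          xh : clo x h ≡ false
          xh rewrite ≢⇒≡ᵇ {i = x} {h} (λ { refl → ≡false⇒≢true (¬S⇒¬P x (proj₁ (X-out {x} xX))) ph }) = nonadj-sym G hx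

      -- A single neighbour in Z already forces X ⊆ N[k] by `Z-nbr`, in particular k ∈ N[x₀]. The
      -- neighbours of k in Z are disjoint from X, and deg k ≤ deg u with `deg-u+2≤` leaves room for
      -- fewer than s of them.
      Z-neighbours≤ : ∀ k → P k ≡ false → ∣ (λ z → Z z ∧ adj G k z) ∣ ≤ 𝟙 (clo x₀ k) * (3 * t + 1)
      Z-neighbours≤ k k∉P with any? (λ z → (Z z ∧ adj G k z) Bool.≟ true)
      ... | no none = ≤-trans (≤-trans (sum-mono pt) (≤-reflexive (sum-replicate-zero n))) z≤n
        where
        pt : ∀ z → 𝟙 (Z z ∧ adj G k z) ≤ 0
        pt z with Z z ∧ adj G k z in e
        ... | true  = contradiction (z , e) none
        ... | false = z≤n
      ... | yes (z , e) with ∧-≡true {Z z} e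
      ...   | zZ , kz rewrite Z-nbr {z} {x = x₀} zZ (Adj-sym G kz) (X-in {x₀} x₀∉S ux₀) =
        ≤-trans (≤-pred (≤-trans (≤-reflexive (+-comm 1 _)) (≤-trans ZN+1≤s (≤-trans s≤3t+2 (≤-reflexive (id₁ t)))))) (m≤m+n _ _)
        where
        open ℕₚ.≤-Reasoning
        ZN : Fin n → Bool
        ZN v = Z v ∧ adj G k v
        id₁ : ∀ t → 3 * t + 2 ≡ 1 + (3 * t + 1)
        id₁ = solve-∀
        id₂ : ∀ a b → a + (b + 1) ≡ b + a + 1
        id₂ = solve-∀
        id₃ : ∀ a → 1 + a + 1 ≡ a + 2
        id₃ = solve-∀
        pt : ∀ v → 𝟙 (ZN v) + 𝟙 (X v) ≤ 𝟙 (clo k v)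
        pt v with X v in xX
        ... | true = ≤-trans (≤-reflexive (cong (_+ 1) (not-ZN (X-out {v} xX)))) (≤-reflexive (cong 𝟙 (sym kv)))
          where
          kv : clo k v ≡ true
          kv = clo-sym (Z-nbr {z} {x = v} zZ (Adj-sym G kz) xX)
          not-ZN : S v ≡ false × Adj G u v → 𝟙 (ZN v) ≡ 0
          not-ZN (v∉S , uv) with S v | clo y v | clo-sym (S1 uv v∉S wy y∉P)
          ... | true  | _ | _    = refl
          ... | false | _ | refl = refl
        pt v | false with ZN v in e′
        ...   | false = z≤n
        ...   | true  = ≤-reflexive (cong 𝟙 (sym (adj⇒clo (proj₂ (∧-≡true {Z v} e′)))))
        ZN+1≤s : ∣ ZN ∣ + 1 ≤ s
        ZN+1≤s = +-cancelˡ-≤ ∣ X ∣ _ _ (begin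
          ∣ X ∣ + (∣ ZN ∣ + 1)
            ≡⟨ id₂ (∣ X ∣) (∣ ZN ∣) ⟩
          ∣ ZN ∣ + ∣ X ∣ + 1
            ≡⟨ cong (_+ 1) (sym (∑-distrib-+ (𝟙 ∘ ZN) (𝟙 ∘ X))) ⟩
          sum (λ v → 𝟙 (ZN v) + 𝟙 (X v)) + 1
            ≤⟨ +-monoˡ-≤ 1 (sum-mono pt) ⟩
          ∣ clo k ∣ + 1
            ≡⟨ cong (_+ 1) (∣clo∣ k) ⟩
          1 + deg k + 1
            ≤⟨ +-monoˡ-≤ 1 (s≤s (deg≤u k k∉P)) ⟩
          1 + deg u + 1
            ≡⟨ id₃ (deg u) ⟩
          deg u + 2
            ≤⟨ deg-u+2≤ ⟩
          ∣ X ∣ + s ∎)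

      κ : ℕ
      κ = sum (λ z → Z z · nb (not ∘ P) z)

      κ≤ : κ ≤ ∣ K ∣ * (3 * t + 1)
      κ≤ = begin
        κ
          ≡⟨ sum-cong-≗ (λ z → ·-sum (Z z) (λ k → 𝟙 (not (P k) ∧ adj G z k))) ⟩
        sum (λ z → sum (λ k → Z z · 𝟙 (not (P k) ∧ adj G z k)))
          ≡⟨ ∑-comm (λ z k → Z z · 𝟙 (not (P k) ∧ adj G z k)) ⟩
        sum (λ k → sum (λ z → Z z · 𝟙 (not (P k) ∧ adj G z k)))
          ≤⟨ sum-mono col ⟩
        sum (λ k → K k · (3 * t + 1))
          ≡⟨ sum-·ʳ K (3 * t + 1) ⟩
        ∣ K ∣ * (3 * t + 1) ∎
        where
        open ℕₚ.≤-Reasoning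
        to : ∀ b c → 𝟙 c * b ≡ c · b
        to b true  = +-identityʳ b
        to b false = refl
        col : ∀ k → sum (λ z → Z z · 𝟙 (not (P k) ∧ adj G z k)) ≤ K k · (3 * t + 1)
        col k with P k in p
        ... | true  = ≤-trans (≤-reflexive (trans (sum-cong-≗ zero-term) (sum-replicate-zero n))) z≤n
          where
          zero-term : ∀ z → Z z · 0 ≡ 0
          zero-term z with Z z
          ... | true  = refl
          ... | false = refl
        ... | false = ≤-trans (≤-reflexive (sum-cong-≗ flip-adj)) (≤-trans (Z-neighbours≤ k p) (≤-reflexive (to (3 * t + 1) (clo x₀ k))))
          where
          flip-adj : ∀ z → Z z · 𝟙 (adj G z k) ≡ 𝟙 (Z z ∧ adj G k z)
          flip-adj z rewrite adj-sym G z k with Z z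
          ... | true  = refl
          ... | false = refl

      -- A hub outside `P₁` is adjacent to all of X, hence to x₀; so N[x₀] contains `K` and all but
      -- ℓ hubs.
      ∣K∣+2t≤ : ∣ K ∣ + 2 * t ≤ 1 + deg x₀ + ℓ
      ∣K∣+2t≤ = begin
        ∣ K ∣ + 2 * t
          ≡⟨ cong (∣ K ∣ +_) (sym ∣P∣) ⟩
        ∣ K ∣ + ∣ P ∣
          ≡⟨ sym (∑-distrib-+ (𝟙 ∘ K) (𝟙 ∘ P)) ⟩
        sum (λ v → 𝟙 (K v) + 𝟙 (P v))
          ≤⟨ sum-mono pt ⟩
        sum (λ v → 𝟙 (clo x₀ v) + 𝟙 (P₁ v))
          ≡⟨ ∑-distrib-+ (λ v → 𝟙 (clo x₀ v)) (𝟙 ∘ P₁) ⟩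
        ∣ clo x₀ ∣ + ℓ
          ≡⟨ cong (_+ ℓ) (∣clo∣ x₀) ⟩
        1 + deg x₀ + ℓ ∎
        where
        open ℕₚ.≤-Reasoning
        pt : ∀ v → 𝟙 (K v) + 𝟙 (P v) ≤ 𝟙 (clo x₀ v) + 𝟙 (P₁ v)
        pt v with P v in p
        ... | false with clo x₀ v
        ...   | true  = s≤s z≤n
        ...   | false = z≤n
        pt v | true with any? (λ x → (X x ∧ not (adj G v x)) Bool.≟ true)
        ... | yes _ = m≤n+m 1 _
        ... | no ¬q with clo x₀ v in e
        ...   | true  = s≤s z≤n
        ...   | false = contradiction (x₀ , ∧-true (X-in {x₀} x₀∉S ux₀) (cong not (nonadj-sym G (proj₂ (clo-false e))))) ¬q

      deg-w≤ : deg w ≤ ∣ Y ∣ + 2 * t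
      deg-w≤ = begin
        deg w
          ≤⟨ sum-mono pt ⟩
        sum (λ v → 𝟙 (Y v) + 𝟙 (P v))
          ≡⟨ trans (∑-distrib-+ (𝟙 ∘ Y) (𝟙 ∘ P)) (cong (∣ Y ∣ +_) ∣P∣) ⟩
        ∣ Y ∣ + 2 * t ∎
        where
        open ℕₚ.≤-Reasoning
        pt : ∀ v → 𝟙 (adj G w v) ≤ 𝟙 (Y v) + 𝟙 (P v)
        pt v with P v | adj G w v
        ... | true  | true  = s≤s z≤n
        ... | true  | false = z≤n
        ... | false | true  = s≤s z≤n
        ... | false | false = z≤n

      -- Degrees outside S are at most deg u and at most deg w. A small X bounds the former, a small
      -- Y the latter.
      outside-degrees : ∣ X ∣ ≤ 3 * t + 1 ⊎ ∣ Y ∣ ≤ 3 * t + 2 → ∀ v → S v ≡ false → deg v ≤ 6 * t + 1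
      outside-degrees (inj₁ p) v e = +-cancelʳ-≤ 2 _ _ (begin
        deg v + 2                ≤⟨ +-monoˡ-≤ 2 (deg≤u v (¬S⇒¬P v e)) ⟩
        deg u + 2                ≤⟨ deg-u+2≤ ⟩
        ∣ X ∣ + s                ≤⟨ +-mono-≤ p s≤3t+2 ⟩
        3 * t + 1 + (3 * t + 2)  ≡⟨ id₁ t ⟩
        6 * t + 1 + 2            ∎)
        where
        open ℕₚ.≤-Reasoning
        id₁ : ∀ t → 3 * t + 1 + (3 * t + 2) ≡ 6 * t + 1 + 2
        id₁ = solve-∀
      outside-degrees (inj₂ p) v e = begin
        deg v                ≤⟨ deg≤w v e ⟩
        deg w                ≤⟨ deg-w≤ ⟩
        ∣ Y ∣ + 2 * t        ≤⟨ +-monoˡ-≤ (2 * t) p ⟩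
        3 * t + 2 + 2 * t    ≡⟨ id₁ t ⟩
        5 * t + 1 + 1        ≤⟨ +-monoʳ-≤ (5 * t + 1) 1≤t ⟩
        5 * t + 1 + t        ≡⟨ id₂ t ⟩
        6 * t + 1            ∎
        where
        open ℕₚ.≤-Reasoning
        id₁ : ∀ t → 3 * t + 2 + 2 * t ≡ 5 * t + 1 + 1
        id₁ = solve-∀
        id₂ : ∀ t → 5 * t + 1 + t ≡ 6 * t + 1
        id₂ = solve-∀

      module Count (low : ∀ v → S v ≡ false → deg v ≤ 6 * t + 1) where

        ∣K∣≤ : ∣ K ∣ ≤ 4 * t + 2 + ℓ
        ∣K∣≤ = +-cancelʳ-≤ (2 * t) _ _ (≤-trans ∣K∣+2t≤ (≤-trans (+-monoˡ-≤ ℓ (s≤s (low x₀ x₀∉S))) (≤-reflexive (id₁ t ℓ))))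
          where
          id₁ : ∀ t l → 1 + (6 * t + 1) + l ≡ 4 * t + 2 + l + 2 * t
          id₁ = solve-∀

        D′ m q : ℕ
        D′ = proj₁ (m≤n⇒∃[o]m+o≡n 2t≤deg-u)
        m = proj₁ (m≤n⇒∃[o]m+o≡n 2t≤n)
        q = proj₁ (m≤n⇒∃[o]m+o≡n 2t≤s)

        D≡ : 2 * t + D′ ≡ deg u
        D≡ = proj₂ (m≤n⇒∃[o]m+o≡n 2t≤deg-u)
        n≡ : 2 * t + m ≡ n
        n≡ = proj₂ (m≤n⇒∃[o]m+o≡n 2t≤n)
        s≡ : 2 * t + q ≡ s
        s≡ = proj₂ (m≤n⇒∃[o]m+o≡n 2t≤s)

        S∖P : Fin n → Bool
        S∖P v = not (P v) ∧ S v

        ∣S∖P∣ : ∣ S∖P ∣ ≡ q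
        ∣S∖P∣ = ℕₚ.+-cancelˡ-≡ (2 * t) _ _ (trans (cong (_+ ∣ S∖P ∣) (sym ∣P∣))
          (trans (sym (∑-distrib-+ (𝟙 ∘ P) (𝟙 ∘ S∖P))) (trans (trans (sum-cong-≗ pt) ∣S∣) (sym s≡))))
          where
          pt : ∀ v → 𝟙 (P v) + 𝟙 (S∖P v) ≡ 𝟙 (S v)
          pt v with P v in p
          ... | true rewrite P⇒S v p = refl
          ... | false = refl

        ∣¬P∣ : ∣ not ∘ P ∣ ≡ m
        ∣¬P∣ = ℕₚ.+-cancelˡ-≡ (2 * t) _ _ (trans (cong (_+ ∣ not ∘ P ∣) (sym ∣P∣)) (trans (∣not∣ P) (sym n≡)))

        outer : ℕ
        outer = sum (λ v → not (P v) · (deg v + nb P v))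

        -- Every non-hub has the allowance 4t. Vertices of Z save 2ℓ by `nb-Z`, because a hub
        -- neighbour counts in the degree and again in `nb P`; their non-hub edges are summed in κ.
        -- Vertices of `B` may exceed 4t by 4t + 1, and the q vertices of S outside P by D′.
        outer≤ : outer + ∣ Z ∣ * (2 * ℓ) ≤ m * (4 * t) + κ + ∣ B ∣ * (4 * t + 1) + q * D′
        outer≤ = begin
          outer + ∣ Z ∣ * (2 * ℓ)
            ≡⟨ cong (outer +_) (sym (sum-·ʳ Z (2 * ℓ))) ⟩
          outer + sum (λ v → Z v · (2 * ℓ))
            ≡⟨ sym (∑-distrib-+ (λ v → not (P v) · (deg v + nb P v)) (λ v → Z v · (2 * ℓ))) ⟩
          sum (λ v → not (P v) · (deg v + nb P v) + Z v · (2 * ℓ))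
            ≤⟨ sum-mono pt ⟩
          sum (λ v → not (P v) · (4 * t) + Z v · nb (not ∘ P) v + B v · (4 * t + 1) + S∖P v · D′)
            ≡⟨ sum-+₄ (λ v → not (P v) · (4 * t)) (λ v → Z v · nb (not ∘ P) v) (λ v → B v · (4 * t + 1)) (λ v → S∖P v · D′) ⟩
          sum (λ v → not (P v) · (4 * t)) + κ + sum (λ v → B v · (4 * t + 1)) + sum (λ v → S∖P v · D′)
            ≡⟨ cong₂ _+_ (cong₂ (λ a b → a + κ + b) (trans (sum-·ʳ (not ∘ P) (4 * t)) (cong (_* (4 * t)) ∣¬P∣))
                 (sum-·ʳ B (4 * t + 1))) (trans (sum-·ʳ S∖P D′) (cong (_* D′) ∣S∖P∣)) ⟩
          m * (4 * t) + κ + ∣ B ∣ * (4 * t + 1) + q * D′ ∎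
          where
          open ℕₚ.≤-Reasoning
          nbP≤ : ∀ v → nb P v ≤ 2 * t
          nbP≤ v = subst (nb P v ≤_) ∣P∣ (nb≤∣∣ P v)
          id₁ : ∀ t D → 2 * t + D + 2 * t ≡ 4 * t + 0 + 0 + D
          id₁ = solve-∀
          id₂ : ∀ t → 6 * t + 1 + 2 * t ≡ 4 * t + 0 + (4 * t + 1) + 0
          id₂ = solve-∀
          id₃ : ∀ a b l → a + b + a + 2 * l ≡ (a + l) + (a + l) + b
          id₃ = solve-∀
          id₄ : ∀ t b → 2 * t + 2 * t + b ≡ 4 * t + b + 0 + 0
          id₄ = solve-∀
          pt : ∀ v → not (P v) · (deg v + nb P v) + Z v · (2 * ℓ)
                     ≤ not (P v) · (4 * t) + Z v · nb (not ∘ P) v + B v · (4 * t + 1) + S∖P v · D′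
          pt v with P v in p
          ... | true rewrite P⇒S v p = z≤n
          ... | false with S v in e
          ...   | true = ≤-trans (≤-reflexive (+-identityʳ _)) (≤-trans (+-mono-≤ (≤-trans (deg≤u v p) (≤-reflexive (sym D≡))) (nbP≤ v)) (≤-reflexive (id₁ t D′)))
          ...   | false with clo y v in c
          ...     | true = ≤-trans (≤-reflexive (+-identityʳ _)) (≤-trans (+-mono-≤ (low v e) (nbP≤ v)) (≤-reflexive (id₂ t)))
          ...     | false = begin
            deg v + nb P v + 2 * ℓ
              ≡⟨ cong (λ d → d + nb P v + 2 * ℓ) (deg-split P v) ⟩
            nb P v + nb (not ∘ P) v + nb P v + 2 * ℓ
              ≡⟨ id₃ (nb P v) (nb (not ∘ P) v) ℓ ⟩
            (nb P v + ℓ) + (nb P v + ℓ) + nb (not ∘ P) v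
              ≤⟨ +-monoˡ-≤ (nb (not ∘ P) v) (+-mono-≤ bound bound) ⟩
            2 * t + 2 * t + nb (not ∘ P) v
              ≡⟨ id₄ t (nb (not ∘ P) v) ⟩
            4 * t + nb (not ∘ P) v + 0 + 0 ∎
            where
            bound = nb-Z v (∧-true (cong not e) (cong not c))

        outer> : m * (4 * t) < outer
        outer> = ℕₚ.+-cancelʳ-< (8 * (t * t)) _ _ (begin-strict
          m * (4 * t) + 8 * (t * t)
            ≡⟨ id₁ t m ⟩
          4 * t * (2 * t + m)
            ≡⟨ cong (4 * t *_) n≡ ⟩
          4 * t * n
            <⟨ dense ⟩
          sum deg + 4 * (t * t) + 2 * t
            ≡⟨ id₂ (sum deg) t ⟩
          sum deg + 2 * t + 4 * (t * t)
            ≤⟨ +-monoˡ-≤ (4 * (t * t)) (subst (λ p → sum deg + p ≤ p * p + outer) ∣P∣ (erdős-gallai P)) ⟩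
          2 * t * (2 * t) + outer + 4 * (t * t)
            ≡⟨ id₃ t outer ⟩
          outer + 8 * (t * t) ∎)
          where
          open ℕₚ.≤-Reasoning
          id₁ : ∀ t m → m * (4 * t) + 8 * (t * t) ≡ 4 * t * (2 * t + m)
          id₁ = solve-∀
          id₂ : ∀ a t → a + 4 * (t * t) + 2 * t ≡ a + 2 * t + 4 * (t * t)
          id₂ = solve-∀
          id₃ : ∀ t o → 2 * t * (2 * t) + o + 4 * (t * t) ≡ o + 8 * (t * t)
          id₃ = solve-∀

        impossible : ⊥
        impossible = stuck-arithmetic t ℓ q D′ m (∣ Z ∣) (∣ B ∣) (∣ X ∣) κ 1≤ℓ ℓ≤2t q≤
          (subst (20 * (t * t) + 31 * t + 12 ≤_) (sym n≡) n≥)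
          (≤-reflexive m≡) (subst (∣ B ∣ ≤_) (sym D≡) ∣B∣≤deg-u)
          (subst₂ (λ a b → a + 2 ≤ ∣ X ∣ + b) (sym D≡) (sym s≡) deg-u+2≤) ∣X∣≤
          (≤-trans κ≤ (*-monoˡ-≤ (3 * t + 1) ∣K∣≤))
          (ℕₚ.+-cancelˡ-< (m * (4 * t)) _ _ (begin-strict
            m * (4 * t) + 2 * ℓ * ∣ Z ∣
              <⟨ ℕₚ.+-monoˡ-< (2 * ℓ * ∣ Z ∣) outer> ⟩
            outer + 2 * ℓ * ∣ Z ∣
              ≡⟨ cong (outer +_) (ℕₚ.*-comm (2 * ℓ) (∣ Z ∣)) ⟩
            outer + ∣ Z ∣ * (2 * ℓ)
              ≤⟨ outer≤ ⟩
            m * (4 * t) + κ + ∣ B ∣ * (4 * t + 1) + q * D′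
              ≡⟨ id₁ (m * (4 * t)) κ (∣ B ∣) t q D′ ⟩
            m * (4 * t) + (κ + (4 * t + 1) * ∣ B ∣ + D′ * q) ∎))
          where
          open ℕₚ.≤-Reasoning
          id₁ : ∀ a k b t q d → a + k + b * (4 * t + 1) + q * d ≡ a + (k + (4 * t + 1) * b + d * q)
          id₁ = solve-∀
          id₂ : ∀ t q z → z + (2 * t + q) ≡ 2 * t + (z + q)
          id₂ = solve-∀
          id₃ : ∀ t → 3 * t + 2 ≡ 2 * t + (t + 2)
          id₃ = solve-∀
          q≤ : q ≤ t + 2
          q≤ = +-cancelˡ-≤ (2 * t) _ _ (≤-trans (≤-reflexive s≡) (≤-trans s≤3t+2 (≤-reflexive (id₃ t))))
          m≡ : m ≡ ∣ Z ∣ + ∣ B ∣ + q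
          m≡ = ℕₚ.+-cancelˡ-≡ (2 * t) _ _ (trans n≡ (trans (sym ∣Z∣+∣B∣+∣S∣)
                 (trans (cong (∣ Z ∣ + ∣ B ∣ +_) (sym s≡)) (id₂ t q (∣ Z ∣ + ∣ B ∣)))))

    -- If X and Y are large and X is not a clique, take distinct non-adjacent a, z in X. `S1` joins
    -- z to all of Y, and `S2` with the edge zc, for c in Y, makes c adjacent to every other b in Y.
    -- Only z itself is left out of Y, hence the threshold for Y is one higher than that for X.
    clique : ∃ λ C → 3 * t + 2 ≤ ∣ C ∣ × Clique G C
    clique with ∣ X ∣ ≤? 3 * t + 1 | ∣ Y ∣ ≤? 3 * t + 2
    ... | yes p | _     = ⊥-elim (Count.impossible (outside-degrees (inj₁ p)))
    ... | no _  | yes p = ⊥-elim (Count.impossible (outside-degrees (inj₂ p)))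
    ... | no ¬p | no ¬q with any? (λ a → any? (λ z → (X a ∧ (X z ∧ not (clo a z))) Bool.≟ true))
    ...   | no none = X , ≤-trans (≤-reflexive (id₁ t)) (≰⇒> ¬p) , all-adjacent
      where
      id₁ : ∀ t → 3 * t + 2 ≡ 1 + (3 * t + 1)
      id₁ = solve-∀
      all-adjacent : Clique G X
      all-adjacent {a} {b} xa xb a≢b with clo a b in e
      ... | true  = clo⇒adj a≢b e
      ... | false = contradiction (a , b , ∧-true xa (∧-true xb (cong not e))) none
    ...   | yes (a , z , e) with ∧-≡true {X a} e
    ...     | xa , e′ with ∧-≡true {X z} e′
    ...       | xz , az with X-out {a} xa | X-out {z} xz
    ...         | a∉S , ua | z∉S , uz = Y∖z , size , all-adjacent
      where
      Y∖z : Fin n → Bool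
      Y∖z v = Y v ∧ not (z ≡ᵇ v)
      size : 3 * t + 2 ≤ ∣ Y∖z ∣
      size = +-cancelʳ-≤ 1 _ _ (≤-trans (≤-reflexive (+-comm _ 1)) (≤-trans (≰⇒> ¬q)
        (≤-trans (sum-mono pt) (≤-reflexive (trans (∑-distrib-+ (𝟙 ∘ Y∖z) (λ v → 𝟙 (z ≡ᵇ v))) (cong (∣ Y∖z ∣ +_) (∣singleton∣ z)))))))
        where
        pt : ∀ v → 𝟙 (Y v) ≤ 𝟙 (Y∖z v) + 𝟙 (z ≡ᵇ v)
        pt v with Y v | z ≡ᵇ v
        ... | true  | true  = s≤s z≤n
        ... | true  | false = s≤s z≤n
        ... | false | _     = z≤n
      Y-out : ∀ {v} → Y∖z v ≡ true → P v ≡ false × Adj G w v × z ≢ v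
      Y-out {v} e with ∧-≡true {Y v} e
      ... | p , q with ∧-≡true {not (P v)} p
      ...   | r , wv = not-≡true r , wv , λ { refl → ≡false⇒≢true (not-≡true q) (≡ᵇ-refl z) }
      all-adjacent : Clique G Y∖z
      all-adjacent {b} {c} yb yc b≢c with Y-out {b} yb | Y-out {c} yc
      ... | b∉P , wb , z≢b | c∉P , wc , z≢c =
        clo⇒adj b≢c (S2 ua a∉S wb b∉P (clo⇒adj z≢c (S1 uz z∉S wc c∉P)) (inj₁ z∉S) (not-≡true az))

-- Target relations, and the alternative of improving or being blocked

does⇒ : ∀ {A : Set} (d : Dec A) → does d ≡ true → A
does⇒ (yes a) _ = a

module _ {n : ℕ} (p s : ℕ) {M : ℕ → ℕ → Set} (M? : ∀ a b → Dec (M a b)) where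

  -- For a non-increasing sequence the first s indices carry the largest degrees. The first p of
  -- them are the hubs; `M` describes the core edges in terms of indices.
  InTarget : Fin n → Fin n → Set
  InTarget a b = a ≢ b × toℕ a < s × toℕ b < s × (toℕ a < p ⊎ toℕ b < p ⊎ M (toℕ a) (toℕ b))

  inTarget? : ∀ a b → Dec (InTarget a b)
  inTarget? a b = ¬? (a ≟ b) ×-dec (toℕ a <? s) ×-dec (toℕ b <? s) ×-dec
                  ((toℕ a <? p) ⊎-dec ((toℕ b <? p) ⊎-dec M? (toℕ a) (toℕ b)))

  target : Rel n
  target a b = does (inTarget? a b)

  target⇒ : ∀ {a b} → target a b ≡ true → InTarget a b
  target⇒ {a} {b} = does⇒ (inTarget? a b)

  ⇒target : ∀ {a b} → InTarget a b → target a b ≡ true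
  ⇒target {a} {b} = dec-true (inTarget? a b)

  ¬⇒target : ∀ {a b} → ¬ InTarget a b → target a b ≡ false
  ¬⇒target {a} {b} = dec-false (inTarget? a b)

  ¬target⇒ : ∀ {a b} → target a b ≡ false → ¬ InTarget a b
  ¬target⇒ e q = ≡false⇒≢true e (⇒target q)

  InTarget-sym : (∀ {a b} → M a b → M b a) → ∀ {a b} → InTarget a b → InTarget b a
  InTarget-sym M-sym (a≢b , a<s , b<s , inj₁ x)        = a≢b ∘ sym , b<s , a<s , inj₂ (inj₁ x)
  InTarget-sym M-sym (a≢b , a<s , b<s , inj₂ (inj₁ x)) = a≢b ∘ sym , b<s , a<s , inj₁ x
  InTarget-sym M-sym (a≢b , a<s , b<s , inj₂ (inj₂ x)) = a≢b ∘ sym , b<s , a<s , inj₂ (inj₂ (M-sym x))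

  target-sym : (∀ {a b} → M a b → M b a) → Symmetricᵇ target
  target-sym M-sym a b with target a b in e | target b a in e′
  ... | true  | true  = refl
  ... | false | false = refl
  ... | true  | false = contradiction (InTarget-sym M-sym (target⇒ {a} {b} e)) (¬target⇒ e′)
  ... | false | true  = contradiction (InTarget-sym M-sym (target⇒ {b} {a} e′)) (¬target⇒ e)

module _ {n : ℕ} (T : Rel n) (T-sym : Symmetricᵇ T) (G : Graph n) where
  open Neighbourhoods G

  -- Closed neighbourhoods appear because a switch also fails when two ends that it would join
  -- coincide.
  record Blocked (u w : Fin n) : Set where
    field
      blocked₂ : ∀ {a b} → Adj G u a → T u a ≡ false → Adj G w b → T w b ≡ false → clo a b ≡ true
      blocked₃ : ∀ {a b z z′} → Adj G u a → T u a ≡ false → Adj G w b → T w b ≡ false →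
                 Adj G z z′ → T z z′ ≡ false → clo a z ≡ false → clo b z′ ≡ true

  swap-improved : ∀ {u w} → Improved T G w u → Improved T G u w
  swap-improved I = record { graph = graph ; degrees = degrees ; gained = Adj-sym graph gained ; kept = kept }
    where open Improved I

  improve-or-blocked : ∀ {u w} → u ≢ w → adj G u w ≡ false → Improved T G u w ⊎ Blocked u w
  improve-or-blocked {u} {w} u≢w uw with any? (λ a → any? (λ b → (free u a ∧ (free w b ∧ not (clo a b))) Bool.≟ true))
    where
    free : Fin n → Fin n → Bool
    free v a = adj G v a ∧ not (T v a)
  ... | yes (a , b , e) with ∧-≡true {adj G u a ∧ not (T u a)} e
  ...   | e₁ , e₂ with ∧-≡true {adj G u a} e₁ | ∧-≡true {adj G w b ∧ not (T w b)} e₂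
  ...     | ua , tua | e₃ , ab with ∧-≡true {adj G w b} e₃ | clo-false {a} {b} (not-≡true ab)
  ...       | wb , twb | a≢b , a≁b =
    inj₁ (improve₂ {T = T} T-sym G ua wb u≢w uw a≢b a≁b (not-≡true tua) (not-≡true twb))
  improve-or-blocked {u} {w} u≢w uw | no none₂
    with any? (λ a → any? (λ b → any? (λ z → any? (λ z′ →
           (free u a ∧ (free w b ∧ (free z z′ ∧ (not (clo a z) ∧ not (clo b z′))))) Bool.≟ true))))
    where
    free : Fin n → Fin n → Bool
    free v a = adj G v a ∧ not (T v a)
  ... | yes (a , b , z , z′ , e) with ∧-≡true {adj G u a ∧ not (T u a)} e
  ...   | e₁ , e₂ with ∧-≡true {adj G u a} e₁ | ∧-≡true {adj G w b ∧ not (T w b)} e₂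
  ...     | ua , tua | e₃ , e₄ with ∧-≡true {adj G w b} e₃ | ∧-≡true {adj G z z′ ∧ not (T z z′)} e₄
  ...       | wb , twb | e₅ , e₆ with ∧-≡true {adj G z z′} e₅ | ∧-≡true {not (clo a z)} e₆
  ...         | zz , tzz | az , bz with clo-false {a} {z} (not-≡true az) | clo-false {b} {z′} (not-≡true bz)
  ...           | a≢z , a≁z | b≢z , b≁z =
    inj₁ (improve₃ {T = T} T-sym G ua wb zz u≢w uw a≢z a≁z b≢z b≁z (not-≡true tua) (not-≡true twb) (not-≡true tzz))
  improve-or-blocked {u} {w} u≢w uw | no none₂ | no none₃ = inj₂ (record
    { blocked₂ = λ {a} {b} ua tua wb twb → closed λ e → none₂ (a , b ,
        ∧-true (∧-true ua (cong not tua)) (∧-true (∧-true wb (cong not twb)) (cong not e)))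
    ; blocked₃ = λ {a} {b} {z} {z′} ua tua wb twb zz tzz az → closed λ e → none₃ (a , b , z , z′ ,
        ∧-true (∧-true ua (cong not tua)) (∧-true (∧-true wb (cong not twb))
          (∧-true (∧-true zz (cong not tzz)) (∧-true (cong not az) (cong not e)))))
    })
    where
    closed : ∀ {b} → ¬ (b ≡ false) → b ≡ true
    closed {true}  _ = refl
    closed {false} q = contradiction refl q

module _ {n : ℕ} (G : Graph n) where
  open Neighbourhoods G

  neighbour-outside : ∀ {v} (A : Fin n → Bool) → ∣ A ∣ < deg v → ∃ λ x → Adj G v x × A x ≡ false
  neighbour-outside {v} A lt with any? (λ x → (adj G v x ∧ not (A x)) Bool.≟ true)
  ... | yes (x , e) = x , proj₁ (∧-≡true e) , not-≡true (proj₂ (∧-≡true {adj G v x} e))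
  ... | no none = contradiction (∣∣-mono (adj G v) A sub) (<⇒≱ lt)
    where
    sub : ∀ x → Adj G v x → A x ≡ true
    sub x e with A x in a
    ... | true  = refl
    ... | false = contradiction (x , ∧-true e (cong not a)) none

  -- The non-neighbour u saves one: v has at most ∣A∣ - 1 neighbours in `A`, so a degree equal to
  -- ∣A∣ suffices. The degree bounds used for planting are often no better than that.
  neighbour-outside-≤ : ∀ {v u} (A : Fin n → Bool) → A u ≡ true → adj G v u ≡ false → ∣ A ∣ ≤ deg v →
                        ∃ λ x → Adj G v x × A x ≡ false
  neighbour-outside-≤ {v} {u} A au vu le with neighbour-outside {v} A∖u (<-≤-trans smaller le)
    where
    A∖u : Fin n → Bool
    A∖u x = A x ∧ not (u ≡ᵇ x)
    smaller : ∣ A∖u ∣ < ∣ A ∣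
    smaller = ∣∣-mono-< A∖u A (λ x e → proj₁ (∧-≡true e)) u off au
      where
      off : A∖u u ≡ false
      off rewrite ≡ᵇ-refl u | au = refl
  ... | x , vx , e = x , vx , out
    where
    out : A x ≡ false
    out with A x | u ≟ x
    ... | false | _        = refl
    ... | true  | yes refl = contradiction vx (≡false⇒≢true vu)
    ... | true  | no u≢x   = contradiction e λ ()

-- Planting the target

HasBigClique : ∀ {n} → (Fin n → ℕ) → ℕ → Set
HasBigClique {n} π k = Σ (Graph n) λ G → Realization π G × ∃ λ C → k ≤ ∣ C ∣ × Clique G C

module _ {n : ℕ} {π : Fin n → ℕ} (G : Graph n) (r : Realization π G) where
  open Neighbourhoods G

  deg≡ : ∀ v → deg v ≡ π v
  deg≡ v = trans (sym (degree-sum G v)) (r v)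

  sum-deg : sum deg ≡ sum π
  sum-deg = sum-cong-≗ deg≡

  -- Erdős-Gallai over the first m vertices. The extra allowance e before index m′ admits a stretch
  -- of larger degrees between the head and a uniformly small tail.
  tail-bound : ∀ m k c m′ e → m + k ≡ n → m′ ≤ n →
               (∀ v → below m v ≡ false → deg v + nb (below m) v ≤ c + below m′ v · e) →
               sum π + m ≤ m * m + (k * c + m′ * e)
  tail-bound m k c m′ e m+k≡n m′≤n bound = begin
    sum π + m
      ≡⟨ cong₂ _+_ (sym sum-deg) (sym ∣M∣) ⟩
    sum deg + ∣ M ∣
      ≤⟨ erdős-gallai M ⟩
    ∣ M ∣ * ∣ M ∣ + sum (λ v → not (M v) · (deg v + nb M v))
      ≤⟨ +-mono-≤ (≤-reflexive (cong₂ _*_ ∣M∣ ∣M∣)) (sum-mono pt) ⟩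
    m * m + sum (λ v → not (M v) · c + M′ v · e)
      ≡⟨ cong (m * m +_) (∑-distrib-+ (λ v → not (M v) · c) (λ v → M′ v · e)) ⟩
    m * m + (sum (λ v → not (M v) · c) + sum (λ v → M′ v · e))
      ≡⟨ cong (m * m +_) (cong₂ _+_ (trans (sum-·ʳ (not ∘ M) c) (cong (_* c) ∣¬M∣))
           (trans (sum-·ʳ M′ e) (cong (_* e) (∣below∣ m′ m′≤n)))) ⟩
    m * m + (k * c + m′ * e) ∎
    where
    open ℕₚ.≤-Reasoning
    M M′ : Fin n → Bool
    M = below m
    M′ = below m′
    ∣M∣ : ∣ M ∣ ≡ m
    ∣M∣ = ∣below∣ m (≤-trans (m≤m+n m k) (≤-reflexive m+k≡n))
    ∣¬M∣ : ∣ not ∘ M ∣ ≡ k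
    ∣¬M∣ = ℕₚ.+-cancelˡ-≡ m _ _ (trans (cong (_+ ∣ not ∘ M ∣) (sym ∣M∣)) (trans (∣not∣ M) (sym m+k≡n)))
    pt : ∀ v → not (M v) · (deg v + nb M v) ≤ not (M v) · c + M′ v · e
    pt v with M v in eq
    ... | true  = z≤n
    ... | false = bound v eq

-- With n = 2t + 1 + k the second inequality reads σ ≤ 4tn - 4t² - 2t, the exact negation of the
-- first.
head-arithmetic : ∀ t k σ → 4 * t * (2 * t + 1 + k) < σ + 4 * (t * t) + 2 * t →
                  σ + (2 * t + 1) ≤ (2 * t + 1) * (2 * t + 1) + k * (2 * t + 2 * t) → ⊥
head-arithmetic t k σ dense tail = <-irrefl refl (begin-strict
    4 * t * (2 * t + 1 + k) + (2 * t + 1)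
      <⟨ ℕₚ.+-monoˡ-< (2 * t + 1) dense ⟩
    σ + 4 * (t * t) + 2 * t + (2 * t + 1)
      ≡⟨ id₁ σ t ⟩
    σ + (2 * t + 1) + (4 * (t * t) + 2 * t)
      ≤⟨ +-monoˡ-≤ (4 * (t * t) + 2 * t) tail ⟩
    (2 * t + 1) * (2 * t + 1) + k * (2 * t + 2 * t) + (4 * (t * t) + 2 * t)
      ≡⟨ id₂ t k ⟩
    4 * t * (2 * t + 1 + k) + (2 * t + 1) ∎)
  where
  open ℕₚ.≤-Reasoning
  id₁ : ∀ a t → a + 4 * (t * t) + 2 * t + (2 * t + 1) ≡ a + (2 * t + 1) + (4 * (t * t) + 2 * t)
  id₁ = solve-∀
  id₂ : ∀ t k → (2 * t + 1) * (2 * t + 1) + k * (2 * t + 2 * t) + (4 * (t * t) + 2 * t) ≡ 4 * t * (2 * t + 1 + k) + (2 * t + 1)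
  id₂ = solve-∀

-- Tail degrees below 2t lose 2 per vertex against the allowance 4t, and 2k exceeds the quadratic
-- terms of the head.
core-arithmetic : ∀ t k c σ → 4 * t * (3 * t + 1 + k) < σ + 4 * (t * t) + 2 * t → c < 2 * t →
                  20 * (t * t) + 28 * t + 11 ≤ k →
                  σ + (3 * t + 1) ≤ (3 * t + 1) * (3 * t + 1) + k * (c + c) → ⊥
core-arithmetic t k c σ dense c<2t k≥ tail = <-irrefl refl (begin-strict
  4 * t * (3 * t + 1 + k) + (3 * t + 1) + 2 * k
    <⟨ ℕₚ.+-monoˡ-< (2 * k) (ℕₚ.+-monoˡ-< (3 * t + 1) dense) ⟩
  σ + 4 * (t * t) + 2 * t + (3 * t + 1) + 2 * k
    ≡⟨ id₁ σ t k ⟩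
  σ + (3 * t + 1) + (4 * (t * t) + 2 * t + 2 * k)
    ≤⟨ +-monoˡ-≤ (4 * (t * t) + 2 * t + 2 * k) tail ⟩
  (3 * t + 1) * (3 * t + 1) + k * (c + c) + (4 * (t * t) + 2 * t + 2 * k)
    ≡⟨ id₂ t k c ⟩
  (3 * t + 1) * (3 * t + 1) + (4 * (t * t) + 2 * t) + k * ((1 + c) + (1 + c))
    ≤⟨ +-mono-≤ (slack (27 * (t * t) + 48 * t + 21) (id₃ t)) (*-monoʳ-≤ k (+-mono-≤ c<2t c<2t)) ⟩
  2 * (20 * (t * t) + 28 * t + 11) + k * (2 * t + 2 * t)
    ≤⟨ +-monoˡ-≤ (k * (2 * t + 2 * t)) (*-monoʳ-≤ 2 k≥) ⟩
  2 * k + k * (2 * t + 2 * t)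
    ≤⟨ slack (12 * (t * t) + 7 * t + 1) (id₄ t k) ⟩
  4 * t * (3 * t + 1 + k) + (3 * t + 1) + 2 * k ∎)
  where
  open ℕₚ.≤-Reasoning
  id₁ : ∀ a t k → a + 4 * (t * t) + 2 * t + (3 * t + 1) + 2 * k ≡ a + (3 * t + 1) + (4 * (t * t) + 2 * t + 2 * k)
  id₁ = solve-∀
  id₂ : ∀ t k c → (3 * t + 1) * (3 * t + 1) + k * (c + c) + (4 * (t * t) + 2 * t + 2 * k)
                  ≡ (3 * t + 1) * (3 * t + 1) + (4 * (t * t) + 2 * t) + k * ((1 + c) + (1 + c))
  id₂ = solve-∀
  id₃ : ∀ t → (3 * t + 1) * (3 * t + 1) + (4 * (t * t) + 2 * t) + (27 * (t * t) + 48 * t + 21) ≡ 2 * (20 * (t * t) + 28 * t + 11)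
  id₃ = solve-∀
  id₄ : ∀ t k → 2 * k + k * (2 * t + 2 * t) + (12 * (t * t) + 7 * t + 1) ≡ 4 * t * (3 * t + 1 + k) + (3 * t + 1) + 2 * k
  id₄ = solve-∀

module Dense {n : ℕ} (t : ℕ) (1≤t : 1 ≤ t) (n≥ : 20 * (t * t) + 31 * t + 12 ≤ n)
  (π : Fin n → ℕ) (sorted : NonIncreasing π) (G₀ : Graph n) (r₀ : Realization π G₀)
  (dense : 4 * t * n < sum π + 4 * (t * t) + 2 * t) where

  3t+2≤n : 3 * t + 2 ≤ n
  3t+2≤n = ≤-trans (slack (20 * (t * t) + 28 * t + 10) (id₁ t)) n≥
    where
    id₁ : ∀ t → 3 * t + 2 + (20 * (t * t) + 28 * t + 10) ≡ 20 * (t * t) + 31 * t + 12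
    id₁ = solve-∀

  2t≤n : 2 * t ≤ n
  2t≤n = ≤-trans (slack (t + 2) (id₁ t)) 3t+2≤n
    where
    id₁ : ∀ t → 2 * t + (t + 2) ≡ 3 * t + 2
    id₁ = solve-∀

  private
    tail-2π : ∀ m k c → m + k ≡ n → (∀ v → m ≤ toℕ v → π v ≤ c) → sum π + m ≤ m * m + k * (c + c)
    tail-2π m k c m+k≡n bound = ≤-trans
      (tail-bound G₀ r₀ m k (c + c) 0 0 m+k≡n z≤n λ v e →
        let d≤c = ≤-trans (≤-reflexive (deg≡ G₀ r₀ v)) (bound v (¬below⇒≥ {i = v} e))
        in ≤-trans (+-mono-≤ d≤c (≤-trans (Neighbourhoods.nb≤deg G₀ (below m) v) d≤c)) (m≤m+n (c + c) _))
      (≤-reflexive (cong (m * m +_) (+-identityʳ (k * (c + c)))))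

  degree≥2t+1 : ∀ v → toℕ v < 2 * t + 2 → 2 * t + 1 ≤ π v
  degree≥2t+1 v v< with 2 * t + 1 ≤? π v
  ... | yes p = p
  ... | no ¬p = ⊥-elim (head-arithmetic t (proj₁ rest) (sum π)
      (subst (λ x → 4 * t * x < sum π + 4 * (t * t) + 2 * t) (sym (proj₂ rest)) dense)
      (tail-2π (2 * t + 1) (proj₁ rest) (2 * t) (proj₂ rest) low))
    where
    id₁ : ∀ t → 2 * t + 1 + (t + 1) ≡ 3 * t + 2
    id₁ = solve-∀
    id₂ : ∀ t → 2 * t + 2 ≡ 1 + (2 * t + 1)
    id₂ = solve-∀
    rest : ∃ λ k → 2 * t + 1 + k ≡ n
    rest = m≤n⇒∃[o]m+o≡n (≤-trans (slack (t + 1) (id₁ t)) 3t+2≤n)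
    low : ∀ w → 2 * t + 1 ≤ toℕ w → π w ≤ 2 * t
    low w w≥ = ≤-trans (sorted v w (≤-trans (≤-pred (≤-trans v< (≤-reflexive (id₂ t)))) w≥))
                 (≤-pred (≤-trans (≰⇒> ¬p) (≤-reflexive (+-comm (2 * t) 1))))

  degree≥2t : ∀ v → toℕ v < 3 * t + 2 → 2 * t ≤ π v
  degree≥2t v v< with 2 * t ≤? π v
  ... | yes p = p
  ... | no ¬p = ⊥-elim (core-arithmetic t (proj₁ rest) (π v) (sum π)
      (subst (λ x → 4 * t * x < sum π + 4 * (t * t) + 2 * t) (sym (proj₂ rest)) dense) (≰⇒> ¬p) k≥
      (tail-2π (3 * t + 1) (proj₁ rest) (π v) (proj₂ rest) low))
    where
    id₁ : ∀ t → 3 * t + 1 + 1 ≡ 3 * t + 2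
    id₁ = solve-∀
    id₂ : ∀ t → 20 * (t * t) + 28 * t + 11 + (3 * t + 1) ≡ 20 * (t * t) + 31 * t + 12
    id₂ = solve-∀
    id₃ : ∀ t → 3 * t + 2 ≡ 1 + (3 * t + 1)
    id₃ = solve-∀
    rest : ∃ λ k → 3 * t + 1 + k ≡ n
    rest = m≤n⇒∃[o]m+o≡n (≤-trans (slack 1 (id₁ t)) 3t+2≤n)
    k≥ : 20 * (t * t) + 28 * t + 11 ≤ proj₁ rest
    k≥ = +-cancelʳ-≤ (3 * t + 1) _ _ (≤-trans (≤-reflexive (id₂ t)) (≤-trans n≥
           (≤-reflexive (trans (sym (proj₂ rest)) (+-comm (3 * t + 1) (proj₁ rest))))))
    low : ∀ w → 3 * t + 1 ≤ toℕ w → π w ≤ π v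
    low w w≥ = sorted v w (≤-trans (≤-pred (≤-trans v< (≤-reflexive (id₃ t)))) w≥)

-- At least 2t degrees exceeding 3t: planting in three stages

never : ∀ (a b : ℕ) → Dec ⊥
never _ _ = no λ ()

BothBelow : ℕ → ℕ → ℕ → Set
BothBelow m a b = a < m × b < m

bothBelow? : ∀ m a b → Dec (BothBelow m a b)
bothBelow? m a b = (a <? m) ×-dec (b <? m)

module ManyHighDegrees {n : ℕ} (t : ℕ) (1≤t : 1 ≤ t) (n≥ : 20 * (t * t) + 31 * t + 12 ≤ n)
  (π : Fin n → ℕ) (sorted : NonIncreasing π) (G₀ : Graph n) (r₀ : Realization π G₀)
  (dense : 4 * t * n < sum π + 4 * (t * t) + 2 * t)
  (high : ∀ v → toℕ v < 2 * t → 3 * t + 1 ≤ π v) where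

  open Dense t 1≤t n≥ π sorted G₀ r₀ dense

  private
    Goal : Set
    Goal = HasBigClique π (3 * t + 2)

    module Degrees (G : Graph n) (r : Realization π G) where
      open Neighbourhoods G

      dense′ : 4 * t * n < sum deg + 4 * (t * t) + 2 * t
      dense′ = subst (λ d → 4 * t * n < d + 4 * (t * t) + 2 * t) (sym (sum-deg G r)) dense

      antitone : ∀ {v w} → toℕ v ≤ toℕ w → deg w ≤ deg v
      antitone {v} {w} p = subst₂ _≤_ (sym (deg≡ G r w)) (sym (deg≡ G r v)) (sorted v w p)

      across : ∀ {m v w} → below m v ≡ true → below m w ≡ false → deg w ≤ deg v
      across {m} {v} {w} p q = antitone {v} {w} (ℕₚ.<⇒≤ (<-≤-trans (below⇒< {m = m} {v} p) (¬below⇒≥ {m = m} {w} q)))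

      deg≥ : ∀ {v c} → c ≤ π v → c ≤ deg v
      deg≥ {v} p = ≤-trans p (≤-reflexive (sym (deg≡ G r v)))

    module Join (s : ℕ) (2t≤s : 2 * t ≤ s) (s≤3t+2 : s ≤ 3 * t + 2) where
      T : Rel n
      T = target (2 * t) s never

      T-sym : Symmetricᵇ T
      T-sym = target-sym (2 * t) s never (λ ())

      outside-P : ∀ {v a} → below (2 * t) v ≡ false → below (2 * t) a ≡ false → T v a ≡ false
      outside-P {v} {a} p q = ¬⇒target (2 * t) s never {v} {a} λ
        { (_ , _ , _ , inj₁ x)        → ≡false⇒≢true p (<⇒below {i = v} x)
        ; (_ , _ , _ , inj₂ (inj₁ x)) → ≡false⇒≢true q (<⇒below {i = a} x) }

      outside-Sʳ : ∀ {v a} → below s a ≡ false → T v a ≡ false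
      outside-Sʳ {v} {a} p = ¬⇒target (2 * t) s never {v} {a} λ { (_ , _ , x , _) → ≡false⇒≢true p (<⇒below {i = a} x) }

      outside-Sˡ : ∀ {v a} → below s v ≡ false → T v a ≡ false
      outside-Sˡ {v} {a} p = trans (T-sym v a) (outside-Sʳ {a} {v} p)

      -- `w-free` is the reason for the stages. `Stuck` needs all edges from w to non-hubs to lie
      -- outside the target, which holds if the target lives within the hubs or if w is not a hub.
      -- Hence the edges between hubs come first.
      connect : ∀ {G} → Realization π G → ∀ {u w} → toℕ u < 2 * t → toℕ w < s → u ≢ w → adj G u w ≡ false →
                (∀ {b} → Adj G w b → below (2 * t) b ≡ false → T w b ≡ false) → Improved T G u w ⊎ Goal
      connect {G} r {u} {w} u<2t w<s u≢w uw w-free with improve-or-blocked T T-sym G u≢w uw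
      ... | inj₁ I = inj₁ I
      ... | inj₂ blocked = inj₂ (G , r , Stuck.clique G t s 1≤t 2t≤s s≤3t+2 s≤n n≥ dense′ u w (proj₁ x) (proj₁ y)
          u∈S w∈S u≢w uw
          (λ v e → across {s} {w} {v} w∈S e) (λ v e → across {2 * t} {u} {v} u∈P e) (λ h v p q → across {2 * t} {h} {v} p q)
          (≤-trans 2t≤3t+1 (deg≥ (high u u<2t))) (proj₁ (proj₂ x)) x∉S (proj₁ (proj₂ y)) (proj₂ (proj₂ y))
          (λ {a} ua a∉S wb b∉P → blocked₂ ua (outside-Sʳ {u} {a} a∉S) wb (w-free wb b∉P))
          (λ {a} {b} {z} {z′} ua a∉S wb b∉P zz out → blocked₃ ua (outside-Sʳ {u} {a} a∉S) wb (w-free wb b∉P) zz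
            ([ outside-Sˡ {z} {z′} , outside-Sʳ {z} {z′} ]′ out)))
        where
        open Neighbourhoods G
        open Degrees G r
        open Blocked blocked
        s≤n = ≤-trans s≤3t+2 3t+2≤n
        u∈P = <⇒below {i = u} u<2t
        u∈S = <⇒below {i = u} (<-≤-trans u<2t 2t≤s)
        w∈S = <⇒below {i = w} w<s
        id₁ : ∀ t → 2 * t + (t + 1) ≡ 3 * t + 1
        id₁ = solve-∀
        id₂ : ∀ t → 3 * t + 2 ≡ 1 + (3 * t + 1)
        id₂ = solve-∀
        2t≤3t+1 : 2 * t ≤ 3 * t + 1
        2t≤3t+1 = slack (t + 1) (id₁ t)
        S∖u : Fin n → Bool
        S∖u v = below s v ∧ not (u ≡ᵇ v)
        ∣S∖u∣ : ∣ S∖u ∣ ≤ 3 * t + 1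
        ∣S∖u∣ = ≤-pred (≤-trans (subst (∣ S∖u ∣ <_) (∣below∣ s s≤n)
          (∣∣-mono-< S∖u (below s) (λ v e → proj₁ (∧-≡true e)) u off u∈S)) (≤-trans s≤3t+2 (≤-reflexive (id₂ t))))
          where
          off : S∖u u ≡ false
          off rewrite ≡ᵇ-refl u | u∈S = refl
        w∈S∖u : S∖u w ≡ true
        w∈S∖u = ∧-true w∈S (cong not (≢⇒≡ᵇ u≢w))
        x : ∃ λ x → Adj G u x × S∖u x ≡ false
        -- S without u has at most 3t + 1 vertices and contains the non-neighbour w, so degree 3t +
        -- 1 yields a neighbour outside S.
        x = neighbour-outside-≤ G S∖u w∈S∖u uw (≤-trans ∣S∖u∣ (deg≥ (high u u<2t)))
        x∉S : below s (proj₁ x) ≡ false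
        x∉S = ≢true⇒false λ e → ≡false⇒≢true (proj₂ (proj₂ x)) (∧-true e (cong not (≢⇒≡ᵇ (Adj⇒≢ G (proj₁ (proj₂ x))))))
        y : ∃ λ y → Adj G w y × below (2 * t) y ≡ false
        y = neighbour-outside-≤ G (below (2 * t)) u∈P (nonadj-sym G uw)
              (≤-trans (≤-reflexive (∣below∣ (2 * t) 2t≤n)) (deg≥ (degree≥2t w (<-≤-trans w<s s≤3t+2))))

    2t≤3t+2 : 2 * t ≤ 3 * t + 2
    2t≤3t+2 = slack (t + 2) (id₁ t)
      where
      id₁ : ∀ t → 2 * t + (t + 2) ≡ 3 * t + 2
      id₁ = solve-∀

    module A = Join (2 * t) ≤-refl 2t≤3t+2
    module B = Join (3 * t + 2) 2t≤3t+2 ≤-refl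

    M = BothBelow (2 * t + 2)
    M? = bothBelow? (2 * t + 2)

    T : Rel n
    T = target (2 * t) (3 * t + 2) M?

    T-sym : Symmetricᵇ T
    T-sym = target-sym (2 * t) (3 * t + 2) M? (λ (p , q) → q , p)

    A⊑B : A.T ⊑ B.T
    A⊑B {a} {b} e with target⇒ (2 * t) (2 * t) never {a} {b} e
    ... | a≢b , as , bs , h = ⇒target (2 * t) (3 * t + 2) never {a} {b}
      (a≢b , <-≤-trans as 2t≤3t+2 , <-≤-trans bs 2t≤3t+2 , h)

    B⊑T : B.T ⊑ T
    B⊑T {a} {b} e with target⇒ (2 * t) (3 * t + 2) never {a} {b} e
    ... | a≢b , as , bs , inj₁ x = ⇒target (2 * t) (3 * t + 2) M? {a} {b} (a≢b , as , bs , inj₁ x)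
    ... | a≢b , as , bs , inj₂ (inj₁ x) = ⇒target (2 * t) (3 * t + 2) M? {a} {b} (a≢b , as , bs , inj₂ (inj₁ x))

    empty : Rel n
    empty _ _ = false

    stepA : ∀ G → Realization π G → empty ⊆ G → ∀ {u w} → A.T u w ≡ true → adj G u w ≡ false → Improved A.T G u w ⊎ Goal
    stepA G r _ {u} {w} e uw with target⇒ (2 * t) (2 * t) never e
    ... | u≢w , u<2t , w<2t , _ = A.connect r u<2t w<2t u≢w uw (λ {b} _ b∉P → A.outside-Sʳ {w} {b} b∉P)

    stepB : ∀ G → Realization π G → A.T ⊆ G → ∀ {u w} → B.T u w ≡ true → adj G u w ≡ false → Improved B.T G u w ⊎ Goal
    stepB G r A⊆G {u} {w} e uw with target⇒ (2 * t) (3 * t + 2) never e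
    ... | u≢w , u<s , w<s , inj₁ u<2t = B.connect r u<2t w<s u≢w uw λ {b} _ b∉P → B.outside-P {w} {b} w∉P b∉P
      where
      w∉P : below (2 * t) w ≡ false
      -- Edges between hubs are present since the first stage.
      w∉P = ≢true⇒false λ p → ≡false⇒≢true uw (A⊆G (⇒target (2 * t) (2 * t) never (u≢w , u<2t , below⇒< {i = w} p , inj₁ u<2t)))
    ... | u≢w , u<s , w<s , inj₂ (inj₁ w<2t) with B.connect r w<2t u<s (u≢w ∘ sym) (nonadj-sym G uw)
                                                    (λ {b} _ b∉P → B.outside-P {u} {b} u∉P b∉P)
      where
      u∉P : below (2 * t) u ≡ false
      u∉P = ≢true⇒false λ p → ≡false⇒≢true uw (A⊆G (⇒target (2 * t) (2 * t) never (u≢w , below⇒< {i = u} p , w<2t , inj₂ (inj₁ w<2t))))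
    ...   | inj₁ I    = inj₁ (swap-improved B.T B.T-sym G I)
    ...   | inj₂ goal = inj₂ goal

    module Last {G : Graph n} (r : Realization π G) (B⊆G : B.T ⊆ G) {u w : Fin n} (u≡ : toℕ u ≡ 2 * t) (w≡ : toℕ w ≡ 2 * t + 1)
      (uw : adj G u w ≡ false) where
      open Neighbourhoods G
      open Degrees G r

      u≢w : u ≢ w
      u≢w refl = ℕₚ.1+n≢n (trans (+-comm 1 _) (trans (sym w≡) u≡))

      P S : Fin n → Bool
      P = below (2 * t)
      S = below (3 * t + 2)

      u<2t+2 : toℕ u < 2 * t + 2
      u<2t+2 = ≤-trans (≤-reflexive (cong suc u≡)) (slack 1 (id₁ t))
        where
        id₁ : ∀ t → 1 + 2 * t + 1 ≡ 2 * t + 2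
        id₁ = solve-∀
      w<2t+2 : toℕ w < 2 * t + 2
      w<2t+2 = ≤-reflexive (trans (cong suc w≡) (id₁ t))
        where
        id₁ : ∀ t → 1 + (2 * t + 1) ≡ 2 * t + 2
        id₁ = solve-∀
      2t+2≤3t+2 : 2 * t + 2 ≤ 3 * t + 2
      2t+2≤3t+2 = slack t (id₁ t)
        where
        id₁ : ∀ t → 2 * t + 2 + t ≡ 3 * t + 2
        id₁ = solve-∀

      u∉P : P u ≡ false
      u∉P = ≥⇒¬below {i = u} (≤-reflexive (sym u≡))
      w∉P : P w ≡ false
      w∉P = ≥⇒¬below {i = w} (≤-trans (slack 1 refl) (≤-reflexive (sym w≡)))
      u∈S : S u ≡ true
      u∈S = <⇒below {i = u} (<-≤-trans u<2t+2 2t+2≤3t+2)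
      w∈S : S w ≡ true
      w∈S = <⇒below {i = w} (<-≤-trans w<2t+2 2t+2≤3t+2)

      Q-two : ∀ {v} → P v ≡ false → toℕ v < 2 * t + 2 → v ≡ u ⊎ v ≡ w
      Q-two {v} p q with toℕ v ℕₚ.≟ 2 * t
      ... | yes e = inj₁ (toℕ-injective (trans e (sym u≡)))
      ... | no ¬e = inj₂ (toℕ-injective (trans (ℕₚ.≤-antisym
              (≤-pred (≤-trans q (≤-reflexive (id₁ t)))) (≤-trans (≤-reflexive (+-comm (2 * t) 1)) (ℕₚ.≤∧≢⇒< (¬below⇒≥ {i = v} p) (¬e ∘ sym)))) (sym w≡)))
        where
        id₁ : ∀ t → 2 * t + 2 ≡ 1 + (2 * t + 1)
        id₁ = solve-∀

      -- From u or w the only core edge of the target is uw itself, which is absent from `G`; so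
      -- their edges to non-hubs are free to be switched.
      free : ∀ {v a} → P v ≡ false → Adj G v a → P a ≡ false → toℕ v < 2 * t + 2 → T v a ≡ false
      free {v} {a} v∉P va a∉P v< = ¬⇒target (2 * t) (3 * t + 2) M? {v} {a} λ
        { (_ , _ , _ , inj₁ x)        → ≡false⇒≢true v∉P (<⇒below {i = v} x)
        ; (_ , _ , _ , inj₂ (inj₁ x)) → ≡false⇒≢true a∉P (<⇒below {i = a} x)
        ; (v≢a , _ , _ , inj₂ (inj₂ (_ , a<))) → two v≢a (Q-two v∉P v<) (Q-two a∉P a<) }
        where
        two : v ≢ a → v ≡ u ⊎ v ≡ w → a ≡ u ⊎ a ≡ w → ⊥
        two v≢a (inj₁ refl) (inj₁ refl) = v≢a refl
        two v≢a (inj₂ refl) (inj₂ refl) = v≢a refl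
        two v≢a (inj₁ refl) (inj₂ refl) = ≡false⇒≢true uw va
        two v≢a (inj₂ refl) (inj₁ refl) = ≡false⇒≢true (nonadj-sym G uw) va

      outside-Sʳ : ∀ {v a} → S a ≡ false → T v a ≡ false
      outside-Sʳ {v} {a} p = ¬⇒target (2 * t) (3 * t + 2) M? {v} {a} λ { (_ , _ , x , _) → ≡false⇒≢true p (<⇒below {i = a} x) }

      finish : Blocked T T-sym G u w → Goal
      finish blocked = G , r , Stuck.clique G t (3 * t + 2) 1≤t 2t≤3t+2 ≤-refl 3t+2≤n n≥ dense′ u w (proj₁ x) (proj₁ y)
          u∈S w∈S u≢w uw
          (λ v e → across {3 * t + 2} {w} {v} w∈S e)
          (λ v e → antitone {u} {v} (≤-trans (≤-reflexive u≡) (¬below⇒≥ {i = v} e)))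
          (λ h v p q → across {2 * t} {h} {v} p q)
          (≤-trans (slack 1 refl) (deg≥ (degree≥2t+1 u u<2t+2)))
          (proj₁ (proj₂ x)) (far (proj₁ (proj₂ x)) (proj₂ (proj₂ x))) (proj₁ (proj₂ y)) (proj₂ (proj₂ y))
          (λ {a} {b} ua a∉S wb b∉P → blocked₂ ua (outside-Sʳ {u} {a} a∉S) wb (free {w} {b} w∉P wb b∉P w<2t+2))
          (λ {a} {b} {z} {z′} ua a∉S wb b∉P zz out → blocked₃ ua (outside-Sʳ {u} {a} a∉S) wb (free {w} {b} w∉P wb b∉P w<2t+2) zz
            ([ (λ e → trans (T-sym z z′) (outside-Sʳ {z′} {z} e)) , outside-Sʳ {z} {z′} ]′ out))
        where
        open Blocked blocked
        ∣P∣<deg : ∀ v → toℕ v < 2 * t + 2 → ∣ P ∣ < deg v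
        ∣P∣<deg v v< = ≤-trans (≤-reflexive (trans (cong suc (∣below∣ (2 * t) 2t≤n)) (+-comm 1 (2 * t)))) (deg≥ (degree≥2t+1 v v<))
        x : ∃ λ x → Adj G u x × P x ≡ false
        x = neighbour-outside G P (∣P∣<deg u u<2t+2)
        y : ∃ λ y → Adj G w y × P y ≡ false
        y = neighbour-outside G P (∣P∣<deg w w<2t+2)
        -- A non-hub neighbour x of u inside S comes after w in the order, so `private-neighbour`
        -- applies. The vertex b that it yields violates `blocked₂` if it is not a hub, and an edge
        -- planted in the second stage if it is.
        far : ∀ {x} → Adj G u x → P x ≡ false → S x ≡ false
        far {x} ux x∉P with S x in x∈S
        ... | false = refl
        ... | true with private-neighbour ux uw u≢w x≢w (antitone {w} {x} w≤x)
          where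
          x≢w : x ≢ w
          x≢w refl = ≡false⇒≢true uw ux
          w≤x : toℕ w ≤ toℕ x
          w≤x with toℕ x <? 2 * t + 2
          ... | no ¬x< = ≤-trans (ℕₚ.<⇒≤ w<2t+2) (≮⇒≥ ¬x<)
          ... | yes x< with Q-two x∉P x<
          ...   | inj₁ refl = contradiction refl (Adj⇒≢ G ux)
          ...   | inj₂ refl = ≤-refl
        ...   | b , wb , xb with P b in b∈P
        ...     | false = contradiction (blocked₂ ux (free {u} {x} u∉P ux x∉P u<2t+2) wb (free {w} {b} w∉P wb b∈P w<2t+2)) (≡false⇒≢true xb)
        ...     | true  = contradiction (B⊆G (⇒target (2 * t) (3 * t + 2) never
                    (proj₁ (clo-false xb) , below⇒< {i = x} x∈S , <-≤-trans (below⇒< {i = b} b∈P) 2t≤3t+2 , inj₂ (inj₁ (below⇒< {i = b} b∈P)))))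
                    (≡false⇒≢true (proj₂ (clo-false xb)))

      result : Improved T G u w ⊎ Goal
      result with improve-or-blocked T T-sym G u≢w uw
      ... | inj₁ I = inj₁ I
      ... | inj₂ blocked = inj₂ (finish blocked)

    stepC : ∀ G → Realization π G → B.T ⊆ G → ∀ {u w} → T u w ≡ true → adj G u w ≡ false → Improved T G u w ⊎ Goal
    stepC G r B⊆G {u} {w} e uw with target⇒ (2 * t) (3 * t + 2) M? e
    ... | u≢w , us , ws , inj₁ x = contradiction (B⊆G (⇒target (2 * t) (3 * t + 2) never (u≢w , us , ws , inj₁ x))) (≡false⇒≢true uw)
    ... | u≢w , us , ws , inj₂ (inj₁ x) = contradiction (B⊆G (⇒target (2 * t) (3 * t + 2) never (u≢w , us , ws , inj₂ (inj₁ x)))) (≡false⇒≢true uw)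
    ... | u≢w , us , ws , inj₂ (inj₂ (u< , w<)) = split (position u u∉P u<) (position w w∉P w<)
      where
      u∉P : below (2 * t) u ≡ false
      u∉P = ≢true⇒false λ p → ≡false⇒≢true uw (B⊆G (⇒target (2 * t) (3 * t + 2) never (u≢w , us , ws , inj₁ (below⇒< {i = u} p))))
      w∉P : below (2 * t) w ≡ false
      w∉P = ≢true⇒false λ p → ≡false⇒≢true uw (B⊆G (⇒target (2 * t) (3 * t + 2) never (u≢w , us , ws , inj₂ (inj₁ (below⇒< {i = w} p)))))
      position : ∀ v → below (2 * t) v ≡ false → toℕ v < 2 * t + 2 → toℕ v ≡ 2 * t ⊎ toℕ v ≡ 2 * t + 1
      position v p q with toℕ v ℕₚ.≟ 2 * t
      ... | yes e = inj₁ e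
      ... | no ¬e = inj₂ (ℕₚ.≤-antisym (≤-pred (≤-trans q (≤-reflexive (id₁ t))))
              (≤-trans (≤-reflexive (+-comm (2 * t) 1)) (ℕₚ.≤∧≢⇒< (¬below⇒≥ {i = v} p) (¬e ∘ sym))))
        where
        id₁ : ∀ t → 2 * t + 2 ≡ 1 + (2 * t + 1)
        id₁ = solve-∀
      split : toℕ u ≡ 2 * t ⊎ toℕ u ≡ 2 * t + 1 → toℕ w ≡ 2 * t ⊎ toℕ w ≡ 2 * t + 1 → Improved T G u w ⊎ Goal
      split (inj₁ p) (inj₁ q) = contradiction (toℕ-injective (trans p (sym q))) u≢w
      split (inj₂ p) (inj₂ q) = contradiction (toℕ-injective (trans p (sym q))) u≢w
      split (inj₁ p) (inj₂ q) = Last.result r B⊆G p q uw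
      split (inj₂ p) (inj₁ q) with Last.result r B⊆G q p (nonadj-sym G uw)
      ... | inj₁ I    = inj₁ (swap-improved T T-sym G I)
      ... | inj₂ goal = inj₂ goal

  realization : (Σ (Graph n) λ G → Realization π G × target (2 * t) (3 * t + 2) (bothBelow? (2 * t + 2)) ⊆ G) ⊎ Goal
  realization with realize π A.T empty (λ ()) stepA G₀ r₀ (λ ())
  ... | inj₂ goal = inj₂ goal
  ... | inj₁ (G₁ , r₁ , A⊆) with realize π B.T A.T (λ {a} {b} → A⊑B {a} {b}) stepB G₁ r₁ A⊆
  ...   | inj₂ goal = inj₂ goal
  ...   | inj₁ (G₂ , r₂ , B⊆) = realize π T B.T (λ {a} {b} → B⊑T {a} {b}) stepC G₂ r₂ B⊆

-- A layout lists the first members of the core pairs before the second ones, so partners are j + 1 positions apart.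
Unmatched : ℕ → ℕ → ℕ → ℕ → Set
Unmatched m j a b = BothBelow m a b × b ≢ a + suc j × a ≢ b + suc j

unmatched? : ∀ m j a b → Dec (Unmatched m j a b)
unmatched? m j a b = bothBelow? m a b ×-dec (¬? (b ℕₚ.≟ a + suc j) ×-dec ¬? (a ℕₚ.≟ b + suc j))

-- Fewer than 2t degrees exceeding 3t

module FewHighDegrees {n : ℕ} (t : ℕ) (1≤t : 1 ≤ t) (n≥ : 20 * (t * t) + 31 * t + 12 ≤ n)
  (π : Fin n → ℕ) (sorted : NonIncreasing π) (G₀ : Graph n) (r₀ : Realization π G₀)
  (dense : 4 * t * n < sum π + 4 * (t * t) + 2 * t)
  (p j : ℕ) (p+j≡2t : p + j ≡ 2 * t) (1≤j : 1 ≤ j)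
  (high : ∀ v → toℕ v < p → 3 * t + 1 ≤ π v) (low : ∀ v → p ≤ toℕ v → π v ≤ 3 * t) where

  open Dense t 1≤t n≥ π sorted G₀ r₀ dense using (3t+2≤n; 2t≤n)

  private
    p≤2t : p ≤ 2 * t
    p≤2t = ≤-trans (m≤m+n p j) (≤-reflexive p+j≡2t)

    p≤n : p ≤ n
    p≤n = ≤-trans p≤2t 2t≤n

    k : ℕ
    k = proj₁ (m≤n⇒∃[o]m+o≡n p≤n)

    p+k≡n : p + k ≡ n
    p+k≡n = proj₂ (m≤n⇒∃[o]m+o≡n p≤n)

    k≥ : 20 * (t * t) + 29 * t + 12 ≤ k
    k≥ = +-cancelˡ-≤ (2 * t) _ _ (begin
      2 * t + (20 * (t * t) + 29 * t + 12)  ≡⟨ id₁ t ⟩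
      20 * (t * t) + 31 * t + 12            ≤⟨ n≥ ⟩
      n                                     ≡⟨ sym p+k≡n ⟩
      p + k                                 ≤⟨ +-monoˡ-≤ k p≤2t ⟩
      2 * t + k                             ∎)
      where
      open ℕₚ.≤-Reasoning
      id₁ : ∀ t → 2 * t + (20 * (t * t) + 29 * t + 12) ≡ 20 * (t * t) + 31 * t + 12
      id₁ = solve-∀

    p²≤ : p * p ≤ 4 * t * p
    p²≤ = *-monoˡ-≤ p (≤-trans p≤2t (slack (2 * t) (id₁ t)))
      where
      id₁ : ∀ t → 2 * t + 2 * t ≡ 4 * t
      id₁ = solve-∀

    -- `W` collects contributions of the k vertices after the hubs, on average at least one below
    -- 4t; `e` is the rest. The gain k ≥ 20t² + 29t + 12 pays for the 4t² + 2t of the density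
    -- hypothesis and leaves 16t² + 27t + 12 for `e`.
    too-sparse : ∀ W e → sum π + p ≤ p * p + (W + e) → W + k ≤ k * (4 * t) → e ≤ 16 * (t * t) + 27 * t + 12 → ⊥
    too-sparse W e eg W≤ e≤ = <-irrefl refl (begin-strict
      4 * t * p + (k * (4 * t)) + p
        ≡⟨ id₁ t p k ⟩
      4 * t * (p + k) + p
        ≡⟨ cong (λ x → 4 * t * x + p) p+k≡n ⟩
      4 * t * n + p
        <⟨ ℕₚ.+-monoˡ-< p dense ⟩
      sum π + 4 * (t * t) + 2 * t + p
        ≡⟨ id₂ (sum π) t p ⟩
      sum π + p + (4 * (t * t) + 2 * t)
        ≤⟨ +-monoˡ-≤ (4 * (t * t) + 2 * t) eg ⟩
      p * p + (W + e) + (4 * (t * t) + 2 * t)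
        ≤⟨ +-monoˡ-≤ (4 * (t * t) + 2 * t) (+-mono-≤ p²≤ (+-monoʳ-≤ W e≤)) ⟩
      4 * t * p + (W + (16 * (t * t) + 27 * t + 12)) + (4 * (t * t) + 2 * t)
        ≡⟨ id₃ (4 * t * p) W t ⟩
      4 * t * p + (W + (20 * (t * t) + 29 * t + 12))
        ≤⟨ +-monoʳ-≤ (4 * t * p) (≤-trans (+-monoʳ-≤ W k≥) W≤) ⟩
      4 * t * p + (k * (4 * t))
        ≤⟨ m≤m+n _ p ⟩
      4 * t * p + (k * (4 * t)) + p ∎)
      where
      open ℕₚ.≤-Reasoning
      id₁ : ∀ t p k → 4 * t * p + (k * (4 * t)) + p ≡ 4 * t * (p + k) + p
      id₁ = solve-∀
      id₂ : ∀ a t p → a + 4 * (t * t) + 2 * t + p ≡ a + p + (4 * (t * t) + 2 * t)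
      id₂ = solve-∀
      id₃ : ∀ a w t → a + (w + (16 * (t * t) + 27 * t + 12)) + (4 * (t * t) + 2 * t) ≡ a + (w + (20 * (t * t) + 29 * t + 12))
      id₃ = solve-∀

    nb≤p : ∀ v → Neighbourhoods.nb G₀ (below p) v ≤ p
    nb≤p v = ≤-trans (Neighbourhoods.nb≤∣∣ G₀ (below p) v) (≤-reflexive (∣below∣ p p≤n))

    outside-low : ∀ v → below p v ≡ false → π v ≤ 3 * t
    outside-low v e = low v (¬below⇒≥ {i = v} e)

  -- With fewer than t hubs, every other vertex contributes at most 3t + p ≤ 4t - 1 to Erdős-Gallai.
  j≤t : j ≤ t
  j≤t with t ≤? p
  ... | yes t≤p = +-cancelˡ-≤ p _ _ (≤-trans (≤-reflexive p+j≡2t) (≤-trans (≤-reflexive (id₁ t)) (+-monoˡ-≤ t t≤p)))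
    where
    id₁ : ∀ t → 2 * t ≡ t + t
    id₁ = solve-∀
  ... | no t≰p = ⊥-elim (too-sparse (k * (3 * t + p)) 0
      (tail-bound G₀ r₀ p k (3 * t + p) 0 0 p+k≡n z≤n λ v e →
        ≤-trans (+-mono-≤ (≤-trans (≤-reflexive (deg≡ G₀ r₀ v)) (outside-low v e)) (nb≤p v)) (m≤m+n _ _))
      (≤-trans (≤-reflexive (id₁ k t p)) (*-monoʳ-≤ k (≤-trans (+-monoʳ-≤ (3 * t) (≰⇒> t≰p)) (≤-reflexive (id₂ t)))))
      z≤n)
    where
    id₁ : ∀ k t p → k * (3 * t + p) + k ≡ k * (3 * t + suc p)
    id₁ = solve-∀
    id₂ : ∀ t → 3 * t + t ≡ 4 * t
    id₂ = solve-∀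

  -- If π v is smaller, each vertex from index 3t + 1 on contributes at most π v + p < 2t + j + p =
  -- 4t, and the earlier ones exceed this by at most 3t each.
  degree≥2t+j : ∀ v → toℕ v < 3 * t + 2 → 2 * t + j ≤ π v
  degree≥2t+j v v< with 2 * t + j ≤? π v
  ... | yes q = q
  ... | no ¬q = ⊥-elim (too-sparse (k * (π v + p)) ((3 * t + 1) * (3 * t))
      (tail-bound G₀ r₀ p k (π v + p) (3 * t + 1) (3 * t) p+k≡n (≤-trans (slack 1 (id₀ t)) 3t+2≤n) bound)
      (≤-trans (≤-reflexive (id₁ k (π v) p)) (*-monoʳ-≤ k (≤-trans (+-monoˡ-≤ p (≰⇒> ¬q)) (≤-reflexive 4t≡))))
      (slack (7 * (t * t) + 24 * t + 12) (id₃ t)))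
    where
    id₀ : ∀ t → 3 * t + 1 + 1 ≡ 3 * t + 2
    id₀ = solve-∀
    id₁ : ∀ k d p → k * (d + p) + k ≡ k * (suc d + p)
    id₁ = solve-∀
    id₂ : ∀ t p j → 2 * t + j + p ≡ 2 * t + (p + j)
    id₂ = solve-∀
    id₃ : ∀ t → (3 * t + 1) * (3 * t) + (7 * (t * t) + 24 * t + 12) ≡ 16 * (t * t) + 27 * t + 12
    id₃ = solve-∀
    id₄ : ∀ t → 2 * t + 2 * t ≡ 4 * t
    id₄ = solve-∀
    id₅ : ∀ t → 3 * t + 2 ≡ 1 + (3 * t + 1)
    id₅ = solve-∀
    id₆ : ∀ d p e → e + p + d ≡ d + p + e
    id₆ = solve-∀
    4t≡ : 2 * t + j + p ≡ 4 * t
    4t≡ = trans (id₂ t p j) (trans (cong (2 * t +_) p+j≡2t) (id₄ t))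
    bound : ∀ w → below p w ≡ false → Neighbourhoods.deg G₀ w + Neighbourhoods.nb G₀ (below p) w ≤ π v + p + below (3 * t + 1) w · (3 * t)
    bound w e with below (3 * t + 1) w in f
    ... | true  = ≤-trans (+-mono-≤ (≤-trans (≤-reflexive (deg≡ G₀ r₀ w)) (outside-low w e)) (nb≤p w))
                    (≤-trans (m≤m+n _ (π v)) (≤-reflexive (id₆ (π v) p (3 * t))))
    ... | false = ≤-trans (+-mono-≤ (≤-trans (≤-reflexive (deg≡ G₀ r₀ w)) (sorted v w v≤w)) (nb≤p w)) (m≤m+n _ _)
      where
      v≤w : toℕ v ≤ toℕ w
      v≤w = ≤-trans (≤-pred (≤-trans v< (≤-reflexive (id₅ t)))) (¬below⇒≥ {i = w} f)

  private
    s m : ℕ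
    s = 3 * t + 2
    -- Equal to p + 2(j + 1): the core occupies the indices from p to m - 1.
    m = 2 * t + j + 2

    m≤s : m ≤ s
    m≤s = +-monoˡ-≤ 2 (≤-trans (+-monoʳ-≤ (2 * t) j≤t) (≤-reflexive (id₁ t)))
      where
      id₁ : ∀ t → 2 * t + t ≡ 3 * t
      id₁ = solve-∀

    T : Rel n
    T = target p s (unmatched? m j)

    T-sym : Symmetricᵇ T
    T-sym = target-sym p s (unmatched? m j) (λ ((a , b) , c , d) → (b , a) , d , c)

    T⇒ : ∀ {a b} → T a b ≡ true → InTarget p s (unmatched? m j) a b
    T⇒ = target⇒ p s (unmatched? m j)

    p≤s : p ≤ s
    p≤s = ≤-trans p≤2t (slack (t + 2) (id₁ t))
      where
      id₁ : ∀ t → 2 * t + (t + 2) ≡ 3 * t + 2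
      id₁ = solve-∀

    row-hub : ∀ u → toℕ u < p → toℕ u < s → ∣ T u ∣ ≤ 3 * t + 1
    row-hub u u<p u<s = ≤-pred (≤-trans (subst (∣ T u ∣ <_) (∣below∣ s 3t+2≤n)
        (∣∣-mono-< (T u) (below s) inside u self (<⇒below {i = u} u<s))) (≤-reflexive (id₁ t)))
      where
      id₁ : ∀ t → 3 * t + 2 ≡ 1 + (3 * t + 1)
      id₁ = solve-∀
      inside : ∀ v → T u v ≡ true → below s v ≡ true
      inside v e = <⇒below {i = v} (proj₁ (proj₂ (proj₂ (T⇒ {u} {v} e))))
      self : T u u ≡ false
      self = ¬⇒target p s (unmatched? m j) {u} {u} (λ e → proj₁ e refl)

    row-lone : ∀ u → ¬ (toℕ u < p) → ¬ (toℕ u < m) → ∣ T u ∣ ≤ p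
    row-lone u u≮p u≮m = ≤-trans (∣∣-mono (T u) (below p) inside) (≤-reflexive (∣below∣ p p≤n))
      where
      inside : ∀ v → T u v ≡ true → below p v ≡ true
      inside v e with T⇒ {u} {v} e
      ... | _ , _ , _ , inj₁ x = contradiction x u≮p
      ... | _ , _ , _ , inj₂ (inj₁ x) = <⇒below {i = v} x
      ... | _ , _ , _ , inj₂ (inj₂ ((x , _) , _)) = contradiction x u≮m

    Partner : ℕ → ℕ → Set
    Partner u c = p ≤ c × c < m × (c ≡ u + suc j ⊎ u ≡ c + suc j)

    partner : ∀ u → ¬ (u < p) → u < m → ∃ (Partner u)
    partner u u≮p u<m with u <? p + suc j
    ... | yes u<h = u + suc j , ≤-trans (≮⇒≥ u≮p) (m≤m+n _ _) , <-≤-trans (ℕₚ.+-monoˡ-< (suc j) u<h) (≤-reflexive m≡) , inj₁ refl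
      where
      id₁ : ∀ p j → p + suc j + suc j ≡ p + j + j + 2
      id₁ = solve-∀
      m≡ : p + suc j + suc j ≡ m
      m≡ = trans (id₁ p j) (cong (λ x → x + j + 2) p+j≡2t)
    ... | no u≮h = c , +-cancelʳ-≤ (suc j) _ _ (≤-trans (≮⇒≥ u≮h) (≤-reflexive (sym c≡))) ,
                   ≤-<-trans (≤-trans (m≤m+n c (suc j)) (≤-reflexive c≡)) u<m , inj₂ (sym c≡)
      where
      1+j≤u : suc j ≤ u
      1+j≤u = ≤-trans (m≤n+m (suc j) p) (≮⇒≥ u≮h)
      c : ℕ
      c = u ∸ suc j
      c≡ : c + suc j ≡ u
      c≡ = ℕₚ.m∸n+n≡m 1+j≤u

    row-core′ : ∀ u v → ¬ (toℕ u < p) → toℕ u < m → Partner (toℕ u) (toℕ v) → ∣ T u ∣ + 2 ≤ m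
    row-core′ u v u≮p u<m (p≤v , v<m , partners) =
      ≤-trans (≤-reflexive (+-comm (∣ T u ∣) 2)) (≤-trans (s≤s T<M∖u) M∖u<m)
      where
      M∖u : Fin n → Bool
      M∖u a = below m a ∧ not (u ≡ᵇ a)
      M∖u<m : ∣ M∖u ∣ < m
      M∖u<m = subst (∣ M∖u ∣ <_) (∣below∣ m (≤-trans m≤s 3t+2≤n))
        (∣∣-mono-< M∖u (below m) (λ a e → proj₁ (∧-≡true e)) u self (<⇒below {i = u} u<m))
        where
        self : M∖u u ≡ false
        self rewrite ≡ᵇ-refl u with below m u
        ... | true  = refl
        ... | false = refl
      u≢v : u ≢ v
      u≢v u≡v = [ (λ e → no-shift (trans (cong toℕ u≡v) e)) , (λ e → no-shift (trans (sym (cong toℕ u≡v)) e)) ]′ partners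
        where
        no-shift : ∀ {a} → a ≢ a + suc j
        no-shift {a} e = ℕₚ.m≢1+m+n a (trans e (ℕₚ.+-suc a j))
      off-target : T u v ≡ false
      off-target = ¬⇒target p s (unmatched? m j) {u} {v} λ
        { (_ , _ , _ , inj₁ x) → u≮p x
        ; (_ , _ , _ , inj₂ (inj₁ x)) → <⇒≱ x p≤v
        ; (_ , _ , _ , inj₂ (inj₂ (_ , x , y))) → [ x , y ]′ partners }
      inside : ∀ a → T u a ≡ true → M∖u a ≡ true
      inside a e with T⇒ {u} {a} e
      ... | _ , _ , _ , inj₁ x = contradiction x u≮p
      ... | u≢a , _ , _ , inj₂ (inj₁ x) = ∧-true (<⇒below {i = a} (≤-trans x p≤m)) (cong not (≢⇒≡ᵇ u≢a))
        where
        p≤m : p ≤ m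
        p≤m = ≤-trans p≤2t (≤-trans (m≤m+n _ j) (m≤m+n _ 2))
      ... | u≢a , _ , _ , inj₂ (inj₂ ((_ , x) , _)) = ∧-true (<⇒below {i = a} x) (cong not (≢⇒≡ᵇ u≢a))
      T<M∖u : ∣ T u ∣ < ∣ M∖u ∣
      T<M∖u = ∣∣-mono-< (T u) M∖u inside v off-target (∧-true (<⇒below {i = v} v<m) (cong not (≢⇒≡ᵇ u≢v)))

    row-core : ∀ u → ¬ (toℕ u < p) → toℕ u < m → ∣ T u ∣ + 2 ≤ m
    row-core u u≮p u<m with partner (toℕ u) u≮p u<m
    ... | c , p≤c , c<m , e = row-core′ u (fromℕ< c<n) u≮p u<m (subst (Partner (toℕ u)) (sym (toℕ-fromℕ< c<n)) (p≤c , c<m , e))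
      where
      c<n : c < n
      c<n = <-≤-trans c<m (≤-trans m≤s 3t+2≤n)

    -- A core vertex is joined to all m = 2t + j + 2 hub and core vertices but itself and its
    -- partner, which uses exactly the degree 2t + j guaranteed above. A hub needs 3t + 1 and the
    -- remaining vertices p.
    ∣T∣≤π : ∀ u → toℕ u < s → ∣ T u ∣ ≤ π u
    ∣T∣≤π u u<s with toℕ u <? p | toℕ u <? m
    ... | yes u<p | _       = ≤-trans (row-hub u u<p u<s) (high u u<p)
    ... | no u≮p  | no u≮m  = ≤-trans (row-lone u u≮p u≮m) (≤-trans (≤-trans p≤2t (m≤m+n _ j)) (degree≥2t+j u u<s))
    ... | no u≮p  | yes u<m = ≤-trans (+-cancelʳ-≤ 2 _ _ (row-core u u≮p u<m)) (degree≥2t+j u u<s)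

    module _ {G : Graph n} (r : Realization π G) {u w : Fin n} (u<s : toℕ u < s) (w<s : toℕ w < s)
      (uw∈T : T u w ≡ true) (uw : adj G u w ≡ false) (blocked : Blocked T T-sym G u w) where
      open Neighbourhoods G
      open Blocked blocked

      P : Fin n → Bool
      P = below p

      x-witness : ∃ λ x → Adj G u x × T u x ≡ false
      x-witness = neighbour-outside-≤ G (T u) uw∈T uw (≤-trans (∣T∣≤π u u<s) (≤-reflexive (sym (deg≡ G r u))))

      y-witness : ∃ λ y → Adj G w y × T w y ≡ false
      y-witness = neighbour-outside-≤ G (T w) (trans (T-sym w u) uw∈T) (nonadj-sym G uw)
                    (≤-trans (∣T∣≤π w w<s) (≤-reflexive (sym (deg≡ G r w))))

      x y : Fin n
      x = proj₁ x-witness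
      y = proj₁ y-witness

      free⇒∉P : ∀ {v a} → toℕ v < s → Adj G v a → T v a ≡ false → P a ≡ false
      free⇒∉P {v} {a} v<s va e = ≢true⇒false λ q → ¬target⇒ p s (unmatched? m j) e
        (Adj⇒≢ G va , v<s , <-≤-trans (below⇒< {i = a} q) p≤s , inj₂ (inj₁ (below⇒< {i = a} q)))

      deg-low : ∀ {v} → P v ≡ false → deg v ≤ 3 * t
      deg-low {v} e = ≤-trans (≤-reflexive (deg≡ G r v)) (outside-low v e)

      -- Twice the number of edges avoiding the hubs.
      L : ℕ
      L = sum (λ z → not (P z) · nb (not ∘ P) z)

      ∣clo∣≤ : ∀ {v} → P v ≡ false → ∣ clo v ∣ * (3 * t) ≤ (1 + 3 * t) * (3 * t)
      ∣clo∣≤ {v} e = *-monoˡ-≤ (3 * t) (≤-trans (≤-reflexive (∣clo∣ v)) (s≤s (deg-low e)))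

      S : Fin n → Bool
      S = below s

      closed-sum : Fin n → Fin n → ℕ
      closed-sum a z = (not (P z) ∧ clo a z) · deg z

      closed-sum≤ : ∀ a z → closed-sum a z ≤ clo a z · (3 * t)
      closed-sum≤ a z with P z in e
      ... | true  = z≤n
      ... | false with clo a z
      ...   | true  = deg-low e
      ...   | false = z≤n

      -- For a non-target edge zz′ between non-hubs, `blocked₃` puts z into N[x] or z′ into N[y].
      -- Neither x nor y is a hub, so these sets have at most 3t + 1 vertices, and the non-hubs in
      -- them have degree at most 3t. Target edges are covered by the (3t + 2)² pairs inside S.
      L≤ : L ≤ 27 * (t * t) + 18 * t + 4
      L≤ = begin
        L
          ≡⟨ sum-cong-≗ (λ z → ·-sum (not (P z)) (λ z′ → 𝟙 (not (P z′) ∧ adj G z z′))) ⟩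
        sum (λ z → sum (λ z′ → not (P z) · 𝟙 (not (P z′) ∧ adj G z z′)))
          ≤⟨ sum-mono (λ z → sum-mono (pt z)) ⟩
        sum (λ z → sum (λ z′ → f z z′ + g z′ z + h z z′))
          ≡⟨ trans (sum-cong-≗ (λ z → sum-+₃ (f z) (λ z′ → g z′ z) (h z))) (sum-+₃ (λ z → sum (f z)) (λ z → sum (λ z′ → g z′ z)) (λ z → sum (h z))) ⟩
        sum (λ z → sum (f z)) + sum (λ z → sum (λ z′ → g z′ z)) + sum (λ z → sum (h z))
          ≡⟨ cong₂ _+_ (cong₂ _+_ (sum-cong-≗ (λ z → sym (·-sum (not (P z) ∧ clo x z) (λ z′ → 𝟙 (adj G z z′)))))
               (trans (∑-comm (λ z z′ → g z′ z)) (sum-cong-≗ (λ z → sym (·-sum (not (P z) ∧ clo y z) (λ z′ → 𝟙 (adj G z z′)))))))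
               (trans (sum-cong-≗ (λ z → sym (·-sum (S z) (λ z′ → 𝟙 (S z′))))) (trans (sum-·ʳ S (∣ S ∣)) (cong₂ _*_ ∣S∣ ∣S∣))) ⟩
        sum (closed-sum x) + sum (closed-sum y) + s * s
          ≤⟨ +-monoˡ-≤ (s * s) (+-mono-≤ (side x (free⇒∉P u<s (proj₁ (proj₂ x-witness)) (proj₂ (proj₂ x-witness))))
               (side y (free⇒∉P w<s (proj₁ (proj₂ y-witness)) (proj₂ (proj₂ y-witness))))) ⟩
        (1 + 3 * t) * (3 * t) + (1 + 3 * t) * (3 * t) + s * s
          ≡⟨ id₁ t ⟩
        27 * (t * t) + 18 * t + 4 ∎
        where
        open ℕₚ.≤-Reasoning
        id₁ : ∀ t → (1 + 3 * t) * (3 * t) + (1 + 3 * t) * (3 * t) + (3 * t + 2) * (3 * t + 2) ≡ 27 * (t * t) + 18 * t + 4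
        id₁ = solve-∀
        ∣S∣ : ∣ S ∣ ≡ s
        ∣S∣ = ∣below∣ s 3t+2≤n
        f g h : Fin n → Fin n → ℕ
        f z z′ = (not (P z) ∧ clo x z) · 𝟙 (adj G z z′)
        g z z′ = (not (P z) ∧ clo y z) · 𝟙 (adj G z z′)
        h z z′ = S z · 𝟙 (S z′)
        side : ∀ a → P a ≡ false → sum (closed-sum a) ≤ (1 + 3 * t) * (3 * t)
        side a e = ≤-trans (sum-mono (closed-sum≤ a)) (≤-trans (≤-reflexive (sum-·ʳ (clo a) (3 * t))) (∣clo∣≤ e))
        pt : ∀ z z′ → not (P z) · 𝟙 (not (P z′) ∧ adj G z z′) ≤ f z z′ + g z′ z + h z z′
        pt z z′ with P z | P z′ | adj G z z′ in zz
        ... | true  | _     | _     = z≤n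
        ... | false | true  | _     = z≤n
        ... | false | false | false = z≤n
        ... | false | false | true with clo x z in xz
        ...   | true  = s≤s z≤n
        ...   | false with T z z′ in e
        ...     | true with T⇒ e
        ...       | _ , zs , zs′ , _ rewrite <⇒below {i = z} zs | <⇒below {i = z′} zs′ = m≤n+m 1 _
        pt z z′ | false | false | true | false | false
          rewrite blocked₃ (proj₁ (proj₂ x-witness)) (proj₂ (proj₂ x-witness)) (proj₁ (proj₂ y-witness)) (proj₂ (proj₂ y-witness)) zz e xz
                | Adj-sym G zz = s≤s z≤n

      outer≤ : sum (λ v → not (P v) · (deg v + nb P v)) ≤ k * (2 * p) + L
      outer≤ = begin
        sum (λ v → not (P v) · (deg v + nb P v))
          ≤⟨ sum-mono pt ⟩
        sum (λ v → not (P v) · (2 * p) + not (P v) · nb (not ∘ P) v)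
          ≡⟨ ∑-distrib-+ (λ v → not (P v) · (2 * p)) (λ v → not (P v) · nb (not ∘ P) v) ⟩
        sum (λ v → not (P v) · (2 * p)) + L
          ≡⟨ cong (_+ L) (trans (sum-·ʳ (not ∘ P) (2 * p)) (cong (_* (2 * p)) ∣¬P∣)) ⟩
        k * (2 * p) + L ∎
        where
        open ℕₚ.≤-Reasoning
        ∣¬P∣ : ∣ not ∘ P ∣ ≡ k
        ∣¬P∣ = ℕₚ.+-cancelˡ-≡ p _ _ (trans (cong (_+ ∣ not ∘ P ∣) (sym (∣below∣ p p≤n))) (trans (∣not∣ P) (sym p+k≡n)))
        nbP≤ : ∀ v → nb P v ≤ p
        nbP≤ v = ≤-trans (nb≤∣∣ P v) (≤-reflexive (∣below∣ p p≤n))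
        id₁ : ∀ a b → a + b + a ≡ (a + a) + b
        id₁ = solve-∀
        id₂ : ∀ a b → a + a + b ≡ 2 * a + b
        id₂ = solve-∀
        pt : ∀ v → not (P v) · (deg v + nb P v) ≤ not (P v) · (2 * p) + not (P v) · nb (not ∘ P) v
        pt v with P v
        ... | true  = z≤n
        ... | false = begin
          deg v + nb P v                        ≡⟨ cong (_+ nb P v) (deg-split P v) ⟩
          nb P v + nb (not ∘ P) v + nb P v      ≡⟨ id₁ (nb P v) (nb (not ∘ P) v) ⟩
          nb P v + nb P v + nb (not ∘ P) v      ≤⟨ +-monoˡ-≤ (nb (not ∘ P) v) (+-mono-≤ (nbP≤ v) (nbP≤ v)) ⟩
          p + p + nb (not ∘ P) v                ≡⟨ id₂ p (nb (not ∘ P) v) ⟩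
          2 * p + nb (not ∘ P) v                ∎

      impossible : ⊥
      -- As 2p ≤ 4t - 2, the gain is 2k. `too-sparse` consumes k of it, and the other k is added to
      -- the budget for `L`.
      impossible = too-sparse (k * (2 * p) + k) (16 * (t * t) + 27 * t + 12) (begin
        sum π + p
          ≡⟨ cong₂ _+_ (sym (sum-deg G r)) (sym (∣below∣ p p≤n)) ⟩
        sum deg + ∣ P ∣
          ≤⟨ erdős-gallai P ⟩
        ∣ P ∣ * ∣ P ∣ + sum (λ v → not (P v) · (deg v + nb P v))
          ≤⟨ +-mono-≤ (≤-reflexive (cong₂ _*_ (∣below∣ p p≤n) (∣below∣ p p≤n))) outer≤ ⟩
        p * p + (k * (2 * p) + L)
          ≤⟨ +-monoʳ-≤ (p * p) (+-monoʳ-≤ (k * (2 * p)) (≤-trans L≤ (≤-trans (slack (9 * (t * t) + 38 * t + 20) (id₁ t)) (+-monoˡ-≤ (16 * (t * t) + 27 * t + 12) k≥)))) ⟩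
        p * p + (k * (2 * p) + (k + (16 * (t * t) + 27 * t + 12)))
          ≡⟨ cong (p * p +_) (sym (+-assoc (k * (2 * p)) k _)) ⟩
        p * p + (k * (2 * p) + k + (16 * (t * t) + 27 * t + 12)) ∎)
        (≤-trans (≤-reflexive (id₂ k p)) (*-monoʳ-≤ k (≤-trans (*-monoʳ-≤ 2 p+1≤) (≤-reflexive (id₃ t))))) ≤-refl
        where
        open ℕₚ.≤-Reasoning
        id₁ : ∀ t → 27 * (t * t) + 18 * t + 4 + (9 * (t * t) + 38 * t + 20) ≡ 20 * (t * t) + 29 * t + 12 + (16 * (t * t) + 27 * t + 12)
        id₁ = solve-∀
        id₂ : ∀ k p → k * (2 * p) + k + k ≡ k * (2 * (p + 1))
        id₂ = solve-∀
        id₃ : ∀ t → 2 * (2 * t) ≡ 4 * t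
        id₃ = solve-∀
        p+1≤ : p + 1 ≤ 2 * t
        p+1≤ = ≤-trans (+-monoʳ-≤ p 1≤j) (≤-reflexive p+j≡2t)

    improve : ∀ G → Realization π G → (λ _ _ → false) ⊆ G → ∀ {u w} → T u w ≡ true → adj G u w ≡ false → Improved T G u w ⊎ ⊥
    improve G r _ {u} {w} e uw with T⇒ e
    ... | u≢w , u<s , w<s , _ with improve-or-blocked T T-sym G u≢w uw
    ...   | inj₁ I = inj₁ I
    ...   | inj₂ blocked = inj₂ (impossible r u<s w<s e uw blocked)

  realization : Σ (Graph n) λ G → Realization π G × target p (3 * t + 2) (unmatched? (2 * t + j + 2) j) ⊆ G
  realization with realize π T (λ _ _ → false) (λ ()) improve G₀ r₀ (λ ())
  ... | inj₁ result = result

-- 2-trees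

-- The witnesses may coincide and may lie outside `A`; only that they cover `A` matters, so `zero`
-- serves when `A` is empty.
two-neighbours : ∀ {n} (A : Fin (suc n) → Bool) → ∣ A ∣ ≤ 2 → ∃ λ a → ∃ λ b → ∀ x → A x ≡ true → x ≡ a ⊎ x ≡ b
two-neighbours {n} A le with any? (λ a → A a Bool.≟ true)
... | no none = zero , zero , λ x e → contradiction (x , e) none
... | yes (a , Aa) with any? (λ b → (A b ∧ not (a ≡ᵇ b)) Bool.≟ true)
...   | no none = a , a , λ x e → inj₁ (same x e)
  where
  same : ∀ x → A x ≡ true → x ≡ a
  same x e with a ≟ x in eq
  ... | yes p = sym p
  ... | no ¬p = contradiction (x , ∧-true e (cong (not ∘ does) eq)) none
...   | yes (b , e) with ∧-≡true {A b} e
...     | Ab , a≢ᵇb = a , b , one-of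
  where
  a≢b : a ≢ b
  a≢b refl = ≡false⇒≢true (not-≡true a≢ᵇb) (≡ᵇ-refl a)
  one-of : ∀ x → A x ≡ true → x ≡ a ⊎ x ≡ b
  one-of x Ax with x ≟ a | x ≟ b
  ... | yes p | _     = inj₁ p
  ... | no _  | yes q = inj₂ q
  ... | no x≢a | no x≢b = contradiction (≤-trans three le) λ { (s≤s (s≤s ())) }
    where
    pt : ∀ v → 𝟙 (a ≡ᵇ v) + 𝟙 (b ≡ᵇ v) + 𝟙 (x ≡ᵇ v) ≤ 𝟙 (A v)
    pt v with a ≟ v | b ≟ v | x ≟ v
    ... | yes refl | yes refl | _        = contradiction refl a≢b
    ... | yes refl | no _     | yes refl = contradiction refl x≢a
    ... | no _     | yes refl | yes refl = contradiction refl x≢b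
    ... | yes refl | no _     | no _ rewrite Aa = ≤-refl
    ... | no _     | yes refl | no _ rewrite Ab = ≤-refl
    ... | no _     | no _     | yes refl rewrite Ax = ≤-refl
    ... | no _     | no _     | no _     = z≤n
    three : 3 ≤ ∣ A ∣
    three = ≤-trans (≤-reflexive (sym (trans (sum-+₃ (λ v → 𝟙 (a ≡ᵇ v)) (λ v → 𝟙 (b ≡ᵇ v)) (λ v → 𝟙 (x ≡ᵇ v)))
      (cong₂ _+_ (cong₂ _+_ (∣singleton∣ a) (∣singleton∣ b)) (∣singleton∣ x))))) (sum-mono pt)

data PunchView {m} (v : Fin (suc m)) : Fin (suc m) → Set where
  at  : PunchView v v
  off : ∀ i → PunchView v (punchIn v i)

punchView : ∀ {m} (v x : Fin (suc m)) → PunchView v x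
punchView v x with v ≟ x
... | yes refl = at
... | no v≢x   = subst (PunchView v) (punchIn-punchOut v≢x) (off (punchOut v≢x))

TwoNeighbours : ∀ {m} → Graph m → (Fin m → Bool) → Fin m → Set
TwoNeighbours G W v = ∃ λ a → ∃ λ b → ∀ x → W x ≡ true → Adj G v x → x ≡ a ⊎ x ≡ b

degree-2⇒ : ∀ {m} (G : Graph (suc m)) v → degree G v ≡ 2 → ∃ λ a → ∃ λ b → ∀ x → Adj G v x → x ≡ a ⊎ x ≡ b
degree-2⇒ G v d = two-neighbours (adj G v) (≤-reflexive (trans (sym (degree-sum G v)) d))

-- When the 2-tree is dismantled, the first member of `W` to go still has all of `W` around it and
-- degree at most 2.
two-degenerate : ∀ {m} {G : Graph m} → IsTwoTree m G → (W : Fin m → Bool) → ∀ i → W i ≡ true →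
                 ∃ λ v → W v ≡ true × TwoNeighbours G W v
two-degenerate (base G _) W i Wi with two-neighbours (adj G i)
    (≤-pred (∣∣-mono-< (adj G i) (λ _ → true) (λ _ _ → refl) i (irrefl G i) refl))
... | a , b , f = i , Wi , a , b , λ x _ → f x
two-degenerate (step G v d _ tree) W i Wi with W v in Wv
... | true with degree-2⇒ G v d
...   | a , b , f = v , Wv , a , b , λ x _ → f x
two-degenerate (step G v d _ tree) W i Wi | false with punchView v i
... | at = contradiction Wi (≡false⇒≢true Wv)
... | off i′ with two-degenerate tree (W ∘ punchIn v) i′ Wi
...   | v′ , Wv′ , a , b , f = punchIn v v′ , Wv′ , punchIn v a , punchIn v b , g
  where
  g : ∀ x → W x ≡ true → Adj G (punchIn v v′) x → x ≡ punchIn v a ⊎ x ≡ punchIn v b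
  g x Wx e with punchView v x
  ... | at = contradiction Wx (≡false⇒≢true Wv)
  ... | off x′ with f x′ Wx e
  ...   | inj₁ refl = inj₁ refl
  ...   | inj₂ refl = inj₂ refl

Proper : ∀ {m} → Graph m → (Fin m → Fin 3) → Set
Proper G c = ∀ {x y} → Adj G x y → c x ≢ c y

third-colour : (a b : Fin 3) → ∃ λ c → c ≢ a × c ≢ b
third-colour zero             zero             = suc zero , (λ ()) , (λ ())
third-colour zero             (suc zero)       = suc (suc zero) , (λ ()) , (λ ())
third-colour zero             (suc (suc zero)) = suc zero , (λ ()) , (λ ())
third-colour (suc zero)       zero             = suc (suc zero) , (λ ()) , (λ ())
third-colour (suc zero)       (suc zero)       = zero , (λ ()) , (λ ())
third-colour (suc zero)       (suc (suc zero)) = zero , (λ ()) , (λ ())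
third-colour (suc (suc zero)) zero             = suc zero , (λ ()) , (λ ())
third-colour (suc (suc zero)) (suc zero)       = zero , (λ ()) , (λ ())
third-colour (suc (suc zero)) (suc (suc zero)) = zero , (λ ()) , (λ ())

three-colourable : ∀ {m} {G : Graph m} → IsTwoTree m G → ∃ λ c → Proper G c
three-colourable (base G _) = id , λ e → Adj⇒≢ G e
three-colourable (step {m} G v d _ tree) with three-colourable tree | degree-2⇒ G v d
... | c , proper | a , b , f = c⁺ , proper⁺
  where
  old : ∀ {x} → PunchView v x → Fin 3
  -- The type does not exclude that a or b is v itself; then any colour will do.
  old at      = zero
  old (off i) = c i
  new = third-colour (old (punchView v a)) (old (punchView v b))
  paint : ∀ {x} → PunchView v x → Fin 3
  paint at      = proj₁ new
  paint (off i) = c i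
  c⁺ : Fin (suc m) → Fin 3
  c⁺ x = paint (punchView v x)
  fresh : ∀ {x i} → (p : PunchView v x) → x ≡ punchIn v i → old p ≡ c i
  fresh at      e = contradiction (sym e) (punchInᵢ≢i v _)
  fresh (off j) e = cong c (punchIn-injective v _ _ e)
  apart : ∀ i → Adj G v (punchIn v i) → proj₁ new ≢ c i
  apart i e q with f (punchIn v i) e
  ... | inj₁ p = proj₁ (proj₂ new) (trans q (sym (fresh (punchView v a) (sym p))))
  ... | inj₂ p = proj₂ (proj₂ new) (trans q (sym (fresh (punchView v b) (sym p))))
  proper⁺ : Proper G c⁺
  proper⁺ {x} {y} e with punchView v x | punchView v y
  ... | at    | at    = contradiction refl (Adj⇒≢ G e)
  ... | at    | off j = apart j e
  ... | off i | at    = apart i (Adj-sym G e) ∘ sym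
  ... | off i | off j = proper e

-- When the 2-tree is dismantled, the neighbours of the first cycle vertex to go are adjacent, and
-- two of them lie on the cycle.
four-cycle-chord : ∀ {m} {G : Graph m} → IsTwoTree m G → ∀ {p q r s} → Adj G p q → Adj G q r → Adj G r s → Adj G s p →
                   p ≢ r → q ≢ s → Adj G p r ⊎ Adj G q s
four-cycle-chord (base G k3) {p} {q} {r} _ _ _ _ p≢r _ = inj₁ (k3 p r p≢r)
four-cycle-chord (step G v _ simplicial tree) {p} {q} {r} {s} pq qr rs sp p≢r q≢s
  with punchView v p | punchView v q | punchView v r | punchView v s
... | at     | _      | _      | _      = inj₂ (simplicial q s pq (Adj-sym G sp) q≢s)
... | off _  | at     | _      | _      = inj₁ (simplicial p r (Adj-sym G pq) qr p≢r)
... | off _  | off _  | at     | _      = inj₂ (simplicial q s (Adj-sym G qr) rs q≢s)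
... | off _  | off _  | off _  | at     = inj₁ (simplicial p r sp (Adj-sym G rs) p≢r)
... | off p′ | off q′ | off r′ | off s′ =
  four-cycle-chord tree pq qr rs sp (p≢r ∘ cong (punchIn v)) (q≢s ∘ cong (punchIn v))

-- Layouts: splitting a 2-tree into hubs, core pairs and isolated vertices

module _ {A : Set} where

  Unique-resp-↭ : {xs ys : List A} → xs ↭ ys → Unique xs → Unique ys
  Unique-resp-↭ p = Permₛ.Unique-resp-↭ (setoid A) (↭⇒↭ₛ p)

  Unique-tail : ∀ {x : A} {xs} → Unique (x ∷ xs) → Unique xs
  Unique-tail (_ ∷ u) = u

  head∉ : ∀ {x y : A} {xs} → Unique (x ∷ xs) → y ∈ xs → x ≢ y
  head∉ (x∉ ∷ _) y∈ = All.lookup x∉ y∈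

  Unique-++-disjoint : ∀ (xs : List A) {ys x} → Unique (xs ++ ys) → x ∈ xs → x ∈ ys → ⊥
  Unique-++-disjoint (z ∷ xs) u (here refl) q = head∉ u (∈-++⁺ʳ xs q) refl
  Unique-++-disjoint (z ∷ xs) u (there p)   q = Unique-++-disjoint xs (Unique-tail u) p q

  extract : ∀ {x : A} {xs} → x ∈ xs → ∃ λ ys → xs ↭ x ∷ ys
  extract x∈ with ∈-∃++ x∈
  ... | ys , zs , refl = ys ++ zs , shift _ ys zs

four-colours-collide : (a b c d : Fin 3) → a ≡ b ⊎ a ≡ c ⊎ a ≡ d ⊎ b ≡ c ⊎ b ≡ d ⊎ c ≡ d
four-colours-collide a b c d with pigeonhole (s≤s (s≤s (s≤s (s≤s z≤n)))) (Vec.lookup (a Vec.∷ b Vec.∷ c Vec.∷ d Vec.∷ Vec.[]))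
... | zero , suc zero , _ , e                   = inj₁ e
... | zero , suc (suc zero) , _ , e             = inj₂ (inj₁ e)
... | zero , suc (suc (suc zero)) , _ , e       = inj₂ (inj₂ (inj₁ e))
... | suc zero , suc (suc zero) , _ , e         = inj₂ (inj₂ (inj₂ (inj₁ e)))
... | suc zero , suc (suc (suc zero)) , _ , e   = inj₂ (inj₂ (inj₂ (inj₂ (inj₁ e))))
... | suc (suc zero) , suc (suc (suc zero)) , _ , e = inj₂ (inj₂ (inj₂ (inj₂ (inj₂ e))))
... | suc zero , suc zero , s≤s () , _
... | suc (suc zero) , suc (suc zero) , s≤s (s≤s ()) , _
... | suc (suc (suc zero)) , suc (suc (suc zero)) , s≤s (s≤s (s≤s ())) , _
... | suc (suc (suc zero)) , suc (suc zero) , s≤s (s≤s ()) , _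
... | suc (suc (suc zero)) , suc zero , s≤s () , _
... | suc (suc zero) , suc zero , s≤s () , _

module Layouts {k : ℕ} {H : Graph k} (tree : IsTwoTree k H) where
  open DecMembership (_≟_ {k}) using (_∈?_)

  private
    colour : Fin k → Fin 3
    colour = proj₁ (three-colourable tree)

    same-colour : ∀ {x y} → colour x ≡ colour y → adj H x y ≡ false
    same-colour e = ≢true⇒false λ xy → proj₂ (three-colourable tree) xy e

    V : Set
    V = Fin k

    -- When a is absent from the list, its head acts as a filler, so that peeling always removes the
    -- same number of vertices.
    bring : ∀ (a x : V) xs → ∃ λ y → ∃ λ ys → x ∷ xs ↭ y ∷ ys × (a ∈ x ∷ xs → y ≡ a)
    bring a x xs with a ∈? (x ∷ xs)
    ... | no a∉ = x , xs , ↭-refl , λ a∈ → contradiction a∈ a∉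
    ... | yes a∈ with extract a∈
    ...   | ys , p = a , ys , p , λ _ → refl

    isolate : ∀ x₁ x₂ x₃ (xs : List V) → Unique (x₁ ∷ x₂ ∷ x₃ ∷ xs) → ∃ λ v → ∃ λ a → ∃ λ b → ∃ λ ys →
              x₁ ∷ x₂ ∷ x₃ ∷ xs ↭ v ∷ a ∷ b ∷ ys × (∀ {x} → x ∈ v ∷ a ∷ b ∷ ys → Adj H v x → x ≡ a ⊎ x ≡ b)
    isolate x₁ x₂ x₃ xs u
      with two-degenerate tree (λ x → does (x ∈? (x₁ ∷ x₂ ∷ x₃ ∷ xs))) x₁ (dec-true (x₁ ∈? (x₁ ∷ x₂ ∷ x₃ ∷ xs)) (here refl))
    ... | v , Wv , a , b , f with extract (does⇒ (v ∈? (x₁ ∷ x₂ ∷ x₃ ∷ xs)) Wv)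
    ...   | [] , p = contradiction (↭-length p) λ ()
    ...   | _ ∷ [] , p = contradiction (↭-length p) λ ()
    ...   | y₁ ∷ y₂ ∷ ys , p with bring a y₁ (y₂ ∷ ys)
    ...     | _ , [] , q , _ = contradiction (↭-length q) λ ()
    ...     | a′ , z ∷ zs , q , fa with bring b z zs
    ...       | b′ , ws , r , fb = v , a′ , b′ , ws , perm , g
      where
      perm : x₁ ∷ x₂ ∷ x₃ ∷ xs ↭ v ∷ a′ ∷ b′ ∷ ws
      perm = ↭-trans p (prep v (↭-trans q (prep a′ r)))
      g : ∀ {x} → x ∈ v ∷ a′ ∷ b′ ∷ ws → Adj H v x → x ≡ a′ ⊎ x ≡ b′
      g (here refl) e = contradiction refl (Adj⇒≢ H e)
      g {x} (there x∈) e with f x (dec-true (x ∈? (x₁ ∷ x₂ ∷ x₃ ∷ xs)) (∈-resp-↭ (↭-sym perm) (there x∈))) e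
      ... | inj₁ refl = inj₁ (sym (fa (∈-resp-↭ (↭-trans (prep a′ (↭-sym r)) (↭-sym q)) x∈)))
      ... | inj₂ refl with x∈
      ...   | here p′   = inj₁ p′
      ...   | there x∈′ = inj₂ (sym (fb (∈-resp-↭ (↭-sym r) x∈′)))

  record Peeled (i r : ℕ) (xs : List V) : Set where
    field
      isolated hit rest : List V
      perm       : xs ↭ isolated ++ hit ++ rest
      ∣hit∣      : length hit ≡ 2 * i
      ∣rest∣     : length rest ≡ r
      dominated  : ∀ {v x} → v ∈ isolated → x ∈ xs → Adj H v x → x ∈ hit

  private
    3+ : ∀ i r → 3 * suc i + r ≡ 3 + (3 * i + r)
    3+ = solve-∀

    4+ : ∀ i r → 2 * suc i + (2 + r) ≡ 4 + (2 * i + r)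
    4+ = solve-∀

  -- Each round removes three vertices: one with at most two neighbours among those left, and these
  -- neighbours or fillers. Vertices isolated in different rounds are non-adjacent, because the
  -- neighbours of the earlier one left together with it.
  peel : ∀ i r xs → Unique xs → length xs ≡ 3 * i + r → Peeled i r xs
  peel zero r xs u len = record
    { isolated = [] ; hit = [] ; rest = xs ; perm = ↭-refl ; ∣hit∣ = refl ; ∣rest∣ = len
    ; dominated = λ () }
  peel (suc i) r [] u len = contradiction len λ ()
  peel (suc i) r (_ ∷ []) u len = contradiction (trans len (3+ i r)) λ ()
  peel (suc i) r (_ ∷ _ ∷ []) u len = contradiction (trans len (3+ i r)) λ ()
  peel (suc i) r (x₁ ∷ x₂ ∷ x₃ ∷ xs′) u len with isolate x₁ x₂ x₃ xs′ u
  ... | v , a , b , ys , p , f with peel i r ys (Unique-tail (Unique-tail (Unique-tail (Unique-resp-↭ p u))))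
                                      (ℕₚ.+-cancelˡ-≡ 3 _ _ (trans (sym (↭-length p)) (trans len (3+ i r))))
  ...   | IH = record
    { isolated = v ∷ isolated ; hit = a ∷ b ∷ hit ; rest = rest
    ; perm = ↭-trans p (prep v (↭-trans (prep a (prep b perm)) (↭-sym move)))
    ; ∣hit∣ = trans (cong (2 +_) ∣hit∣) (id₂ i) ; ∣rest∣ = ∣rest∣
    ; dominated = dom }
    where
    open Peeled IH
    id₂ : ∀ i → 2 + 2 * i ≡ 2 * suc i
    id₂ = solve-∀
    move : isolated ++ (a ∷ b ∷ hit) ++ rest ↭ a ∷ b ∷ isolated ++ hit ++ rest
    move = shifts isolated (a ∷ b ∷ [])
    u′ = Unique-resp-↭ p u
    isolated⊆ys : ∀ {w} → w ∈ isolated → w ∈ ys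
    isolated⊆ys w∈ = ∈-resp-↭ (↭-sym perm) (∈-++⁺ˡ w∈)
    dom : ∀ {w x} → w ∈ v ∷ isolated → x ∈ x₁ ∷ x₂ ∷ x₃ ∷ xs′ → Adj H w x → x ∈ a ∷ b ∷ hit
    dom (here refl) x∈ e with f (∈-resp-↭ p x∈) e
    ... | inj₁ refl = here refl
    ... | inj₂ refl = there (here refl)
    dom (there w∈) x∈ e with ∈-resp-↭ p x∈
    ... | there (here refl)         = here refl
    ... | there (there (here refl)) = there (here refl)
    ... | there (there (there x∈′)) = there (there (dominated w∈ x∈′ e))
    ... | here refl with f (there (there (there (isolated⊆ys w∈)))) (Adj-sym H e)
    ...   | inj₁ refl = contradiction refl (head∉ (Unique-tail u′) (there (isolated⊆ys w∈)))
    ...   | inj₂ refl = contradiction refl (head∉ (Unique-tail (Unique-tail u′)) (isolated⊆ys w∈))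

  Pair : Set
  Pair = V × V

  Apart : Pair → Set
  Apart (x , y) = adj H x y ≡ false

  flat : List Pair → List V
  flat prs = map proj₁ prs ++ map proj₂ prs

  flat-∷ : ∀ x y prs (zs : List V) → flat ((x , y) ∷ prs) ++ zs ↭ x ∷ y ∷ flat prs ++ zs
  flat-∷ x y prs zs = prep x (++⁺ʳ zs (shift y (map proj₁ prs) (map proj₂ prs)))

  private
    monochromatic-pair : ∀ a b c d xs → ∃ λ x → ∃ λ y → ∃ λ ys → a ∷ b ∷ c ∷ d ∷ xs ↭ x ∷ y ∷ ys × colour x ≡ colour y
    monochromatic-pair a b c d xs with four-colours-collide (colour a) (colour b) (colour c) (colour d)
    ... | inj₁ e = a , b , c ∷ d ∷ xs , ↭-refl , e
    ... | inj₂ (inj₁ e) = a , c , b ∷ d ∷ xs , prep a (shift c (b ∷ []) _) , e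
    ... | inj₂ (inj₂ (inj₁ e)) = a , d , b ∷ c ∷ xs , prep a (shift d (b ∷ c ∷ []) _) , e
    ... | inj₂ (inj₂ (inj₂ (inj₁ e))) = b , c , a ∷ d ∷ xs , ↭-trans (shift b (a ∷ []) _) (prep b (shift c (a ∷ []) _)) , e
    ... | inj₂ (inj₂ (inj₂ (inj₂ (inj₁ e)))) = b , d , a ∷ c ∷ xs , ↭-trans (shift b (a ∷ []) _) (prep b (shift d (a ∷ c ∷ []) _)) , e
    ... | inj₂ (inj₂ (inj₂ (inj₂ (inj₂ e)))) = c , d , a ∷ b ∷ xs , ↭-trans (shift c (a ∷ b ∷ []) _) (prep c (shift d (a ∷ b ∷ []) _)) , e

  record Paired (i r : ℕ) (xs : List V) : Set where
    field
      pairs  : List Pair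
      rest   : List V
      perm   : xs ↭ flat pairs ++ rest
      ∣pairs∣ : length pairs ≡ i
      ∣rest∣ : length rest ≡ r
      apart  : All Apart pairs

  -- Of any four vertices two share one of the three colours. A remainder of at least 2 ensures that
  -- four are present whenever a pair is still wanted.
  pair-up : ∀ i r xs → length xs ≡ 2 * i + (2 + r) → Paired i (2 + r) xs
  pair-up zero r xs len = record
    { pairs = [] ; rest = xs ; perm = ↭-refl ; ∣pairs∣ = refl ; ∣rest∣ = len ; apart = [] }
  pair-up (suc i) r [] len = contradiction len λ ()
  pair-up (suc i) r (_ ∷ []) len = contradiction (trans len (4+ i r)) λ ()
  pair-up (suc i) r (_ ∷ _ ∷ []) len = contradiction (trans len (4+ i r)) λ ()
  pair-up (suc i) r (_ ∷ _ ∷ _ ∷ []) len = contradiction (trans len (4+ i r)) λ ()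
  pair-up (suc i) r (a ∷ b ∷ c ∷ d ∷ xs′) len with monochromatic-pair a b c d xs′
  ... | x , y , ys , p , e with pair-up i r ys
                                  (ℕₚ.+-cancelˡ-≡ 2 _ _ (trans (sym (↭-length p)) (trans len (id₂ i r))))
    where
    id₂ : ∀ i r → 2 * suc i + (2 + r) ≡ 2 + (2 * i + (2 + r))
    id₂ = solve-∀
  ...   | IH = record
    { pairs = (x , y) ∷ pairs ; rest = rest
    ; perm = ↭-trans p (↭-trans (prep x (prep y perm)) (↭-sym (flat-∷ x y pairs rest)))
    ; ∣pairs∣ = cong suc ∣pairs∣ ; ∣rest∣ = ∣rest∣ ; apart = same-colour e ∷ apart }
    where open Paired IH

  TwoPairs : List V → Set
  TwoPairs xs = ∃ λ prs → ∃ λ z → xs ↭ flat prs ++ z ∷ [] × length prs ≡ 2 × All Apart prs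

  -- Three triangles on the common edge pq, with pages of one colour and hence pairwise
  -- non-adjacent: the obstruction to two disjoint non-adjacent pairs among five vertices.
  record Book (xs : List V) : Set where
    field
      p q c₁ c₂ c₃ : V
      perm : xs ↭ p ∷ q ∷ c₁ ∷ c₂ ∷ c₃ ∷ []
      pq   : Adj H p q
      page : ∀ {c} → c ∈ c₁ ∷ c₂ ∷ c₃ ∷ [] → Adj H p c × Adj H q c × colour c ≡ colour c₁

  two-pairs : ∀ {xs} a b c d z → xs ↭ a ∷ b ∷ c ∷ d ∷ z ∷ [] → adj H a b ≡ false → adj H c d ≡ false → TwoPairs xs
  two-pairs a b c d z p ab cd = (a , b) ∷ (c , d) ∷ [] , z , ↭-trans p (prep a (shift c (b ∷ []) _)) , refl , ab ∷ cd ∷ []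

  private
    book : ∀ {xs} c c′ r p q → xs ↭ c ∷ c′ ∷ r ∷ p ∷ q ∷ [] → colour c ≡ colour c′ → colour c ≡ colour r →
           Adj H p q → Adj H r p → Adj H r q → TwoPairs xs ⊎ Book xs
    book {xs} c c′ r p q perm cc′ cr pq rp rq
      with adj H c′ p in c′p | adj H c′ q in c′q | adj H c p in cp | adj H c q in cq
    ... | false | _ | _ | _ = inj₁ (two-pairs c r c′ p q (↭-trans perm (prep c (shift r (c′ ∷ []) _))) (same-colour cr) c′p)
    ... | true | false | _ | _ = inj₁ (two-pairs c r c′ q p (↭-trans perm (prep c (↭-trans (shift r (c′ ∷ []) _) (prep r (prep c′ (shift q (p ∷ []) [])))))) (same-colour cr) c′q)
    ... | true | true | false | _ = inj₁ (two-pairs c′ r c p q (↭-trans perm (↭-trans (shift c′ (c ∷ []) _) (prep c′ (shift r (c ∷ []) _)))) (same-colour (trans (sym cc′) cr)) cp)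
    ... | true | true | true | false = inj₁ (two-pairs c′ r c q p (↭-trans perm (↭-trans (shift c′ (c ∷ []) _) (prep c′ (↭-trans (shift r (c ∷ []) _) (prep r (prep c (shift q (p ∷ []) []))))))) (same-colour (trans (sym cc′) cr)) cq)
    ... | true | true | true | true = inj₂ (record
      { p = p ; q = q ; c₁ = c ; c₂ = c′ ; c₃ = r
      ; perm = ↭-trans perm (↭-trans (shift p (c ∷ c′ ∷ r ∷ []) _) (prep p (shift q (c ∷ c′ ∷ r ∷ []) [])))
      ; pq = pq
      ; page = λ { (here refl) → Adj-sym H cp , Adj-sym H cq , refl
                 ; (there (here refl)) → Adj-sym H c′p , Adj-sym H c′q , sym cc′
                 ; (there (there (here refl))) → Adj-sym H rp , Adj-sym H rq , sym cr } })

  -- Beside a monochromatic pair c, c′ the other three vertices give a second pair unless they form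
  -- a triangle. Then a corner r has the colour of c and c′; a non-edge from c or c′ to another
  -- corner is one pair, and r with the other of c, c′ is the second. Without such a non-edge there
  -- is a book.
  five : ∀ xs → length xs ≡ 5 → TwoPairs xs ⊎ Book xs
  five (x₁ ∷ x₂ ∷ x₃ ∷ x₄ ∷ x₅ ∷ []) _ with monochromatic-pair x₁ x₂ x₃ x₄ (x₅ ∷ [])
  ... | c , c′ , [] , perm , _ = contradiction (↭-length perm) λ ()
  ... | c , c′ , _ ∷ [] , perm , _ = contradiction (↭-length perm) λ ()
  ... | c , c′ , _ ∷ _ ∷ [] , perm , _ = contradiction (↭-length perm) λ ()
  ... | c , c′ , _ ∷ _ ∷ _ ∷ _ ∷ _ , perm , _ = contradiction (↭-length perm) λ ()
  ... | c , c′ , e ∷ f ∷ g ∷ [] , perm , cc′ with adj H e f in ef | adj H e g in eg | adj H f g in fg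
  ...   | false | _ | _ = inj₁ (two-pairs c c′ e f g perm (same-colour cc′) ef)
  ...   | true | false | _ = inj₁ (two-pairs c c′ e g f (↭-trans perm (prep c (prep c′ (prep e (shift g (f ∷ []) []))))) (same-colour cc′) eg)
  ...   | true | true | false = inj₁ (two-pairs c c′ f g e (↭-trans perm (prep c (prep c′ (↭-trans (shift f (e ∷ []) _) (prep f (shift g (e ∷ []) [])))))) (same-colour cc′) fg)
  ...   | true | true | true with four-colours-collide (colour c) (colour e) (colour f) (colour g)
  ...     | inj₁ ce = book c c′ e f g perm cc′ ce fg ef eg
  ...     | inj₂ (inj₁ cf) = book c c′ f e g (↭-trans perm (prep c (prep c′ (shift f (e ∷ []) _)))) cc′ cf eg (Adj-sym H ef) fg
  ...     | inj₂ (inj₂ (inj₁ cg)) = book c c′ g e f (↭-trans perm (prep c (prep c′ (shift g (e ∷ f ∷ []) _)))) cc′ cg ef (Adj-sym H eg) (Adj-sym H fg)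
  ...     | inj₂ (inj₂ (inj₂ (inj₁ z))) = contradiction ef (≡false⇒≢true (same-colour z))
  ...     | inj₂ (inj₂ (inj₂ (inj₂ (inj₁ z)))) = contradiction eg (≡false⇒≢true (same-colour z))
  ...     | inj₂ (inj₂ (inj₂ (inj₂ (inj₂ z)))) = contradiction fg (≡false⇒≢true (same-colour z))

  record Split (xs : List V) : Set where
    field
      lone      : V
      hubs      : List V
      pairs     : List Pair
      perm      : xs ↭ lone ∷ hubs ++ flat pairs
      ∣hubs∣    : length hubs ≡ 3
      ∣pairs∣   : length pairs ≡ 2
      dominated : ∀ {x} → x ∈ xs → Adj H lone x → x ∈ hubs
      apart     : All Apart pairs

  private
    -- By four-cycle-chord a vertex adjacent to two pages is adjacent to both ends of the spine, giving a K₄.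
    one-page : ∀ {xs} (B : Book xs) → let open Book B in ∀ {a c c′} → a ≢ p → a ≢ q → c ≢ c′ →
               c ∈ c₁ ∷ c₂ ∷ c₃ ∷ [] → c′ ∈ c₁ ∷ c₂ ∷ c₃ ∷ [] → Adj H a c → Adj H a c′ → ⊥
    one-page B {a} {c} {c′} a≢p a≢q c≢c′ c∈ c′∈ ac ac′ with Book.page B c∈ | Book.page B c′∈
    ... | pc , qc , e | pc′ , qc′ , e′ = clash (four-colours-collide (colour p) (colour q) (colour c) (colour a))
      where
      open Book B
      proper : ∀ {x y} → Adj H x y → colour x ≢ colour y
      proper xy z = ≡false⇒≢true (same-colour z) xy
      joined : ∀ {r} → a ≢ r → Adj H r c → Adj H r c′ → Adj H r a
      joined a≢r rc rc′ with four-cycle-chord tree rc (Adj-sym H ac) ac′ (Adj-sym H rc′) (a≢r ∘ sym) c≢c′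
      ... | inj₁ ra = ra
      ... | inj₂ cc′ = contradiction (trans e (sym e′)) (proper cc′)
      clash : _ → ⊥
      clash (inj₁ z) = proper pq z
      clash (inj₂ (inj₁ z)) = proper pc z
      clash (inj₂ (inj₂ (inj₁ z))) = proper (joined a≢p pc pc′) z
      clash (inj₂ (inj₂ (inj₂ (inj₁ z)))) = proper qc z
      clash (inj₂ (inj₂ (inj₂ (inj₂ (inj₁ z))))) = proper (joined a≢q qc qc′) z
      clash (inj₂ (inj₂ (inj₂ (inj₂ (inj₂ z))))) = proper ac (sym z)

    -- A page d₁ not adjacent to a takes over the role of isolated vertex from v: its neighbours are
    -- among p, q, b, since v sees only a and b and pages are pairwise non-adjacent. Now a can be
    -- matched with d₂ and v with d₃.
    split-book : ∀ {xs} v a b p q d₁ d₂ d₃ → Unique xs → xs ↭ v ∷ a ∷ b ∷ p ∷ q ∷ d₁ ∷ d₂ ∷ d₃ ∷ [] →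
                 (∀ {x} → x ∈ v ∷ a ∷ b ∷ p ∷ q ∷ d₁ ∷ d₂ ∷ d₃ ∷ [] → Adj H v x → x ≡ a ⊎ x ≡ b) →
                 adj H a d₁ ≡ false → adj H a d₂ ≡ false → colour d₁ ≡ colour d₂ → colour d₁ ≡ colour d₃ → Split xs
    split-book v a b p q d₁ d₂ d₃ u perm f ad₁ ad₂ e₂ e₃ = record
      { lone = d₁ ; hubs = p ∷ q ∷ b ∷ [] ; pairs = (a , d₂) ∷ (v , d₃) ∷ []
      ; perm = ↭-trans perm
          (↭-trans (shift d₁ (v ∷ a ∷ b ∷ p ∷ q ∷ []) _) (prep d₁
          (↭-trans (shift p (v ∷ a ∷ b ∷ []) _) (prep p
          (↭-trans (shift q (v ∷ a ∷ b ∷ []) _) (prep q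
          (↭-trans (shift b (v ∷ a ∷ []) _) (prep b
          (shift a (v ∷ []) _)))))))))
      ; ∣hubs∣ = refl ; ∣pairs∣ = refl
      ; dominated = λ x∈ → dom (∈-resp-↭ perm x∈)
      ; apart = ad₂ ∷ vd₃ ∷ [] }
      where
      u′ = Unique-resp-↭ perm u
      outside : ∀ {x} → Adj H v x → x ∈ p ∷ q ∷ d₁ ∷ d₂ ∷ d₃ ∷ [] → ⊥
      outside vx x∈ with f (there (there (there x∈))) vx
      ... | inj₁ refl = head∉ (Unique-tail u′) (there x∈) refl
      ... | inj₂ refl = head∉ (Unique-tail (Unique-tail u′)) x∈ refl
      vd₃ : adj H v d₃ ≡ false
      vd₃ = ≢true⇒false λ vx → outside vx (there (there (there (there (here refl)))))
      dom : ∀ {x} → x ∈ v ∷ a ∷ b ∷ p ∷ q ∷ d₁ ∷ d₂ ∷ d₃ ∷ [] → Adj H d₁ x → x ∈ p ∷ q ∷ b ∷ []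
      dom (here refl) e = ⊥-elim (outside (Adj-sym H e) (there (there (here refl))))
      dom (there (here refl)) e = contradiction (Adj-sym H e) (≡false⇒≢true ad₁)
      dom (there (there (here refl))) e = there (there (here refl))
      dom (there (there (there (here refl)))) e = here refl
      dom (there (there (there (there (here refl))))) e = there (here refl)
      dom (there (there (there (there (there (here refl)))))) e = contradiction e (≡false⇒≢true (irrefl H d₁))
      dom (there (there (there (there (there (there (here refl))))))) e = contradiction e (≡false⇒≢true (same-colour e₂))
      dom (there (there (there (there (there (there (there (here refl)))))))) e = contradiction e (≡false⇒≢true (same-colour e₃))

  -- One round of peeling gives v, a, b and leaves five vertices. If these form a book, a sees at
  -- most one page by `one-page`, so two pages remain for `split-book`.
  eight : ∀ xs → Unique xs → length xs ≡ 8 → Split xs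
  eight (x₁ ∷ x₂ ∷ x₃ ∷ xs) u len with isolate x₁ x₂ x₃ xs u
  ... | v , a , b , ys , perm , f with five ys (ℕₚ.+-cancelˡ-≡ 3 _ _ (trans (sym (↭-length perm)) len))
  ...   | inj₁ (prs , z , q , ∣prs∣ , apart) = record
    { lone = v ; hubs = a ∷ b ∷ z ∷ [] ; pairs = prs
    ; perm = ↭-trans perm (prep v (prep a (prep b (↭-trans q (++-comm (flat prs) (z ∷ []))))))
    ; ∣hubs∣ = refl ; ∣pairs∣ = ∣prs∣ ; dominated = dom ; apart = apart }
    where
    dom : ∀ {x} → x ∈ x₁ ∷ x₂ ∷ x₃ ∷ xs → Adj H v x → x ∈ a ∷ b ∷ z ∷ []
    dom x∈ e with f (∈-resp-↭ perm x∈) e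
    ... | inj₁ refl = here refl
    ... | inj₂ refl = there (here refl)
  ...   | inj₂ B = choose
    where
    open Book B renaming (perm to perm₅)
    full : x₁ ∷ x₂ ∷ x₃ ∷ xs ↭ v ∷ a ∷ b ∷ p ∷ q ∷ c₁ ∷ c₂ ∷ c₃ ∷ []
    full = ↭-trans perm (prep v (prep a (prep b perm₅)))
    u₈ = Unique-resp-↭ full u
    u₇ = Unique-tail u₈
    u₃ = Unique-tail (Unique-tail (Unique-tail (Unique-tail u₇)))
    f′ : ∀ {d₁ d₂ d₃} → v ∷ a ∷ b ∷ p ∷ q ∷ d₁ ∷ d₂ ∷ d₃ ∷ [] ↭ v ∷ a ∷ b ∷ ys →
         ∀ {x} → x ∈ v ∷ a ∷ b ∷ p ∷ q ∷ d₁ ∷ d₂ ∷ d₃ ∷ [] → Adj H v x → x ≡ a ⊎ x ≡ b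
    f′ r x∈ = f (∈-resp-↭ r x∈)
    pages : ∀ {d₁ d₂ d₃} → c₁ ∷ c₂ ∷ c₃ ∷ [] ↭ d₁ ∷ d₂ ∷ d₃ ∷ [] → adj H a d₁ ≡ false → adj H a d₂ ≡ false →
            Split (x₁ ∷ x₂ ∷ x₃ ∷ xs)
    pages {d₁} {d₂} {d₃} r ad₁ ad₂ = split-book v a b p q d₁ d₂ d₃ u
      (↭-trans full (prep v (prep a (prep b (prep p (prep q r))))))
      (f′ (↭-sym (prep v (prep a (prep b (↭-trans perm₅ (prep p (prep q r))))))))
      ad₁ ad₂ (trans (tint (here refl)) (sym (tint (there (here refl))))) (trans (tint (here refl)) (sym (tint (there (there (here refl))))))
      where
      tint : ∀ {c} → c ∈ d₁ ∷ d₂ ∷ d₃ ∷ [] → colour c ≡ colour c₁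
      tint c∈ = proj₂ (proj₂ (page (∈-resp-↭ (↭-sym r) c∈)))
    unique-page : ∀ {c c′} → c ≢ c′ → c ∈ c₁ ∷ c₂ ∷ c₃ ∷ [] → c′ ∈ c₁ ∷ c₂ ∷ c₃ ∷ [] → Adj H a c → adj H a c′ ≡ false
    unique-page c≢c′ c∈ c′∈ ac = ≢true⇒false λ ac′ → one-page B
      (head∉ u₇ (there (here refl))) (head∉ u₇ (there (there (here refl)))) c≢c′ c∈ c′∈ ac ac′
    choose : Split (x₁ ∷ x₂ ∷ x₃ ∷ xs)
    choose with adj H a c₁ in ac₁ | adj H a c₂ in ac₂
    ... | false | false = pages ↭-refl ac₁ ac₂
    ... | false | true  = pages (prep c₁ (shift c₃ (c₂ ∷ []) [])) ac₁
      (unique-page (head∉ (Unique-tail u₃) (here refl)) (there (here refl)) (there (there (here refl))) ac₂)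
    ... | true  | _     = pages (↭-trans (shift c₂ (c₁ ∷ []) _) (prep c₂ (shift c₃ (c₁ ∷ []) [])))
      (unique-page (head∉ u₃ (here refl)) (here refl) (there (here refl)) ac₁)
      (unique-page (head∉ u₃ (there (here refl))) (here refl) (there (there (here refl))) ac₁)

  -- `apart` is demanded only for j ≥ 1: for j = 0 the core is a single pair, and the target
  -- contains its edge.
  record Layout (p j : ℕ) : Set where
    field
      hubs      : List V
      pairs     : List Pair
      isolated  : List V
      perm      : allFin k ↭ hubs ++ flat pairs ++ isolated
      ∣hubs∣    : length hubs ≡ p
      ∣pairs∣   : length pairs ≡ suc j
      dominated : ∀ {v x} → v ∈ isolated → Adj H v x → x ∈ hubs
      apart     : 1 ≤ j → All Apart pairs

  private
    rearrange : ∀ (I A F R : List V) → I ++ A ++ F ++ R ↭ (R ++ A) ++ F ++ I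
    rearrange I A F R = ↭-trans (++-comm I (A ++ F ++ R)) (↭-trans (++⁺ʳ I (↭-trans (++⁺ˡ A (++-comm F R)) (shifts A R)))
      (Perm.↭-reflexive (trans (++-assoc R (A ++ F) I) (trans (cong (R ++_) (++-assoc A F I)) (sym (++-assoc R A (F ++ I)))))))

    allFin-length : length (allFin k) ≡ k
    allFin-length = length-tabulate id

  layout-0 : ∀ t → k ≡ 3 * t + 2 → Layout (2 * t) 0
  layout-0 t k≡ with peel t 2 (allFin k) (allFin⁺ k) (trans allFin-length k≡)
  ... | record { rest = a ∷ b ∷ [] ; isolated = I ; hit = A ; perm = perm ; ∣hit∣ = ∣A∣ ; dominated = dom } = record
    { hubs = A ; pairs = (a , b) ∷ [] ; isolated = I ; perm = ↭-trans perm (rearrange I A (a ∷ b ∷ []) [])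
    ; ∣hubs∣ = ∣A∣ ; ∣pairs∣ = refl ; dominated = λ v∈ e → dom v∈ (∈-allFin _) e ; apart = λ () }

  -- For j = 1 the method of `layout-2+` would look for its last pair among three vertices, too few
  -- to repeat a colour. Peeling therefore stops one round earlier, and `eight` provides the last
  -- isolated vertex, three hubs and both pairs.
  layout-1 : ∀ c → k ≡ 3 * (2 + c) + 2 → Layout (3 + 2 * c) 1
  layout-1 c k≡ with peel c 8 (allFin k) (allFin⁺ k) (trans allFin-length (trans k≡ (id₁ c)))
    where
    id₁ : ∀ c → 3 * (2 + c) + 2 ≡ 3 * c + 8
    id₁ = solve-∀
  ... | record { rest = rest ; isolated = I ; hit = A ; perm = perm ; ∣hit∣ = ∣A∣ ; ∣rest∣ = ∣rest∣ ; dominated = dom } = record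
    { hubs = hubs ++ A ; pairs = pairs ; isolated = lone ∷ I
    ; perm = full
    ; ∣hubs∣ = trans (length-++ hubs) (cong₂ _+_ ∣hubs∣ ∣A∣) ; ∣pairs∣ = ∣pairs∣
    ; dominated = dom′ ; apart = λ _ → apart }
    where
    uA : Unique (I ++ A ++ rest)
    uA = Unique-resp-↭ perm (allFin⁺ k)
    drop-prefix : ∀ (xs : List V) {ys} → Unique (xs ++ ys) → Unique ys
    drop-prefix []       u = u
    drop-prefix (x ∷ xs) u = drop-prefix xs (Unique-tail u)
    open Split (eight rest (drop-prefix A (drop-prefix I uA)) ∣rest∣) renaming (perm to perm₈; dominated to dom₈)
    full : allFin k ↭ (hubs ++ A) ++ flat pairs ++ lone ∷ I
    full = ↭-trans perm (↭-trans (++⁺ˡ I (++⁺ˡ A perm₈)) (↭-trans (++⁺ˡ I (shift lone A (hubs ++ flat pairs)))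
      (↭-trans (shift lone I (A ++ hubs ++ flat pairs))
      (↭-trans (prep lone (↭-trans (++⁺ˡ I (++⁺ˡ A (++-comm hubs (flat pairs)))) (rearrange I A (flat pairs) hubs)))
      (↭-trans (prep lone (Perm.↭-reflexive (sym (++-assoc (hubs ++ A) (flat pairs) I))))
      (↭-trans (↭-sym (shift lone ((hubs ++ A) ++ flat pairs) I)) (Perm.↭-reflexive (++-assoc (hubs ++ A) (flat pairs) (lone ∷ I)))))))))
    lone∈rest : lone ∈ rest
    lone∈rest = ∈-resp-↭ (↭-sym perm₈) (here refl)
    dom′ : ∀ {v x} → v ∈ lone ∷ I → Adj H v x → x ∈ hubs ++ A
    dom′ (there v∈) e = ∈-++⁺ʳ hubs (dom v∈ (∈-allFin _) e)
    dom′ {x = x} (here refl) e with ∈-++⁻ I (∈-resp-↭ perm (∈-allFin x))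
    -- An isolated x has all its neighbours in A, so it cannot see `lone`, which lies in `rest`.
    ... | inj₁ x∈I = ⊥-elim (Unique-++-disjoint A (drop-prefix I uA) (dom x∈I (∈-allFin _) (Adj-sym H e)) lone∈rest)
    ... | inj₂ x∈ with ∈-++⁻ A x∈
    ...   | inj₁ x∈A = ∈-++⁺ʳ hubs x∈A
    ...   | inj₂ x∈rest = ∈-++⁺ˡ (dom₈ x∈rest e)

  -- Put J = 2 + j and t = J + c. After c rounds 3J + 2 vertices remain: J + 1 pairs and J further
  -- vertices, which join the 2c vertices hit by the peeling to make 2t - J hubs.
  layout-2+ : ∀ j c → k ≡ 3 * (2 + j + c) + 2 → Layout (2 + j + 2 * c) (2 + j)
  layout-2+ j c k≡ with peel c (2 * (3 + j) + (2 + j)) (allFin k) (allFin⁺ k) (trans allFin-length (trans k≡ (id₁ j c)))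
    where
    id₁ : ∀ j c → 3 * (2 + j + c) + 2 ≡ 3 * c + (2 * (3 + j) + (2 + j))
    id₁ = solve-∀
  ... | record { rest = rest ; isolated = I ; hit = A ; perm = perm ; ∣hit∣ = ∣A∣ ; ∣rest∣ = ∣rest∣ ; dominated = dom }
    with pair-up (3 + j) j rest ∣rest∣
  ...   | record { pairs = prs ; rest = R ; perm = perm′ ; ∣pairs∣ = ∣prs∣ ; ∣rest∣ = ∣R∣ ; apart = apart } = record
    { hubs = R ++ A ; pairs = prs ; isolated = I
    ; perm = ↭-trans perm (↭-trans (++⁺ˡ I (++⁺ˡ A perm′)) (rearrange I A (flat prs) R))
    ; ∣hubs∣ = trans (length-++ R) (cong₂ _+_ ∣R∣ ∣A∣) ; ∣pairs∣ = ∣prs∣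
    ; dominated = λ v∈ e → ∈-++⁺ʳ R (dom v∈ (∈-allFin _) e) ; apart = λ _ → apart }

-- Positions in a layout and the embedding into the target

data At {A : Set} : List A → ℕ → A → Set where
  here  : ∀ {x xs} → At (x ∷ xs) 0 x
  there : ∀ {x xs i a} → At xs i a → At (x ∷ xs) (suc i) a

module _ {A : Set} where

  At⇒∈ : ∀ {xs : List A} {i a} → At xs i a → a ∈ xs
  At⇒∈ here      = here refl
  At⇒∈ (there p) = there (At⇒∈ p)

  ∈⇒At : ∀ {xs : List A} {a} → a ∈ xs → ∃ λ i → At xs i a
  ∈⇒At (here refl) = 0 , here
  ∈⇒At (there a∈)  = let i , p = ∈⇒At a∈ in suc i , there p

  At-< : ∀ {xs : List A} {i a} → At xs i a → i < length xs
  At-< here      = s≤s z≤n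
  At-< (there p) = s≤s (At-< p)

  At-functional : ∀ {xs : List A} {i a b} → At xs i a → At xs i b → a ≡ b
  At-functional here      here      = refl
  At-functional (there p) (there q) = At-functional p q

  At-injective : ∀ {xs : List A} {i i′ a} → Unique xs → At xs i a → At xs i′ a → i ≡ i′
  At-injective u here      here      = refl
  At-injective u here      (there q) = contradiction refl (head∉ u (At⇒∈ q))
  At-injective u (there p) here      = contradiction refl (head∉ u (At⇒∈ p))
  At-injective u (there p) (there q) = cong suc (At-injective (Unique-tail u) p q)

  At-++⁺ˡ : ∀ {xs ys : List A} {i a} → At xs i a → At (xs ++ ys) i a
  At-++⁺ˡ here      = here
  At-++⁺ˡ (there p) = there (At-++⁺ˡ p)

  At-++⁻ : ∀ (xs : List A) {ys i a} → At (xs ++ ys) i a → At xs i a ⊎ ∃ λ i′ → i ≡ length xs + i′ × At ys i′ a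
  At-++⁻ []       p         = inj₂ (_ , refl , p)
  At-++⁻ (x ∷ xs) here      = inj₁ here
  At-++⁻ (x ∷ xs) (there p) with At-++⁻ xs p
  ... | inj₁ q            = inj₁ (there q)
  ... | inj₂ (i′ , e , q) = inj₂ (i′ , cong suc e , q)

At-map⁻ : ∀ {A B : Set} (f : A → B) xs {i b} → At (map f xs) i b → ∃ λ a → At xs i a × b ≡ f a
At-map⁻ f (x ∷ xs) here      = x , here , refl
At-map⁻ f (x ∷ xs) (there p) = let a , q , e = At-map⁻ f xs p in a , there q , e

module Embedding {k n : ℕ} {H : Graph k} (tree : IsTwoTree k H) (k≤n : k ≤ n) where
  open Layouts tree

  module _ {p j : ℕ} (layout : Layout p j) {M : ℕ → ℕ → Set} (M? : ∀ a b → Dec (M a b))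
    (open-pairs : ∀ {a b i i′} → At (flat (Layout.pairs layout)) i a → At (flat (Layout.pairs layout)) i′ b →
                  Adj H a b → M (p + i) (p + i′))
    where
    open Layout layout

    private
      order : List (Fin k)
      order = hubs ++ flat pairs ++ isolated

      unique : Unique order
      unique = Unique-resp-↭ perm (allFin⁺ k)

      place : ∀ a → ∃ λ i → At order i a
      place a = ∈⇒At (∈-resp-↭ perm (∈-allFin a))

      pos : Fin k → ℕ
      pos a = proj₁ (place a)

      pos<k : ∀ a → pos a < k
      pos<k a = <-≤-trans (At-< (proj₂ (place a))) (≤-reflexive (trans (sym (↭-length perm)) (length-tabulate id)))

      f : Fin k → Fin n
      f a = fromℕ< (<-≤-trans (pos<k a) k≤n)

      toℕ-f : ∀ a → toℕ (f a) ≡ pos a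
      toℕ-f a = toℕ-fromℕ< (<-≤-trans (pos<k a) k≤n)

      f-injective : Injective _≡_ _≡_ f
      f-injective {a} {b} e = At-functional (proj₂ (place a))
        (subst (λ i → At order i b) (trans (sym (toℕ-f b)) (trans (cong toℕ (sym e)) (toℕ-f a))) (proj₂ (place b)))

      hub-position : ∀ {a} → a ∈ hubs → pos a < p
      hub-position {a} a∈ with ∈⇒At a∈
      ... | i , q = subst (_< p) (At-injective unique (At-++⁺ˡ q) (proj₂ (place a))) (<-≤-trans (At-< q) (≤-reflexive ∣hubs∣))

      data Zone (a : Fin k) : Set where
        hub  : pos a < p → Zone a
        pair : ∀ {i} → pos a ≡ p + i → At (flat pairs) i a → Zone a
        lone : a ∈ isolated → Zone a

      zone : ∀ a → Zone a
      zone a with At-++⁻ hubs (proj₂ (place a))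
      ... | inj₁ q = hub (<-≤-trans (At-< q) (≤-reflexive ∣hubs∣))
      ... | inj₂ (i , e , q) with At-++⁻ (flat pairs) q
      ...   | inj₁ r = pair (trans e (cong (_+ i) ∣hubs∣)) r
      ...   | inj₂ (_ , _ , r) = lone (At⇒∈ r)

      joined : ∀ {a b} → Adj H a b → pos a < p ⊎ pos b < p ⊎ M (pos a) (pos b)
      joined {a} {b} e with zone a | zone b
      ... | hub x    | _        = inj₁ x
      ... | lone x   | _        = inj₂ (inj₁ (hub-position (dominated x e)))
      ... | pair _ _ | hub y    = inj₂ (inj₁ y)
      ... | pair _ _ | lone y   = inj₁ (hub-position (dominated y (Adj-sym H e)))
      ... | pair x q | pair y r = inj₂ (inj₂ (subst₂ M (sym x) (sym y) (open-pairs q r e)))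

    embed : ∀ {G : Graph n} → target p k M? ⊆ G → ContainsSubgraph G H
    embed T⊆G = f , f-injective , λ a b e → T⊆G {f a} {f b} (⇒target p k M? {f a} {f b}
      ( (λ q → Adj⇒≢ H e (f-injective q))
      , subst (_< k) (sym (toℕ-f a)) (pos<k a)
      , subst (_< k) (sym (toℕ-f b)) (pos<k b)
      , transport (joined e) ))
      where
      transport : ∀ {a b} → pos a < p ⊎ pos b < p ⊎ M (pos a) (pos b) →
                  toℕ (f a) < p ⊎ toℕ (f b) < p ⊎ M (toℕ (f a)) (toℕ (f b))
      transport {a} {b} x rewrite toℕ-f a | toℕ-f b = x

  length-flat : ∀ prs → length (flat prs) ≡ length prs + length prs
  length-flat prs = trans (length-++ (map proj₁ prs)) (cong₂ _+_ (length-map proj₁ prs) (length-map proj₂ prs))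

  embed-0 : ∀ {p m} {G : Graph n} → p + 2 ≡ m → Layout p 0 → target p k (bothBelow? m) ⊆ G → ContainsSubgraph G H
  embed-0 {p} {G = G} refl layout T⊆G = embed layout (bothBelow? (p + 2)) (λ q r _ → inside q , inside r) {G} (λ {a} {b} → T⊆G {a} {b})
    where
    open Layout layout
    inside : ∀ {i a} → At (flat pairs) i a → p + i < p + 2
    inside q = ℕₚ.+-monoʳ-< p (<-≤-trans (At-< q) (≤-reflexive (trans (length-flat pairs) (cong₂ _+_ ∣pairs∣ ∣pairs∣))))

  embed-suc : ∀ {p m} {G : Graph n} j → 1 ≤ j → p + (suc j + suc j) ≡ m → Layout p j → target p k (unmatched? m j) ⊆ G → ContainsSubgraph G H
  embed-suc {p} {G = G} j 1≤j refl layout T⊆G = embed layout (unmatched? (p + (suc j + suc j)) j)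
    (λ q r e → (inside q , inside r) , unmatched q r e , unmatched r q (Adj-sym H e)) {G} (λ {a} {b} → T⊆G {a} {b})
    where
    open Layout layout
    inside : ∀ {i a} → At (flat pairs) i a → p + i < p + (suc j + suc j)
    inside q = ℕₚ.+-monoʳ-< p (<-≤-trans (At-< q) (≤-reflexive (trans (length-flat pairs) (cong₂ _+_ ∣pairs∣ ∣pairs∣))))
    ∣firsts∣ : length (map proj₁ pairs) ≡ suc j
    ∣firsts∣ = trans (length-map proj₁ pairs) ∣pairs∣
    ∣seconds∣ : length (map proj₂ pairs) ≡ suc j
    ∣seconds∣ = trans (length-map proj₂ pairs) ∣pairs∣
    -- In the flat list the first members occupy positions 0 to j and the second ones j + 1 to 2j +
    -- 1. A shift by j + 1 within it leads from a first member to its own partner, which `apart`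
    -- makes non-adjacent.
    unmatched : ∀ {a b i i′} → At (flat pairs) i a → At (flat pairs) i′ b → Adj H a b → p + i′ ≢ p + i + suc j
    unmatched {i = i} {i′} q r e eq with At-++⁻ (map proj₁ pairs) q | At-++⁻ (map proj₁ pairs) r
      | ℕₚ.+-cancelˡ-≡ p _ _ (trans eq (+-assoc p i (suc j)))
    ... | _ | inj₁ r₁ | i′≡ = <⇒≱ (At-< r₁) (≤-trans (≤-reflexive ∣firsts∣) (≤-trans (m≤n+m (suc j) i) (≤-reflexive (sym i′≡))))
    ... | inj₂ (i₂ , i≡ , _) | inj₂ (i₂′ , i′≡₂ , r₂) | i′≡ = <⇒≱ (At-< r₂)
      (≤-trans (≤-reflexive (trans ∣seconds∣ (sym ∣firsts∣))) (≤-trans (m≤m+n _ i₂)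
        (≤-reflexive (trans (sym i≡) (ℕₚ.+-cancelʳ-≡ (suc j) _ _ (trans (sym i′≡) (trans i′≡₂ (trans (cong (_+ i₂′) ∣firsts∣) (+-comm (suc j) i₂′)))))))))
    ... | inj₁ q₁ | inj₂ (i₂′ , i′≡₂ , r₂) | i′≡ with At-map⁻ proj₁ pairs q₁ | At-map⁻ proj₂ pairs r₂
    ...   | x , qx , refl | y , ry , refl with At-functional qx (subst (λ l → At pairs l y) i₂′≡i ry)
      where
      i₂′≡i : i₂′ ≡ i
      i₂′≡i = ℕₚ.+-cancelʳ-≡ (suc j) _ _ (trans (trans (+-comm i₂′ (suc j)) (cong (_+ i₂′) (sym ∣firsts∣))) (trans (sym i′≡₂) i′≡))
    ...     | refl = ≡false⇒≢true (All.lookup (apart 1≤j) (At⇒∈ qx)) e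

-- Final case distinction by the number of large degrees

clique⊇ : ∀ {n k} {G : Graph n} {C} → k ≤ ∣ C ∣ → Clique G C → (H : Graph k) → ContainsSubgraph G H
clique⊇ {k = k} {C = C} le clique H with enumerate k C le
... | f , f-inj , in-C = f , f-inj , λ a b e → clique (in-C a) (in-C b) (Adj⇒≢ H e ∘ f-inj)

cut : ∀ {n} (π : Fin n → ℕ) → NonIncreasing π → ∀ c m →
      (∀ v → toℕ v < m → c ≤ π v) ⊎ ∃ λ p → p < m × (∀ v → toℕ v < p → c ≤ π v) × (∀ v → p ≤ toℕ v → π v < c)
cut π sorted c zero = inj₁ λ v ()
cut {n} π sorted c (suc m) with cut π sorted c m
... | inj₂ (p , p<m , r) = inj₂ (p , ℕₚ.m<n⇒m<1+n p<m , r)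
... | inj₁ high with m <? n
...   | no m≮n = inj₁ λ v _ → high v (<-≤-trans (toℕ<n v) (≮⇒≥ m≮n))
...   | yes m<n with c ≤? π (fromℕ< m<n)
...     | no c≰ = inj₂ (m , ≤-refl , high , λ v m≤v → ≤-<-trans (sorted (fromℕ< m<n) v (≤-trans (≤-reflexive (toℕ-fromℕ< m<n)) m≤v)) (≰⇒> c≰))
...     | yes c≤ = inj₁ high′
  where
  high′ : ∀ v → toℕ v < suc m → c ≤ π v
  high′ v v< = ≤-trans c≤ (sorted v (fromℕ< m<n) (≤-trans (≤-pred v<) (≤-reflexive (sym (toℕ-fromℕ< m<n)))))

theorem4p3 : (t n : ℕ) → 2 ≤ t → 20 * (t * t) + 31 * t + 12 ≤ n →
    (π : Fin n → ℕ) → Graphic π →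
    4 * t * n < σ π + 4 * (t * t) + 2 * t →
    Σ (Graph n) λ G → Realization π G ×
    ((H : Graph (3 * t + 2)) → IsTwoTree (3 * t + 2) H → ContainsSubgraph G H)
theorem4p3 t n 2≤t n≥ π (sorted , G₀ , r₀) dense = main (cut π sorted (3 * t + 1) (2 * t))
  where
  1≤t : 1 ≤ t
  1≤t = ≤-trans (s≤s z≤n) 2≤t
  dense′ : 4 * t * n < sum π + 4 * (t * t) + 2 * t
  dense′ = subst (λ x → 4 * t * n < x + 4 * (t * t) + 2 * t) (sumˡ-allFin π) dense
  open Dense t 1≤t n≥ π sorted G₀ r₀ dense′ using (3t+2≤n)
  Result : Set
  Result = Σ (Graph n) λ G → Realization π G × ((H : Graph (3 * t + 2)) → IsTwoTree (3 * t + 2) H → ContainsSubgraph G H)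

  many : (∀ v → toℕ v < 2 * t → 3 * t + 1 ≤ π v) → Result
  many high with ManyHighDegrees.realization t 1≤t n≥ π sorted G₀ r₀ dense′ high
  ... | inj₁ (G , r , T⊆G) = G , r , λ H tree →
    Embedding.embed-0 tree 3t+2≤n {G = G} refl (Layouts.layout-0 tree t refl) (λ {a} {b} → T⊆G {a} {b})
  ... | inj₂ (G , r , C , size , clique) = G , r , λ H _ → clique⊇ {G = G} size (λ {a} {b} → clique {a} {b}) H

  few : ∀ p j → p + suc j ≡ 2 * t → (∀ v → toℕ v < p → 3 * t + 1 ≤ π v) → (∀ v → p ≤ toℕ v → π v ≤ 3 * t) → Result
  few p j p+j high low = G , r , λ H tree →
    Embedding.embed-suc tree 3t+2≤n {G = G} (suc j) (s≤s z≤n) size (layout tree) (λ {a} {b} → T⊆G {a} {b})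
    where
    open FewHighDegrees t 1≤t n≥ π sorted G₀ r₀ dense′ p (suc j) p+j (s≤s z≤n) high low using (j≤t; realization)
    G = proj₁ realization
    r = proj₁ (proj₂ realization)
    T⊆G : target p (3 * t + 2) (unmatched? (2 * t + suc j + 2) (suc j)) ⊆ G
    T⊆G {a} {b} = proj₂ (proj₂ realization) {a} {b}
    size : p + (suc (suc j) + suc (suc j)) ≡ 2 * t + suc j + 2
    size = trans (id₁ p j) (cong (λ x → x + suc j + 2) p+j)
      where
      id₁ : ∀ p j → p + (suc (suc j) + suc (suc j)) ≡ p + suc j + suc j + 2
      id₁ = solve-∀
    layout : ∀ {H} (tree : IsTwoTree (3 * t + 2) H) → Layouts.Layout tree p (suc j)
    layout tree = go j p+j j≤t
      where
      go : ∀ j → p + suc j ≡ 2 * t → suc j ≤ t → Layouts.Layout tree p (suc j)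
      -- One hub short of 2t: `layout-1` starts from eight vertices, and this is where t ≥ 2 is
      -- essential.
      go zero e _ with m≤n⇒∃[o]m+o≡n 2≤t
      ... | c , t≡ = subst (λ x → Layouts.Layout tree x 1) (ℕₚ.+-cancelʳ-≡ 1 _ _ (trans (id₁ c) (trans (cong (2 *_) t≡) (sym e))))
                       (Layouts.layout-1 tree c (cong (λ x → 3 * x + 2) (sym t≡)))
        where
        id₁ : ∀ c → 3 + 2 * c + 1 ≡ 2 * (2 + c)
        id₁ = solve-∀
      go (suc j) e j≤ with m≤n⇒∃[o]m+o≡n j≤
      ... | c , t≡ = subst (λ x → Layouts.Layout tree x (2 + j)) (ℕₚ.+-cancelʳ-≡ (2 + j) _ _ (trans (id₁ j c) (trans (cong (2 *_) t≡) (sym e))))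
                       (Layouts.layout-2+ tree j c (cong (λ x → 3 * x + 2) (sym t≡)))
        where
        id₁ : ∀ j c → 2 + j + 2 * c + (2 + j) ≡ 2 * (2 + j + c)
        id₁ = solve-∀

  main : _ → Result
  main (inj₁ high) = many high
  main (inj₂ (p , p<2t , high , low)) with m≤n⇒∃[o]m+o≡n p<2t
  ... | j , e = few p j (trans (ℕₚ.+-suc p j) e) high λ v p≤v → ≤-pred (≤-trans (low v p≤v) (≤-reflexive (+-comm (3 * t) 1)))
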